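{- Let $a,b$ be integers with $2 \le a \le 2b$ and $2 \le b \le 2a$. The $(a,b)$-benzel can be tiled by bones if and only if there is an integer $k \ge 2$ such that $a = k(3k-1)/2$ and $b = k(3k+1)/2$, or $a = k(3k+1)/2$ and $b = k(3k-1)/2$.
   Context: Identify the plane with $\mathbb{C}$ and let $\omega = e^{2\pi i/3}$. Let $L_{ -1} = \{x + y\omega : x,y \in \mathbb{Z},\ x+y \equiv -1 \pmod 3\}$. Each $\alpha \in L_{ -1}$ is the center of a unit hexagonal cell with corners $\alpha \pm 1, \alpha \pm \omega, \alpha \pm \omega^2$; these cells tile the plane. For integers $a,b$ with $2 \le a \le 2b$ and $2 \le b \le 2a$, the $(a,b)$-benzel is the union of all unit cells lying entirely within the hexagon with vertices $a\omega+b$, $-a\omega^2-b$, $a\omega^2+b\omega$, $-a-b\omega$, $a+b\omega^2$, $-a\omega-b\omega^2$. A bone (tribone) is the union of three cells with centers $\alpha, \alpha+d, \alpha+2d$, where $\alpha \in L_{ -1}$ and $d \in \{\pm(1-\omega), \pm(\omega-\omega^2), \pm(\omega^2-1)\}$ (three consecutive cells with collinear centers, in any of the three orientations). A tiling by bones is a partition of the region into bones (interiors disjoint, union equal to the region). -}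

module Defs where

open import Data.Integer using (ℤ; +_; -_; _+_; _-_; _*_; _≤_)
open import Data.Integer.Divisibility using (_∣_)
open import Data.Product using (_×_; _,_; Σ; ∃)
open import Data.Fin using (Fin)
open import Data.Nat using (ℕ)
open import Relation.Binary.PropositionalEquality using (_≡_)

-- A point x + yω of the Eisenstein lattice ℤ[ω], ω = e^{2πi/3},
-- is represented by its coordinates (x , y) ∈ ℤ × ℤ.
Pt : Set
Pt = ℤ × ℤ

_⊕_ : Pt → Pt → Pt
(x , y) ⊕ (u , v) = (x + u , y + v)

_⊖_ : Pt → Pt → Pt
(x , y) ⊖ (u , v) = (x - u , y - v)

-- Sign-carrying cross product: Im(conj(p) q) = (√3/2) · cross p q
-- for p = p₁ + p₂ω, q = q₁ + q₂ω.  (√3/2 > 0, so signs agree.)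
cross : Pt → Pt → ℤ
cross (p₁ , p₂) (q₁ , q₂) = p₁ * q₂ - p₂ * q₁

one ω ω² : Pt
one = (+ 1 , + 0)
ω   = (+ 0 , + 1)
ω²  = (- + 1 , - + 1)

neg : Pt → Pt
neg (x , y) = (- x , - y)

scale : ℤ → Pt → Pt
scale k (x , y) = (k * x , k * y)

InL-1 : Pt → Set
InL-1 (x , y) = (+ 3) ∣ (x + y + + 1)

-- The hexagon vertices, in counterclockwise order:
-- aω+b, -aω²-b, aω²+bω, -a-bω, a+bω², -aω-bω².
module Hex (a b : ℤ) where
  bb : Pt
  bb = (b , + 0)
  aa : Pt
  aa = (a , + 0)
  v₁ v₂ v₃ v₄ v₅ v₆ : Pt
  v₁ = scale a ω ⊕ bb
  v₂ = neg (scale a ω² ⊕ bb)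
  v₃ = scale a ω² ⊕ scale b ω
  v₄ = neg (aa ⊕ scale b ω)
  v₅ = aa ⊕ scale b ω²
  v₆ = neg (scale a ω ⊕ scale b ω²)

LeftOf : Pt → Pt → Pt → Set
LeftOf u v p = + 0 ≤ cross (v ⊖ u) (p ⊖ u)

-- Closed (convex) hexagon with the above vertices, as the intersection
-- of the closed half-planes to the left of its counterclockwise edges.
InHexagon : ℤ → ℤ → Pt → Set
InHexagon a b p =
  LeftOf v₁ v₂ p × LeftOf v₂ v₃ p × LeftOf v₃ v₄ p ×
  LeftOf v₄ v₅ p × LeftOf v₅ v₆ p × LeftOf v₆ v₁ p
  where open Hex a b

-- The unit cell centred at α has corners α ± 1, α ± ω, α ± ω²;
-- being convex, it lies in the (convex) hexagon iff all six corners do.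
CellInHexagon : ℤ → ℤ → Pt → Set
CellInHexagon a b α =
  InHexagon a b (α ⊕ one) × InHexagon a b (α ⊖ one) ×
  InHexagon a b (α ⊕ ω)   × InHexagon a b (α ⊖ ω)   ×
  InHexagon a b (α ⊕ ω²)  × InHexagon a b (α ⊖ ω²)

BenzelCell : ℤ → ℤ → Pt → Set
BenzelCell a b α = InL-1 α × CellInHexagon a b α

data Dir : Set where
  d₁ d₂ d₃ d₄ d₅ d₆ : Dir

dirVec : Dir → Pt
dirVec d₁ = one ⊖ ω
dirVec d₂ = neg (one ⊖ ω)
dirVec d₃ = ω ⊖ ω²
dirVec d₄ = neg (ω ⊖ ω²)
dirVec d₅ = ω² ⊖ one
dirVec d₆ = neg (ω² ⊖ one)

-- A bone: centre α ∈ L_{-1} and direction d; its cells have centres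
-- α, α+d, α+2d.
record Bone : Set where
  constructor bone
  field
    base  : Pt
    base∈ : InL-1 base
    dir   : Dir

CellOf : Pt → Bone → Set
CellOf c (bone α _ d) =
  (c ≡ α) Data.Sum.⊎ ((c ≡ α ⊕ dirVec d) Data.Sum.⊎ (c ≡ α ⊕ scale (+ 2) (dirVec d)))
  where import Data.Sum

-- A tiling of the (a,b)-benzel by bones: finitely many bones, every cell
-- of every bone is a benzel cell, and every benzel cell lies in exactly
-- one of the bones (so the bones' interiors are disjoint and their union
-- is the benzel).
TilingByBones : ℤ → ℤ → ℕ → Set
TilingByBones a b n =
  Σ (Fin n → Bone) λ T →
    ((i : Fin n) (c : Pt) → CellOf c (T i) → BenzelCell a b c) ×
    ((c : Pt) → BenzelCell a b c →
       Σ (Fin n) λ i → CellOf c (T i) × ((j : Fin n) → CellOf c (T j) → j ≡ i))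

BenzelTileable : ℤ → ℤ → Set
BenzelTileable a b = ∃ λ n → TilingByBones a b n

{-# OPTIONS --safe #-}
module Submission where

open import Defs
open import Data.Empty using (⊥; ⊥-elim)
open import Data.Fin using (Fin; zero; suc; toℕ; fromℕ<; remQuot; combine)
open import Data.Fin.Properties using (toℕ<n; toℕ-injective; toℕ-fromℕ<; remQuot-combine; combine-remQuot)
open import Data.Integer using (ℤ; +_; -[1+_]; -_; _+_; _-_; _*_; _≤_; +≤+)
open import Data.Integer.Divisibility using (_∣_)
open import Data.Integer.Divisibility.Signed using (module _∣_; divides; ∣⇒∣ᵤ; ∣ᵤ⇒∣)
import Data.Integer.Properties as ℤₚ
open import Data.Integer.Tactic.RingSolver using (solve; solve-∀)
open import Data.List using (_∷_; [])
open import Data.Nat as ℕ using (ℕ; zero; suc; z≤n; s≤s)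
open import Data.Nat.DivMod using (m%n<n; m≡m%n+[m/n]*n; +-distrib-/-∣ʳ; m*n/n≡m)
open import Data.Nat.Divisibility using (n∣m*n)
import Data.Nat.Properties as ℕₚ
open import Data.Nat.Tactic.RingSolver using () renaming (solve-∀ to ℕ-solve-∀)
open import Data.Product using (_×_; _,_; proj₁; proj₂; ∃; ∃-syntax)
open import Data.Sum using (_⊎_; inj₁; inj₂; [_,_]′) renaming (map to ⊎-map)
open import Function using (id; _∘_)
open import Function.Bundles using (_⇔_; mk⇔)
open import Relation.Binary.PropositionalEquality
  using (_≡_; _≢_; refl; sym; trans; cong; cong₂; subst; subst₂; module ≡-Reasoning)
open import Relation.Nullary using (¬_; Dec; yes; no)
open import Relation.Nullary.Decidable using (map′; _×-dec_)
open import Algebra.Properties.AbelianGroup ℤₚ.+-0-abelianGroup using (∙-cancelˡ; ∙-cancelʳ)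

-- Necessity is the Conway–Lagarias argument, with a Heisenberg group in place of the tiling group.  The
-- horizontal edges of the hexagonal grid carry one of three elements T 0, T 1, T 2, according to the colour
-- of the cell above; a tiling changes the values on the edges inside its bones so that the holonomy around
-- every cell becomes trivial.  Sweeping the benzel column by column, the products of the T's along its lower
-- and its upper boundary agree.  Write a = x + 2y + δ and b = 2x + y + δ with δ ∈ {0, 1, 2}: the two central
-- coordinates agree only if δ = 0 and (x - y)² = x + y, and then k = |x - y|.
--
-- For sufficiency, the discrete parabola through the generalised pentagonal numbers and its two rotations
-- cut the benzel into three congruent sectors, and each sector is tiled by parallel bones.

-- Integer inequalities

-- The abelian part of the holonomy decides nothing: for each δ the planar coordinates of the two
-- boundary products coincide identically in x and y, and all the information sits in the central
-- coordinate, which measures twice a signed area. So a central extension of the plane is the right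
-- target. It suffices because a bone along a slanted axis requires only that the values forced on
-- its second inner edge by its middle cell and by its last cell agree; three plane vectors with sum
-- zero, consecutive ones having cross product 1, satisfy this.
--
-- In the converse direction, cells are sorted by lines v - w = 3 μ - 1. On such a line both
-- parabola arms that bound a sector turn into the same comparison of μ with a triangular number,
-- which is why the line has a number of cells divisible by 3. The pentagonal numbers are what makes
-- the sides of the benzel meet the longer lines exactly at the ends of bones.

infix 4 0≤_
-- A record rather than a synonym, so that Agda does not unfold the products in i before the ring solver sees them.
record 0≤_ (i : ℤ) : Set where
  constructor [_]
  field
    unwrap : + 0 ≤ i
open 0≤_

infixl 6 _⊹_
_⊹_ : ∀ {i j} → 0≤ i → 0≤ j → 0≤ i + j
[ p ] ⊹ [ q ] = [ ℤₚ.+-mono-≤ p q ]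

infixl 7 _⊠_
_⊠_ : ∀ {i j} → 0≤ i → 0≤ j → 0≤ i * j
_⊠_ {+ m} {+ n} _ _ = [ subst (+ 0 ≤_) (ℤₚ.pos-* m n) (+≤+ z≤n) ]

nat : ∀ n → 0≤ + n
nat n = [ +≤+ z≤n ]

-- Inequalities are proved by certificates: the quantity is rewritten by the ring solver as a
-- combination of terms known to be nonnegative. A contradiction, by `absurd`, is such a combination
-- that is identically a negative constant.
via : ∀ {i j} → 0≤ j → i ≡ j → 0≤ i
via p refl = p

gap : ∀ {i j} → i ≤ j → 0≤ j - i
gap p = [ ℤₚ.i≤j⇒0≤j-i p ]

ungap : ∀ {i j} → 0≤ j - i → i ≤ j
ungap [ p ] = ℤₚ.0≤i-j⇒j≤i p

absurd : ∀ n {i} → 0≤ i → -[1+ n ] ≡ i → ⊥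
absurd n [ () ] refl

0≤-dec : ∀ i → 0≤ i ⊎ 0≤ - + 1 - i
0≤-dec (+ n)     = inj₁ (nat n)
0≤-dec -[1+ n ]  = inj₂ (via (nat n) (negsuc n))
  where
  negsuc : ∀ n → - + 1 - -[1+ n ] ≡ + n
  negsuc n = refl

-- Integer rounding: 3 i is a multiple of 3, so a bound on it may be off by 2 without harm. This is
-- how divisibility by 3 enters the certificates.
0≤-third : ∀ i → 0≤ + 3 * i + + 2 → 0≤ i
0≤-third i p = [ id , ⊥-elim ∘ negative ]′ (0≤-dec i)
  where
  negative : 0≤ - + 1 - i → ⊥
  negative q = absurd 0 (p ⊹ nat 3 ⊠ q) (solve (i ∷ []))

0≤-half : ∀ i → 0≤ + 2 * i + + 1 → 0≤ i
0≤-half i p = [ id , ⊥-elim ∘ negative ]′ (0≤-dec i)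
  where
  negative : 0≤ - + 1 - i → ⊥
  negative q = absurd 0 (p ⊹ nat 2 ⊠ q) (solve (i ∷ []))

0≤-cancel : ∀ f i → 0≤ f - + 1 → 0≤ f * i → 0≤ i
0≤-cancel f i f>0 p = [ id , ⊥-elim ∘ negative ]′ (0≤-dec i)
  where
  negative : 0≤ - + 1 - i → ⊥
  negative q = absurd 0 (p ⊹ f>0 ⊠ q ⊹ f>0 ⊹ q) (solve (f ∷ i ∷ []))

-- The benzel in the coordinates u = x, v = -y, w = y - x, with u + v + w = 0

record Within (A B x y : ℤ) : Set where
  constructor within
  field
    au : 0≤ A + x
    av : 0≤ A + - y
    aw : 0≤ A + (y - x)
    bu : 0≤ B - x
    bv : 0≤ B - - y
    bw : 0≤ B - (y - x)

module Benzel (a b : ℤ) (0<a : 0≤ a - + 1) (0<b : 0≤ b - + 1) (f≥0 : 0≤ + 2 * b - a) (g≥0 : 0≤ + 2 * a - b) where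

  -- The left-hand sides of these six identities are the unfolded cross products of `LeftOf`. The
  -- edges have direction vectors 2b - a and 2a - b times a unit, alternately, so each half-plane is
  -- one bound on u, v or w times the length of its edge.
  side1 : ∀ x y →
    ((- (a * - + 1 + b)) - (a * + 0 + b)) * (y - (a * + 1 + + 0)) - ((- (a * - + 1 + + 0)) - (a * + 1 + + 0)) * (x - (a * + 0 + b))
      ≡ (+ 2 * b - a) * (a + - y)
  side1 x y = solve (a ∷ b ∷ x ∷ y ∷ [])

  side2 : ∀ x y →
    ((a * - + 1 + b * + 0) - (- (a * - + 1 + b))) * (y - (- (a * - + 1 + + 0))) - ((a * - + 1 + b * + 1) - (- (a * - + 1 + + 0))) * (x - (- (a * - + 1 + b)))
      ≡ (+ 2 * a - b) * (b - (y - x))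
  side2 x y = solve (a ∷ b ∷ x ∷ y ∷ [])

  side3 : ∀ x y →
    ((- (a + b * + 0)) - (a * - + 1 + b * + 0)) * (y - (a * - + 1 + b * + 1)) - ((- (+ 0 + b * + 1)) - (a * - + 1 + b * + 1)) * (x - (a * - + 1 + b * + 0))
      ≡ (+ 2 * b - a) * (a + x)
  side3 x y = solve (a ∷ b ∷ x ∷ y ∷ [])

  side4 : ∀ x y →
    ((a + b * - + 1) - (- (a + b * + 0))) * (y - (- (+ 0 + b * + 1))) - ((+ 0 + b * - + 1) - (- (+ 0 + b * + 1))) * (x - (- (a + b * + 0)))
      ≡ (+ 2 * a - b) * (b - - y)
  side4 x y = solve (a ∷ b ∷ x ∷ y ∷ [])

  side5 : ∀ x y →
    ((- (a * + 0 + b * - + 1)) - (a + b * - + 1)) * (y - (+ 0 + b * - + 1)) - ((- (a * + 1 + b * - + 1)) - (+ 0 + b * - + 1)) * (x - (a + b * - + 1))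
      ≡ (+ 2 * b - a) * (a + (y - x))
  side5 x y = solve (a ∷ b ∷ x ∷ y ∷ [])

  side6 : ∀ x y →
    ((a * + 0 + b) - (- (a * + 0 + b * - + 1))) * (y - (- (a * + 1 + b * - + 1))) - ((a * + 1 + + 0) - (- (a * + 1 + b * - + 1))) * (x - (- (a * + 0 + b * - + 1)))
      ≡ (+ 2 * a - b) * (b - x)
  side6 x y = solve (a ∷ b ∷ x ∷ y ∷ [])

  hexagon← : ∀ x y → Within a b x y → InHexagon a b (x , y)
  hexagon← x y (within au av aw bu bv bw) =
    unwrap (via (f≥0 ⊠ av) (side1 x y)) ,
    unwrap (via (g≥0 ⊠ bw) (side2 x y)) ,
    unwrap (via (f≥0 ⊠ au) (side3 x y)) ,
    unwrap (via (g≥0 ⊠ bv) (side4 x y)) ,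
    unwrap (via (f≥0 ⊠ aw) (side5 x y)) ,
    unwrap (via (g≥0 ⊠ bu) (side6 x y))

  hexagon→ : ∀ x y → InHexagon a b (x , y) → Within a b x y
  hexagon→ x y (h₁ , h₂ , h₃ , h₄ , h₅ , h₆) = cases (0≤-dec (+ 2 * b - a - + 1)) (0≤-dec (+ 2 * a - b - + 1))
    where
    cancel-f : ∀ {i} → 0≤ + 2 * b - a - + 1 → 0≤ (+ 2 * b - a) * i → 0≤ i
    cancel-f {i} = 0≤-cancel (+ 2 * b - a) i
    cancel-g : ∀ {i} → 0≤ + 2 * a - b - + 1 → 0≤ (+ 2 * a - b) * i → 0≤ i
    cancel-g {i} = 0≤-cancel (+ 2 * a - b) i
    r₁ = subst 0≤_ (side1 x y) [ h₁ ]
    r₂ = subst 0≤_ (side2 x y) [ h₂ ]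
    r₃ = subst 0≤_ (side3 x y) [ h₃ ]
    r₄ = subst 0≤_ (side4 x y) [ h₄ ]
    r₅ = subst 0≤_ (side5 x y) [ h₅ ]
    r₆ = subst 0≤_ (side6 x y) [ h₆ ]
    cases : 0≤ + 2 * b - a - + 1 ⊎ 0≤ - + 1 - (+ 2 * b - a - + 1) →
            0≤ + 2 * a - b - + 1 ⊎ 0≤ - + 1 - (+ 2 * a - b - + 1) → Within a b x y
    cases (inj₁ p) (inj₁ q) = within (cancel-f p r₃) (cancel-f p r₁) (cancel-f p r₅) (cancel-g q r₆) (cancel-g q r₄) (cancel-g q r₂)
    -- If a = 2b or b = 2a, three sides degenerate to points, but the other three imply the missing bounds.
    cases (inj₂ p) (inj₁ q) = within
      (via (p ⊹ cancel-g q r₄ ⊹ cancel-g q r₂) (solve (a ∷ b ∷ x ∷ y ∷ [])))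
      (via (p ⊹ cancel-g q r₆ ⊹ cancel-g q r₂) (solve (a ∷ b ∷ x ∷ y ∷ [])))
      (via (p ⊹ cancel-g q r₆ ⊹ cancel-g q r₄) (solve (a ∷ b ∷ x ∷ y ∷ [])))
      (cancel-g q r₆) (cancel-g q r₄) (cancel-g q r₂)
    cases (inj₁ p) (inj₂ q) = within (cancel-f p r₃) (cancel-f p r₁) (cancel-f p r₅)
      (via (q ⊹ cancel-f p r₁ ⊹ cancel-f p r₅) (solve (a ∷ b ∷ x ∷ y ∷ [])))
      (via (q ⊹ cancel-f p r₃ ⊹ cancel-f p r₅) (solve (a ∷ b ∷ x ∷ y ∷ [])))
      (via (q ⊹ cancel-f p r₃ ⊹ cancel-f p r₁) (solve (a ∷ b ∷ x ∷ y ∷ [])))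
    cases (inj₂ p) (inj₂ q) = ⊥-elim (absurd 1 (p ⊹ q ⊹ 0<a ⊹ 0<b) (solve (a ∷ b ∷ [])))

  -- Passing from the centre of a cell to a corner changes each of u, v, w by at most 1; hence the
  -- bounds for centres are those of the hexagon with a - 1 and b - 1.
  corner← : ∀ x y dx dy → 0≤ + 1 + dx → 0≤ + 1 - dx → 0≤ + 1 + dy → 0≤ + 1 - dy →
    0≤ + 1 + (dy - dx) → 0≤ + 1 - (dy - dx) →
    Within (a - + 1) (b - + 1) x y → InHexagon a b (x + dx , y + dy)
  corner← x y dx dy x⁺ x⁻ y⁺ y⁻ z⁺ z⁻ (within au av aw bu bv bw) = hexagon← (x + dx) (y + dy) (within
    (via (au ⊹ x⁺) (solve (a ∷ x ∷ dx ∷ [])))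
    (via (av ⊹ y⁻) (solve (a ∷ y ∷ dy ∷ [])))
    (via (aw ⊹ z⁺) (solve (a ∷ x ∷ y ∷ dx ∷ dy ∷ [])))
    (via (bu ⊹ x⁻) (solve (b ∷ x ∷ dx ∷ [])))
    (via (bv ⊹ y⁺) (solve (b ∷ y ∷ dy ∷ [])))
    (via (bw ⊹ z⁻) (solve (b ∷ x ∷ y ∷ dx ∷ dy ∷ []))))

  cell← : ∀ x y → Within (a - + 1) (b - + 1) x y → CellInHexagon a b (x , y)
  cell← x y c =
    corner← x y (+ 1) (+ 0) (nat 2) (nat 0) (nat 1) (nat 1) (nat 0) (nat 2) c ,
    corner← x y (- + 1) (+ 0) (nat 0) (nat 2) (nat 1) (nat 1) (nat 2) (nat 0) c ,
    corner← x y (+ 0) (+ 1) (nat 1) (nat 1) (nat 2) (nat 0) (nat 2) (nat 0) c ,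
    corner← x y (+ 0) (- + 1) (nat 1) (nat 1) (nat 0) (nat 2) (nat 0) (nat 2) c ,
    corner← x y (- + 1) (- + 1) (nat 0) (nat 2) (nat 0) (nat 2) (nat 1) (nat 1) c ,
    corner← x y (+ 1) (+ 1) (nat 2) (nat 0) (nat 2) (nat 0) (nat 1) (nat 1) c

  cell→ : ∀ x y → CellInHexagon a b (x , y) → Within (a - + 1) (b - + 1) x y
  cell→ x y (p₁ , p₂ , p₃ , p₄ , _ , _) = within
    -- Each bound is read off at a corner where its coordinate is extreme.
    (via (Within.au (hexagon→ (x - + 1) (y - + 0) p₂)) (solve (a ∷ x ∷ [])))
    (via (Within.av (hexagon→ (x + + 0) (y + + 1) p₃)) (solve (a ∷ y ∷ [])))
    (via (Within.aw (hexagon→ (x - + 0) (y - + 1) p₄)) (solve (a ∷ x ∷ y ∷ [])))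
    (via (Within.bu (hexagon→ (x + + 1) (y + + 0) p₁)) (solve (b ∷ x ∷ [])))
    (via (Within.bv (hexagon→ (x - + 0) (y - + 1) p₄)) (solve (b ∷ y ∷ [])))
    (via (Within.bw (hexagon→ (x + + 0) (y + + 1) p₃)) (solve (b ∷ x ∷ y ∷ [])))

-- Flat connections with values in the Heisenberg group

-- The symplectic form of the Heisenberg group: the central coordinate picks up the cross product of
-- the planar parts. Powers and inverses are therefore coordinatewise, and a product of planar
-- vectors with sum zero has twice the signed area of their polygon as central coordinate.
record Heis : Set where
  no-eta-equality
  pattern
  constructor ⟨_,_,_⟩
  field
    e₁ e₂ area : ℤ

infixl 7 _∙_
_∙_ : Heis → Heis → Heis
⟨ p , q , n ⟩ ∙ ⟨ p′ , q′ , n′ ⟩ = ⟨ p + p′ , q + q′ , n + n′ + (p * q′ - q * p′) ⟩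

_⁻¹ : Heis → Heis
⟨ p , q , n ⟩ ⁻¹ = ⟨ - p , - q , - n ⟩

ε : Heis
ε = ⟨ + 0 , + 0 , + 0 ⟩

⟨⟩-cong : ∀ {p p′ q q′ n n′} → p ≡ p′ → q ≡ q′ → n ≡ n′ → ⟨ p , q , n ⟩ ≡ ⟨ p′ , q′ , n′ ⟩
⟨⟩-cong refl refl refl = refl

∙-assoc : ∀ g h k → (g ∙ h) ∙ k ≡ g ∙ (h ∙ k)
∙-assoc ⟨ p , q , n ⟩ ⟨ p′ , q′ , n′ ⟩ ⟨ p″ , q″ , n″ ⟩ =
  ⟨⟩-cong (lin p p′ p″) (lin q q′ q″) (quad p q n p′ q′ n′ p″ q″ n″)
  where
  lin : ∀ x y z → x + y + z ≡ x + (y + z)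
  lin = solve-∀
  quad : ∀ p q n p′ q′ n′ p″ q″ n″ →
    n + n′ + (p * q′ - q * p′) + n″ + ((p + p′) * q″ - (q + q′) * p″)
      ≡ n + (n′ + n″ + (p′ * q″ - q′ * p″)) + (p * (q′ + q″) - q * (p′ + p″))
  quad = solve-∀

∙-identityˡ : ∀ g → ε ∙ g ≡ g
∙-identityˡ ⟨ p , q , n ⟩ = ⟨⟩-cong (lin p) (lin q) (quad p q n)
  where
  lin : ∀ x → + 0 + x ≡ x
  lin = solve-∀
  quad : ∀ p q n → + 0 + n + (+ 0 * q - + 0 * p) ≡ n
  quad = solve-∀

∙-identityʳ : ∀ g → g ∙ ε ≡ g
∙-identityʳ ⟨ p , q , n ⟩ = ⟨⟩-cong (lin p) (lin q) (quad p q n)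
  where
  lin : ∀ x → x + + 0 ≡ x
  lin = solve-∀
  quad : ∀ p q n → n + + 0 + (p * + 0 - q * + 0) ≡ n
  quad = solve-∀

prod : ℕ → (ℕ → Heis) → Heis
prod zero    f = ε
prod (suc n) f = f 0 ∙ prod n (λ i → f (suc i))

prod-cong : ∀ n {f g : ℕ → Heis} → (∀ i → i ℕ.< n → f i ≡ g i) → prod n f ≡ prod n g
prod-cong zero    eq = refl
prod-cong (suc n) eq = cong₂ _∙_ (eq 0 (s≤s z≤n)) (prod-cong n (λ i i<n → eq (suc i) (s≤s i<n)))

-- Pasting of commuting squares: `b i` and `t i` are the lower and upper edge of the i-th square.
-- Here `northeast` is a bound variable for the holonomies along the sides shared by consecutive
-- squares, not the axis.
telescope : ∀ n (b t northeast : ℕ → Heis) → (∀ i → i ℕ.< n → b i ∙ northeast (suc i) ≡ northeast i ∙ t i) →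
  northeast 0 ∙ prod n t ≡ prod n b ∙ northeast n
telescope zero    b t northeast eq = trans (∙-identityʳ (northeast 0)) (sym (∙-identityˡ (northeast 0)))
telescope (suc n) b t northeast eq = begin
  northeast 0 ∙ (t 0 ∙ P)             ≡⟨ ∙-assoc (northeast 0) (t 0) P ⟨
  northeast 0 ∙ t 0 ∙ P               ≡⟨ cong (_∙ P) (eq 0 (s≤s z≤n)) ⟨
  b 0 ∙ northeast 1 ∙ P               ≡⟨ ∙-assoc (b 0) (northeast 1) P ⟩
  b 0 ∙ (northeast 1 ∙ P)             ≡⟨ cong (b 0 ∙_) (telescope n (λ i → b (suc i)) (λ i → t (suc i)) (λ i → northeast (suc i)) (λ i i<n → eq (suc i) (s≤s i<n))) ⟩
  b 0 ∙ (Q ∙ northeast (suc n))       ≡⟨ ∙-assoc (b 0) Q (northeast (suc n)) ⟨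
  b 0 ∙ Q ∙ northeast (suc n)         ∎
  where
  open ≡-Reasoning
  P Q : Heis
  P = prod n (λ i → t (suc i))
  Q = prod n (λ i → b (suc i))

-- Period 3 makes a northern bone flat with the same value on all its horizontal edges. For the
-- slanted bones, `T (1 + r) ∙ T (2 + r) ⁻¹` must equal `T r ⁻¹ ∙ T (2 + r) ⁻¹ ∙ T r ∙ T (1 + r)`,
-- and `T (2 + r) ∙ T r ⁻¹` must equal `T r ⁻¹ ∙ T (1 + r) ⁻¹ ∙ T (2 + r) ∙ T (1 + r)`. Both hold
-- because the three vectors have sum zero and consecutive ones have cross product 1.
T : ℕ → Heis
T 0 = ⟨ + 1 , + 0 , + 0 ⟩
T 1 = ⟨ + 0 , + 1 , + 0 ⟩
T 2 = ⟨ - + 1 , - + 1 , + 0 ⟩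
T (suc (suc (suc r))) = T r

-- Values on the edges of the hexagonal grid

-- Cells have coordinates (m , k): (m , k + 1) is the northern neighbour of (m , k) in column m, its eastern
-- neighbours in column m + 1 are (m + 1 , k) and (m + 1 , k + 1).  The colour of (m , k) is k + m mod 3.
data Axis : Set where
  north southeast northeast : Axis

data Role : Set where
  first second third : Role

data Label : Set where
  none : Label
  at   : Axis → Role → Label

-- Whether the edge between two neighbours lies on the boundary of bones (free), or separates the first two
-- (front) or the last two (back) cells of a bone.
data Status : Set where
  free front back : Status

leaving entering : Role → Status
leaving first  = front
leaving second = back
leaving third  = free
entering first  = free
entering second = front
entering third  = back

fwd bwd : Axis → Label → Status
fwd north (at north r) = leaving r
fwd southeast (at southeast r) = leaving r
fwd northeast (at northeast r) = leaving r
fwd _ _        = free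
bwd north (at north r) = entering r
bwd southeast (at southeast r) = entering r
bwd northeast (at northeast r) = entering r
bwd _ _        = free

-- The value on the edge by which a cell of colour r is left along the given axis.  Free edges are standard;
-- the others are forced by flatness of the first and of the last cell of a bone.
edge : Axis → Status → ℕ → Heis
edge north free r = T (1 ℕ.+ r)
edge north front r = T r
edge north back  r = T (2 ℕ.+ r)
edge _ free r = ε
edge _ front r = T r ⁻¹ ∙ T (1 ℕ.+ r)
edge northeast back  r = T r ⁻¹ ∙ T (1 ℕ.+ r) ⁻¹ ∙ T (2 ℕ.+ r) ∙ T (1 ℕ.+ r)
edge southeast back  r = T r ⁻¹ ∙ T (2 ℕ.+ r) ⁻¹ ∙ T r ∙ T (1 ℕ.+ r)

edge-period : ∀ ax s r → edge ax s (3 ℕ.+ r) ≡ edge ax s r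
edge-period north free r = refl
edge-period north front r = refl
edge-period north back r = refl
edge-period southeast free r = refl
edge-period southeast front r = refl
edge-period southeast back r = refl
edge-period northeast free r = refl
edge-period northeast front r = refl
edge-period northeast back r = refl

-- The paths around a cell from its south-western to its north-eastern corner have equal holonomy.
flat : ∀ ax ro r → let l = at ax ro in
  edge northeast (bwd northeast l) (1 ℕ.+ r) ∙ edge southeast (bwd southeast l) (2 ℕ.+ r) ∙ edge north (fwd north l) r
    ≡ edge north (bwd north l) (2 ℕ.+ r) ∙ edge southeast (fwd southeast l) r ∙ edge northeast (fwd northeast l) r
flat north first  0 = refl
flat north first  1 = refl
flat north first  2 = refl
flat north second 0 = refl
flat north second 1 = refl
flat north second 2 = refl
flat north third  0 = refl
flat north third  1 = refl
flat north third  2 = refl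
flat southeast first  0 = refl
flat southeast first  1 = refl
flat southeast first  2 = refl
flat southeast second 0 = refl
flat southeast second 1 = refl
flat southeast second 2 = refl
flat southeast third  0 = refl
flat southeast third  1 = refl
flat southeast third  2 = refl
flat northeast first  0 = refl
flat northeast first  1 = refl
flat northeast first  2 = refl
flat northeast second 0 = refl
flat northeast second 1 = refl
flat northeast second 2 = refl
flat northeast third  0 = refl
flat northeast third  1 = refl
flat northeast third  2 = refl
flat ax ro (suc (suc (suc r))) = begin
  _ ≡⟨ cong₂ _∙_ (cong₂ _∙_ (edge-period northeast (bwd northeast l) (1 ℕ.+ r)) (edge-period southeast (bwd southeast l) (2 ℕ.+ r))) (edge-period north (fwd north l) r) ⟩
  _ ≡⟨ flat ax ro r ⟩
  _ ≡⟨ cong₂ _∙_ (cong₂ _∙_ (edge-period north (bwd north l) (2 ℕ.+ r)) (edge-period southeast (fwd southeast l) r)) (edge-period northeast (fwd northeast l) r) ⟨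
  _ ∎
  where
  open ≡-Reasoning
  l : Label
  l = at ax ro

-- The three hypotheses say that the two cells at an edge agree on its status. `E` reads the status
-- from the cell that is left, and they allow it to be read from the cell that is entered.
module Transport (τ : ℕ → ℕ → Label)
  (conV : ∀ m k → bwd north (τ m (suc k)) ≡ fwd north (τ m k))
  (conF : ∀ m k → bwd southeast (τ (suc m) k) ≡ fwd southeast (τ m k))
  (conR : ∀ m k → bwd northeast (τ (suc m) (suc k)) ≡ fwd northeast (τ m k)) where

  E : Axis → ℕ → ℕ → Heis
  E ax m k = edge ax (fwd ax (τ m k)) (k ℕ.+ m)

  -- Holonomies upwards along the eastern side of column m, up to the south-eastern corner of cell (m , k)
  -- and to the south-western corner of cell (m + 1 , k + 1), respectively.
  right left : ℕ → ℕ → Heis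
  right m zero    = ε
  right m (suc k) = right m k ∙ E southeast m k ∙ E northeast m k
  left m k = right m k ∙ E southeast m k

  flat-cell : ∀ m k → τ (suc m) (suc k) ≢ none →
    E northeast m k ∙ E southeast m (suc k) ∙ E north (suc m) (suc k)
      ≡ E north (suc m) k ∙ E southeast (suc m) (suc k) ∙ E northeast (suc m) (suc k)
  flat-cell m k covered
    rewrite sym (conR m k) | sym (conF m (suc k)) | sym (conV (suc m) k) | ℕₚ.+-suc k m
    with τ (suc m) (suc k)
  ... | none     = ⊥-elim (covered refl)
  ... | at ax ro = begin
    -- The neighbours before a cell of colour `r` have colours r - 2 and r - 1, which `flat` writes
    -- as 1 + r and 2 + r; `edge-period` removes the difference of 3.
    edge northeast (bwd northeast l) (k ℕ.+ m) ∙ edge southeast (bwd southeast l) (suc (k ℕ.+ m)) ∙ v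
      ≡⟨ cong (_∙ v) (cong₂ _∙_ (edge-period northeast (bwd northeast l) (k ℕ.+ m)) (edge-period southeast (bwd southeast l) (suc (k ℕ.+ m)))) ⟨
    edge northeast (bwd northeast l) (1 ℕ.+ r) ∙ edge southeast (bwd southeast l) (2 ℕ.+ r) ∙ v
      ≡⟨ flat ax ro r ⟩
    edge north (bwd north l) (2 ℕ.+ r) ∙ f ∙ g
      ≡⟨ cong (λ h → h ∙ f ∙ g) (edge-period north (bwd north l) (suc (k ℕ.+ m))) ⟩
    edge north (bwd north l) (suc (k ℕ.+ m)) ∙ f ∙ g ∎
    where
    open ≡-Reasoning
    l : Label
    l = at ax ro
    r : ℕ
    r = suc (suc (k ℕ.+ m))
    v f g : Heis
    v = edge north (fwd north l) r
    f = edge southeast (fwd southeast l) r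
    g = edge northeast (fwd northeast l) r

  E-southeast-uncovered : ∀ m k → τ (suc m) k ≡ none → E southeast m k ≡ ε
  E-southeast-uncovered m k eq rewrite sym (conF m k) | eq = refl

  E-northeast-uncovered : ∀ m k → τ (suc m) (suc k) ≡ none → E northeast m k ≡ ε
  E-northeast-uncovered m k eq rewrite sym (conR m k) | eq = refl

  right-uncovered : ∀ m k → τ m k ≡ none → right m (suc k) ≡ right m k
  right-uncovered m k eq rewrite eq =
    trans (∙-identityʳ (right m k ∙ ε)) (∙-identityʳ (right m k))

  left-uncovered : ∀ m k → τ (suc m) (suc k) ≡ none → left m (suc k) ≡ left m k
  left-uncovered m k eq rewrite E-southeast-uncovered m (suc k) eq | E-northeast-uncovered m k eq =
    trans (∙-identityʳ (left m k ∙ ε)) (∙-identityʳ (left m k))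

  right-initial : ∀ m k → (∀ i → i ℕ.< k → τ m i ≡ none) → right m k ≡ ε
  right-initial m zero    eq = refl
  right-initial m (suc k) eq =
    trans (right-uncovered m k (eq k ℕₚ.≤-refl)) (right-initial m k (λ i i<k → eq i (ℕₚ.m<n⇒m<1+n i<k)))

  left-initial : ∀ m k → (∀ i → i ℕ.≤ k → τ (suc m) i ≡ none) → left m k ≡ ε
  left-initial m zero    eq = trans (∙-identityˡ (E southeast m 0)) (E-southeast-uncovered m 0 (eq 0 z≤n))
  left-initial m (suc k) eq =
    trans (left-uncovered m k (eq (suc k) ℕₚ.≤-refl)) (left-initial m k (λ i i≤k → eq i (ℕₚ.m≤n⇒m≤1+n i≤k)))

  module Column (m lo n : ℕ)
    (below  : ∀ k → k ℕ.≤ lo → τ (suc m) k ≡ none)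
    (inside : ∀ i → i ℕ.< n → τ (suc m) (suc i ℕ.+ lo) ≢ none)
    (above  : ∀ i → τ (suc m) (suc i ℕ.+ (n ℕ.+ lo)) ≡ none) where

    private
      b t : Heis
      b = T (suc lo ℕ.+ suc m)
      t = T (suc (n ℕ.+ lo) ℕ.+ suc m)

    -- Two paths are compared: along the bottom edge and then up the eastern side, or up the western
    -- side and then along the edge above the i-th covered cell. Each further covered cell is flat,
    -- so the path can be pushed across it; at the bottom both vertical parts are trivial.
    climb : ∀ i → i ℕ.≤ n →
      b ∙ right (suc m) (suc (i ℕ.+ lo)) ≡ left m (i ℕ.+ lo) ∙ E north (suc m) (i ℕ.+ lo)
    climb zero _ = begin
      b ∙ right (suc m) (suc lo)
        ≡⟨ cong (b ∙_) (right-initial (suc m) (suc lo) (λ { k (s≤s k≤lo) → below k k≤lo })) ⟩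
      b ∙ ε                            ≡⟨ trans (∙-identityʳ b) (sym (∙-identityˡ b)) ⟩
      ε ∙ b
        ≡⟨ cong₂ _∙_ (left-initial m lo below) (cong (λ l → edge north (fwd north l) (lo ℕ.+ suc m)) (below lo ℕₚ.≤-refl)) ⟨
      left m lo ∙ E north (suc m) lo ∎
      where open ≡-Reasoning
    climb (suc i) i<n = begin
      b ∙ (r ∙ f ∙ g)                       ≡⟨ cong (b ∙_) (∙-assoc r f g) ⟩
      b ∙ (r ∙ (f ∙ g))                     ≡⟨ ∙-assoc b r (f ∙ g) ⟨
      b ∙ r ∙ (f ∙ g)                       ≡⟨ cong (_∙ (f ∙ g)) (climb i (ℕₚ.<⇒≤ i<n)) ⟩
      l ∙ v ∙ (f ∙ g)                       ≡⟨ ∙-assoc l v (f ∙ g) ⟩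
      l ∙ (v ∙ (f ∙ g))                     ≡⟨ cong (l ∙_) (∙-assoc v f g) ⟨
      l ∙ (v ∙ f ∙ g)                       ≡⟨ cong (l ∙_) (flat-cell m (i ℕ.+ lo) (inside i i<n)) ⟨
      l ∙ (g′ ∙ f′ ∙ v′)                    ≡⟨ ∙-assoc l (g′ ∙ f′) v′ ⟨
      l ∙ (g′ ∙ f′) ∙ v′                    ≡⟨ cong (_∙ v′) (∙-assoc l g′ f′) ⟨
      l ∙ g′ ∙ f′ ∙ v′                      ∎
      where
      open ≡-Reasoning
      k = i ℕ.+ lo
      r = right (suc m) (suc k)
      l = left m k
      f = E southeast (suc m) (suc k)
      g = E northeast (suc m) (suc k)
      v = E north (suc m) k
      g′ = E northeast m k
      f′ = E southeast m (suc k)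
      v′ = E north (suc m) (suc k)

    beyond : ∀ i → b ∙ right (suc m) (suc (i ℕ.+ (n ℕ.+ lo))) ≡ left m (i ℕ.+ (n ℕ.+ lo)) ∙ t
    beyond zero = trans (climb n ℕₚ.≤-refl) (cong (left m (n ℕ.+ lo) ∙_) topmost)
      where
      topmost : E north (suc m) (n ℕ.+ lo) ≡ t
      -- Read from the uncovered cell above it, the topmost edge is free.
      topmost rewrite sym (conV (suc m) (n ℕ.+ lo)) | above 0 = refl
    beyond (suc i) = begin
      b ∙ right (suc m) (suc (suc k))   ≡⟨ cong (b ∙_) (right-uncovered (suc m) (suc k) (above i)) ⟩
      b ∙ right (suc m) (suc k)         ≡⟨ beyond i ⟩
      left m k ∙ t                      ≡⟨ cong (_∙ t) (left-uncovered m k (above i)) ⟨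
      left m (suc k) ∙ t                ∎
      where
      open ≡-Reasoning
      k = i ℕ.+ (n ℕ.+ lo)

  -- The region occupies columns 1 to N, and `K` is a row above all of it. The line west of column 1
  -- and the line east of column N each border an empty column, so their holonomies are trivial and
  -- the pasted columns leave only the two products.
  boundary : ∀ N K (lo n : ℕ → ℕ) →
    (∀ k → τ 0 k ≡ none) → (∀ k → τ (suc N) k ≡ none) →
    (∀ m → m ℕ.< N → n m ℕ.+ lo m ℕ.< K) →
    (∀ m → m ℕ.< N → ∀ k → k ℕ.≤ lo m → τ (suc m) k ≡ none) →
    (∀ m → m ℕ.< N → ∀ i → i ℕ.< n m → τ (suc m) (suc i ℕ.+ lo m) ≢ none) →
    (∀ m → m ℕ.< N → ∀ i → τ (suc m) (suc i ℕ.+ (n m ℕ.+ lo m)) ≡ none) →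
    prod N (λ m → T (suc (n m ℕ.+ lo m) ℕ.+ suc m)) ≡ prod N (λ m → T (suc (lo m) ℕ.+ suc m))
  boundary N K lo n start end K-large below inside above = begin
    prod N t                    ≡⟨ ∙-identityˡ _ ⟨
    ε ∙ prod N t                ≡⟨ cong (_∙ prod N t) (right-initial 0 K (λ i _ → start i)) ⟨
    right 0 K ∙ prod N t        ≡⟨ telescope N b t (λ m → right m K) step ⟩
    prod N b ∙ right N K        ≡⟨ cong (prod N b ∙_) last ⟩
    prod N b ∙ ε                ≡⟨ ∙-identityʳ _ ⟩
    prod N b                    ∎
    where
    open ≡-Reasoning
    b t : ℕ → Heis
    b m = T (suc (lo m) ℕ.+ suc m)
    t m = T (suc (n m ℕ.+ lo m) ℕ.+ suc m)

    uncovered : ∀ m → m ℕ.≤ N → τ m K ≡ none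
    uncovered zero    _   = start K
    uncovered (suc m) m<N with ℕₚ.m<n⇒0<n∸m (K-large m m<N) | ℕₚ.m∸n+n≡m (ℕₚ.<⇒≤ (K-large m m<N))
    ... | 0<d | eq with K ℕ.∸ (n m ℕ.+ lo m)
    ... | suc d = subst (λ k → τ (suc m) k ≡ none) eq (above m m<N d)

    last : right N K ≡ ε
    last = all N K end
      where
      all : ∀ m k → (∀ i → τ (suc m) i ≡ none) → right m k ≡ ε
      all m zero    eq = refl
      all m (suc k) eq rewrite all m k eq | E-southeast-uncovered m k (eq k) | E-northeast-uncovered m k (eq (suc k)) = refl

    step : ∀ m → m ℕ.< N → b m ∙ right (suc m) K ≡ right m K ∙ t m
    step m m<N = begin
      b m ∙ right (suc m) K        ≡⟨ cong (b m ∙_) (right-uncovered (suc m) K (uncovered (suc m) m<N)) ⟨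
      b m ∙ right (suc m) (suc K)  ≡⟨ subst (λ k → b m ∙ right (suc m) (suc k) ≡ left m k ∙ t m) (ℕₚ.m∸n+n≡m (ℕₚ.<⇒≤ (K-large m m<N))) (beyond (K ℕ.∸ (n m ℕ.+ lo m))) ⟩
      left m K ∙ t m               ≡⟨ cong (_∙ t m) (trans (cong (right m K ∙_) EF≡ε) (∙-identityʳ (right m K))) ⟩
      right m K ∙ t m              ∎
      where
      open Column m (lo m) (n m) (below m m<N) (inside m m<N) (above m m<N)
      EF≡ε : E southeast m K ≡ ε
      EF≡ε = cong (λ l → edge southeast (fwd southeast l) (K ℕ.+ m)) (uncovered m (ℕₚ.<⇒≤ m<N))

-- The labelling of cells induced by a tiling

-- The compass names refer to the picture reflected in the line through 0 and `stride northeast`.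
-- What matters is that northeast is the sum of north and southeast.
stride : Axis → Pt
stride north = (+ 1 , - + 1)
stride southeast = (+ 1 , + 2)
stride northeast = (+ 2 , + 1)

place : Pt → Axis → Role → Pt
place o ax first  = o
place o ax second = o ⊕ stride ax
place o ax third  = (o ⊕ stride ax) ⊕ stride ax

axis : Bone → Axis
axis (bone _ _ d₁) = north
axis (bone _ _ d₂) = north
axis (bone _ _ d₃) = southeast
axis (bone _ _ d₄) = southeast
axis (bone _ _ d₅) = northeast
axis (bone _ _ d₆) = northeast

origin : Bone → Pt
origin (bone α _ d₁) = α
origin (bone α _ d₂) = α ⊕ scale (+ 2) (dirVec d₂)
origin (bone α _ d₃) = α
origin (bone α _ d₄) = α ⊕ scale (+ 2) (dirVec d₄)
origin (bone α _ d₅) = α ⊕ scale (+ 2) (dirVec d₅)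
origin (bone α _ d₆) = α


⊕-assoc : ∀ α u v → (α ⊕ u) ⊕ v ≡ α ⊕ (u ⊕ v)
⊕-assoc (x , y) (u₁ , u₂) (v₁ , v₂) = cong₂ _,_ (ℤₚ.+-assoc x u₁ v₁) (ℤₚ.+-assoc y u₂ v₂)

⊕-return : ∀ α u v → u ⊕ (v ⊕ v) ≡ (+ 0 , + 0) → ((α ⊕ u) ⊕ v) ⊕ v ≡ α
⊕-return (x , y) u v eq = begin
  (((x , y) ⊕ u) ⊕ v) ⊕ v  ≡⟨ ⊕-assoc ((x , y) ⊕ u) v v ⟩
  ((x , y) ⊕ u) ⊕ (v ⊕ v)  ≡⟨ ⊕-assoc (x , y) u (v ⊕ v) ⟩
  (x , y) ⊕ (u ⊕ (v ⊕ v))  ≡⟨ cong ((x , y) ⊕_) eq ⟩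
  (x + + 0 , y + + 0)      ≡⟨ cong₂ _,_ (ℤₚ.+-identityʳ x) (ℤₚ.+-identityʳ y) ⟩
  (x , y)                  ∎
  where open ≡-Reasoning

place⇒CellOf : ∀ β ro → CellOf (place (origin β) (axis β) ro) β
place⇒CellOf (bone α _ d₁) first  = inj₁ refl
place⇒CellOf (bone α _ d₁) second = inj₂ (inj₁ refl)
place⇒CellOf (bone α _ d₁) third  = inj₂ (inj₂ (⊕-assoc α (dirVec d₁) (stride north)))
place⇒CellOf (bone α _ d₃) first  = inj₁ refl
place⇒CellOf (bone α _ d₃) second = inj₂ (inj₁ refl)
place⇒CellOf (bone α _ d₃) third  = inj₂ (inj₂ (⊕-assoc α (dirVec d₃) (stride southeast)))
place⇒CellOf (bone α _ d₆) first  = inj₁ refl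
place⇒CellOf (bone α _ d₆) second = inj₂ (inj₁ refl)
place⇒CellOf (bone α _ d₆) third  = inj₂ (inj₂ (⊕-assoc α (dirVec d₆) (stride northeast)))
place⇒CellOf (bone α _ d₂) first  = inj₂ (inj₂ refl)
place⇒CellOf (bone α _ d₂) second = inj₂ (inj₁ (⊕-assoc α (scale (+ 2) (dirVec d₂)) (stride north)))
place⇒CellOf (bone α _ d₂) third  = inj₁ (⊕-return α (scale (+ 2) (dirVec d₂)) (stride north) refl)
place⇒CellOf (bone α _ d₄) first  = inj₂ (inj₂ refl)
place⇒CellOf (bone α _ d₄) second = inj₂ (inj₁ (⊕-assoc α (scale (+ 2) (dirVec d₄)) (stride southeast)))
place⇒CellOf (bone α _ d₄) third  = inj₁ (⊕-return α (scale (+ 2) (dirVec d₄)) (stride southeast) refl)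
place⇒CellOf (bone α _ d₅) first  = inj₂ (inj₂ refl)
place⇒CellOf (bone α _ d₅) second = inj₂ (inj₁ (⊕-assoc α (scale (+ 2) (dirVec d₅)) (stride northeast)))
place⇒CellOf (bone α _ d₅) third  = inj₁ (⊕-return α (scale (+ 2) (dirVec d₅)) (stride northeast) refl)

CellOf⇒place : ∀ {c} β → CellOf c β → ∃[ ro ] c ≡ place (origin β) (axis β) ro
CellOf⇒place (bone α _ d₁) (inj₁ refl)        = first , refl
CellOf⇒place (bone α _ d₁) (inj₂ (inj₁ refl)) = second , refl
CellOf⇒place (bone α _ d₁) (inj₂ (inj₂ refl)) = third , sym (⊕-assoc α (dirVec d₁) (stride north))
CellOf⇒place (bone α _ d₃) (inj₁ refl)        = first , refl
CellOf⇒place (bone α _ d₃) (inj₂ (inj₁ refl)) = second , refl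
CellOf⇒place (bone α _ d₃) (inj₂ (inj₂ refl)) = third , sym (⊕-assoc α (dirVec d₃) (stride southeast))
CellOf⇒place (bone α _ d₆) (inj₁ refl)        = first , refl
CellOf⇒place (bone α _ d₆) (inj₂ (inj₁ refl)) = second , refl
CellOf⇒place (bone α _ d₆) (inj₂ (inj₂ refl)) = third , sym (⊕-assoc α (dirVec d₆) (stride northeast))
CellOf⇒place (bone α _ d₂) (inj₁ refl)        = third , sym (⊕-return α (scale (+ 2) (dirVec d₂)) (stride north) refl)
CellOf⇒place (bone α _ d₂) (inj₂ (inj₁ refl)) = second , sym (⊕-assoc α (scale (+ 2) (dirVec d₂)) (stride north))
CellOf⇒place (bone α _ d₂) (inj₂ (inj₂ refl)) = first , refl
CellOf⇒place (bone α _ d₄) (inj₁ refl)        = third , sym (⊕-return α (scale (+ 2) (dirVec d₄)) (stride southeast) refl)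
CellOf⇒place (bone α _ d₄) (inj₂ (inj₁ refl)) = second , sym (⊕-assoc α (scale (+ 2) (dirVec d₄)) (stride southeast))
CellOf⇒place (bone α _ d₄) (inj₂ (inj₂ refl)) = first , refl
CellOf⇒place (bone α _ d₅) (inj₁ refl)        = third , sym (⊕-return α (scale (+ 2) (dirVec d₅)) (stride northeast) refl)
CellOf⇒place (bone α _ d₅) (inj₂ (inj₁ refl)) = second , sym (⊕-assoc α (scale (+ 2) (dirVec d₅)) (stride northeast))
CellOf⇒place (bone α _ d₅) (inj₂ (inj₂ refl)) = first , refl

⊕-cancelʳ : ∀ {α β} v → α ⊕ v ≡ β ⊕ v → α ≡ β
⊕-cancelʳ {x , y} {x′ , y′} (v₁ , v₂) eq =
  cong₂ _,_ (∙-cancelʳ v₁ x x′ (cong proj₁ eq)) (∙-cancelʳ v₂ y y′ (cong proj₂ eq))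

-- All three strides go to the right, so the first coordinate alone tells the cells of a bone apart.
stride-positive : ∀ ax → ∃[ n ] proj₁ (stride ax) ≡ + suc n
stride-positive north = 0 , refl
stride-positive southeast = 0 , refl
stride-positive northeast = 1 , refl

index : Role → ℕ
index first  = 0
index second = 1
index third  = 2

index-injective : ∀ r s → index r ≡ index s → r ≡ s
index-injective first  first  _ = refl
index-injective second second _ = refl
index-injective third  third  _ = refl

place-abscissa : ∀ o ax ro → proj₁ (place o ax ro) ≡ proj₁ o + + index ro * proj₁ (stride ax)
place-abscissa (x , _) ax first  = lemma x (proj₁ (stride ax))
  where
  lemma : ∀ x d → x ≡ x + + 0 * d
  lemma = solve-∀
place-abscissa (x , _) ax second = lemma x (proj₁ (stride ax))
  where
  lemma : ∀ x d → x + d ≡ x + + 1 * d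
  lemma = solve-∀
place-abscissa (x , _) ax third  = lemma x (proj₁ (stride ax))
  where
  lemma : ∀ x d → x + d + d ≡ x + + 2 * d
  lemma = solve-∀

place-injective : ∀ o ax r s → place o ax r ≡ place o ax s → r ≡ s
place-injective o ax r s eq with stride-positive ax | place-abscissa o ax r | place-abscissa o ax s
... | n , pos | pr | ps rewrite pos = index-injective r s (ℤₚ.+-injective (ℤₚ.*-cancelʳ-≡ (+ index r) (+ index s) (+ suc n)
  (∙-cancelˡ (proj₁ o) (+ index r * + suc n) (+ index s * + suc n) (trans (sym pr) (trans (cong proj₁ eq) ps)))))

fwd-view : ∀ ax l → fwd ax l ≡ free ⊎ l ≡ at ax first ⊎ l ≡ at ax second
fwd-view north none = inj₁ refl
fwd-view north (at north first) = inj₂ (inj₁ refl)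
fwd-view north (at north second) = inj₂ (inj₂ refl)
fwd-view north (at north third) = inj₁ refl
fwd-view north (at southeast _) = inj₁ refl
fwd-view north (at northeast _) = inj₁ refl
fwd-view southeast none = inj₁ refl
fwd-view southeast (at southeast first) = inj₂ (inj₁ refl)
fwd-view southeast (at southeast second) = inj₂ (inj₂ refl)
fwd-view southeast (at southeast third) = inj₁ refl
fwd-view southeast (at north _) = inj₁ refl
fwd-view southeast (at northeast _) = inj₁ refl
fwd-view northeast none = inj₁ refl
fwd-view northeast (at northeast first) = inj₂ (inj₁ refl)
fwd-view northeast (at northeast second) = inj₂ (inj₂ refl)
fwd-view northeast (at northeast third) = inj₁ refl
fwd-view northeast (at north _) = inj₁ refl
fwd-view northeast (at southeast _) = inj₁ refl

bwd-view : ∀ ax l → bwd ax l ≡ free ⊎ l ≡ at ax second ⊎ l ≡ at ax third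
bwd-view north none = inj₁ refl
bwd-view north (at north first) = inj₁ refl
bwd-view north (at north second) = inj₂ (inj₁ refl)
bwd-view north (at north third) = inj₂ (inj₂ refl)
bwd-view north (at southeast _) = inj₁ refl
bwd-view north (at northeast _) = inj₁ refl
bwd-view southeast none = inj₁ refl
bwd-view southeast (at southeast first) = inj₁ refl
bwd-view southeast (at southeast second) = inj₂ (inj₁ refl)
bwd-view southeast (at southeast third) = inj₂ (inj₂ refl)
bwd-view southeast (at north _) = inj₁ refl
bwd-view southeast (at northeast _) = inj₁ refl
bwd-view northeast none = inj₁ refl
bwd-view northeast (at northeast first) = inj₁ refl
bwd-view northeast (at northeast second) = inj₂ (inj₁ refl)
bwd-view northeast (at northeast third) = inj₂ (inj₂ refl)
bwd-view northeast (at north _) = inj₁ refl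
bwd-view northeast (at southeast _) = inj₁ refl

fwd-first : ∀ ax → fwd ax (at ax first) ≡ front
fwd-first north = refl
fwd-first southeast = refl
fwd-first northeast = refl

fwd-second : ∀ ax → fwd ax (at ax second) ≡ back
fwd-second north = refl
fwd-second southeast = refl
fwd-second northeast = refl

bwd-second : ∀ ax → bwd ax (at ax second) ≡ front
bwd-second north = refl
bwd-second southeast = refl
bwd-second northeast = refl

bwd-third : ∀ ax → bwd ax (at ax third) ≡ back
bwd-third north = refl
bwd-third southeast = refl
bwd-third northeast = refl

-- An edge that is not free joins either first to second or second to third. The four implications
-- exclude that it is seen so from one side only.
consistent : ∀ ax l l′ →
  (l ≡ at ax first → l′ ≡ at ax second) → (l ≡ at ax second → l′ ≡ at ax third) →
  (l′ ≡ at ax second → l ≡ at ax first) → (l′ ≡ at ax third → l ≡ at ax second) →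
  bwd ax l′ ≡ fwd ax l
consistent ax l l′ f₁ f₂ b₁ b₂ with fwd-view ax l | bwd-view ax l′
... | inj₁ eq          | inj₁ eq′          = trans eq′ (sym eq)
... | inj₂ (inj₁ refl) | _                 rewrite f₁ refl = trans (bwd-second ax) (sym (fwd-first ax))
... | inj₂ (inj₂ refl) | _                 rewrite f₂ refl = trans (bwd-third ax) (sym (fwd-second ax))
... | inj₁ _           | inj₂ (inj₁ refl)  rewrite b₁ refl = trans (bwd-second ax) (sym (fwd-first ax))
... | inj₁ _           | inj₂ (inj₂ refl)  rewrite b₂ refl = trans (bwd-third ax) (sym (fwd-second ax))

module Labelling {a b n} (tiling : TilingByBones a b n)
  (cell : ℕ → ℕ → Pt) (benzel? : ∀ m k → Dec (BenzelCell a b (cell m k))) where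

  private
    bones : Fin n → Bone
    bones = proj₁ tiling
    contained = proj₁ (proj₂ tiling)
    covered   = proj₂ (proj₂ tiling)

  At : Pt → Axis → Role → Set
  At c ax ro = ∃[ i ] axis (bones i) ≡ ax × c ≡ place (origin (bones i)) ax ro

  occupant : ∀ c → BenzelCell a b c → ∃[ ax ] ∃[ ro ] At c ax ro
  occupant c benz = axis (bones i) , proj₁ located , i , refl , proj₂ located
    where
    i = proj₁ (covered c benz)
    located = CellOf⇒place (bones i) (proj₁ (proj₂ (covered c benz)))

  -- Exactness of the tiling identifies the two bones through their indices; within one bone,
  -- `place-injective` identifies the roles. This makes the label of a cell independent of the bone
  -- found for it.
  At-unique : ∀ {c ax ro ax′ ro′} → At c ax ro → At c ax′ ro′ → at ax ro ≡ at ax′ ro′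
  At-unique {c} {ax} {ro} {ax′} {ro′} (i , refl , refl) (j , refl , eq′)
    with covered c (contained i c (place⇒CellOf (bones i) ro))
  ... | i₀ , _ , unique
    with trans (unique i (place⇒CellOf (bones i) ro))
               (sym (unique j (subst (λ c → CellOf c (bones j)) (sym eq′) (place⇒CellOf (bones j) ro′))))
  ... | refl = cong (at ax) (place-injective (origin (bones i)) ax ro ro′ eq′)

  abstract
    τ : ℕ → ℕ → Label
    τ m k with benzel? m k
    ... | yes benz = let ax , ro , _ = occupant (cell m k) benz in at ax ro
    ... | no  _    = none

    τ-outside : ∀ m k → ¬ BenzelCell a b (cell m k) → τ m k ≡ none
    τ-outside m k ¬benz with benzel? m k
    ... | yes benz = ⊥-elim (¬benz benz)
    ... | no  _    = refl

    τ-inside : ∀ m k → BenzelCell a b (cell m k) → τ m k ≢ none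
    τ-inside m k benz with benzel? m k
    ... | no ¬benz = ⊥-elim (¬benz benz)
    ... | yes _    = λ ()

    τ-sound : ∀ m k {ax ro} → τ m k ≡ at ax ro → At (cell m k) ax ro
    τ-sound m k eq with benzel? m k
    τ-sound m k refl | yes benz = proj₂ (proj₂ (occupant (cell m k) benz))

    τ-complete : ∀ m k {ax ro} → At (cell m k) ax ro → τ m k ≡ at ax ro
    τ-complete m k {ax} {ro} here@(i , refl , eq) with benzel? m k
    ... | no ¬benz = ⊥-elim (¬benz (contained i (cell m k) (subst (λ c → CellOf c (bones i)) (sym eq) (place⇒CellOf (bones i) ro))))
    ... | yes benz = At-unique (proj₂ (proj₂ (occupant (cell m k) benz))) here

  τ-consistent : ∀ ax {m k m′ k′} → cell m′ k′ ≡ cell m k ⊕ stride ax → bwd ax (τ m′ k′) ≡ fwd ax (τ m k)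
  τ-consistent ax {m} {k} {m′} {k′} next = consistent ax (τ m k) (τ m′ k′)
    (λ eq → forward first second (λ _ → refl) (τ-sound m k eq))
    (λ eq → forward second third (λ _ → refl) (τ-sound m k eq))
    (λ eq → backward first second (λ _ → refl) (τ-sound m′ k′ eq))
    (λ eq → backward second third (λ _ → refl) (τ-sound m′ k′ eq))
    where
    forward : ∀ ro ro′ → (∀ o → place o ax ro′ ≡ place o ax ro ⊕ stride ax) →
      At (cell m k) ax ro → τ m′ k′ ≡ at ax ro′
    forward ro ro′ step (i , ax≡ , eq) = τ-complete m′ k′ (i , ax≡ , trans next (trans (cong (_⊕ stride ax) eq) (sym (step (origin (bones i))))))
    backward : ∀ ro ro′ → (∀ o → place o ax ro′ ≡ place o ax ro ⊕ stride ax) →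
      At (cell m′ k′) ax ro′ → τ m k ≡ at ax ro
    backward ro ro′ step (i , ax≡ , eq) = τ-complete m k (i , ax≡ , ⊕-cancelʳ (stride ax) (trans (sym next) (trans eq (step (origin (bones i))))))

infixr 8 _^_
_^_ : Heis → ℕ → Heis
g ^ zero  = ε
g ^ suc n = g ∙ g ^ n

-- The boundary of the benzel

-- Within each column, heights are measured from u = -A.  Going east, the lower boundary has x columns of height
-- 0, then ŷ pairs of columns of heights α + 3i and β + 3i, then x columns with steps of 3; the upper boundary is
-- the image of that of the (b , a)-benzel under the reflection exchanging a and b.
-- The constants depend on a + b mod 3.  With s = u - v constant along a column, the first column has
-- s + A + B = θ, and twice the height is at least c + 3i (from w ≤ B) in the i-th column after the first x.
record Shape : Set where
  field
    α β c θ : ℕ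
    α-lower : 0≤ + 2 * + α - + c
    α-upper : 0≤ + c + + 1 - + 2 * + α
    β-lower : 0≤ + 2 * + β - (+ c + + 3)
    β-upper : 0≤ + c + + 4 - + 2 * + β
    β≥2     : 0≤ + β - + 2
    c≤2     : 0≤ + 2 - + c
    θ≤2     : 0≤ + 2 - + θ
    c-θ     : 0≤ + 2 * + θ + + 1 - + c

-- The maximum ℓ of 0, s and ⌈q/2⌉.
record Low (ℓ s q : ℤ) : Set where
  field
    ℓ≥0   : 0≤ ℓ
    s≤ℓ   : 0≤ ℓ - s
    q≤2ℓ  : 0≤ + 2 * ℓ - q
    tight : 0≤ - ℓ ⊎ 0≤ s - ℓ ⊎ 0≤ q + + 1 - + 2 * ℓ

module Levels (shape : Shape) where
  open Shape shape

  rising : ℕ → ℕ → ℕ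
  rising b zero    = b
  rising b (suc n) = rising (3 ℕ.+ b) n

  pairs : ℕ → ℕ → ℕ → ℕ
  pairs zero    b n             = rising (2 ℕ.+ b) n
  pairs (suc y) b zero          = α ℕ.+ b
  pairs (suc y) b (suc zero)    = β ℕ.+ b
  pairs (suc y) b (suc (suc n)) = pairs y (3 ℕ.+ b) n

  level : ℕ → ℕ → ℕ → ℕ
  level zero    y n       = pairs y 0 n
  level (suc x) y zero    = 0
  level (suc x) y (suc n) = level x y n

  -- The sum s + 3 n, arranged so that it unfolds along the recursion of `level`: from one column to
  -- the next both s and q grow by 3.
  advance : ℕ → ℤ → ℤ
  advance zero    s = s
  advance (suc n) s = advance n (+ 3 + s)

  advance≡ : ∀ n s → advance n s ≡ s + + 3 * + n
  advance≡ zero    s = lemma s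
    where
    lemma : ∀ s → s ≡ s + + 3 * + 0
    lemma = solve-∀
  advance≡ (suc n) s = trans (advance≡ n (+ 3 + s)) (lemma s (+ n))
    where
    lemma : ∀ s n → + 3 + s + + 3 * n ≡ s + + 3 * (+ 1 + n)
    lemma = solve-∀

  rising-low : ∀ b n s q → s ≡ + b → 0≤ + 2 * + b - q → Low (+ rising b n) (advance n s) (advance n q)
  rising-low b zero s q refl q≤2b = record
    { ℓ≥0 = nat b ; s≤ℓ = via (nat 0) (lemma (+ b)) ; q≤2ℓ = q≤2b ; tight = inj₂ (inj₁ (via (nat 0) (lemma (+ b)))) }
    where
    lemma : ∀ b → b - b ≡ + 0
    lemma = solve-∀
  rising-low b (suc n) s q refl q≤2b =
    rising-low (3 ℕ.+ b) n (+ 3 + s) (+ 3 + q) refl (via (q≤2b ⊹ nat 3) (lemma (+ b) q))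
    where
    lemma : ∀ b q → + 2 * (+ 3 + b) - (+ 3 + q) ≡ + 2 * b - q + + 3
    lemma = solve-∀

  -- `b` is the base height of the current pair of columns. A pair raises s by 6 but `b` only by 3,
  -- so s catches up from b + 2 - 3 y to b + 2 exactly when the pairs are used up; from there the
  -- bound v ≥ -A takes over from w ≤ B.
  pairs-low : ∀ y b n s q → s ≡ + b + + 2 - + 3 * + y → q ≡ + 2 * + b + + c →
    Low (+ pairs y b n) (advance n s) (advance n q)
  pairs-low zero b n s q refl refl =
    rising-low (2 ℕ.+ b) n s q (eq-s (+ b)) (via (nat 2 ⊹ c≤2) (eq-q (+ b) (+ c)))
    where
    eq-s : ∀ b → b + + 2 - + 3 * + 0 ≡ + 2 + b
    eq-s = solve-∀
    eq-q : ∀ b c → + 2 * (+ 2 + b) - (+ 2 * b + c) ≡ + 2 + (+ 2 - c)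
    eq-q = solve-∀
  pairs-low (suc y) b zero s q refl refl = record
    { ℓ≥0   = nat (α ℕ.+ b)
    ; s≤ℓ   = via (nat α ⊹ nat 3 ⊠ nat y ⊹ nat 1) (eq₁ (+ α) (+ b) (+ y))
    ; q≤2ℓ  = via α-lower (eq₂ (+ α) (+ b) (+ c))
    ; tight = inj₂ (inj₂ (via α-upper (eq₃ (+ α) (+ b) (+ c)))) }
    where
    eq₁ : ∀ α b y → α + b - (b + + 2 - + 3 * (+ 1 + y)) ≡ α + + 3 * y + + 1
    eq₁ = solve-∀
    eq₂ : ∀ α b c → + 2 * (α + b) - (+ 2 * b + c) ≡ + 2 * α - c
    eq₂ = solve-∀
    eq₃ : ∀ α b c → + 2 * b + c + + 1 - + 2 * (α + b) ≡ c + + 1 - + 2 * α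
    eq₃ = solve-∀
  pairs-low (suc y) b (suc zero) s q refl refl = record
    { ℓ≥0   = nat (β ℕ.+ b)
    ; s≤ℓ   = via (β≥2 ⊹ nat 3 ⊠ nat y) (eq₁ (+ β) (+ b) (+ y))
    ; q≤2ℓ  = via β-lower (eq₂ (+ β) (+ b) (+ c))
    ; tight = inj₂ (inj₂ (via β-upper (eq₃ (+ β) (+ b) (+ c)))) }
    where
    eq₁ : ∀ β b y → β + b - (+ 3 + (b + + 2 - + 3 * (+ 1 + y))) ≡ β - + 2 + + 3 * y
    eq₁ = solve-∀
    eq₂ : ∀ β b c → + 2 * (β + b) - (+ 3 + (+ 2 * b + c)) ≡ + 2 * β - (c + + 3)
    eq₂ = solve-∀
    eq₃ : ∀ β b c → + 3 + (+ 2 * b + c) + + 1 - + 2 * (β + b) ≡ c + + 4 - + 2 * β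
    eq₃ = solve-∀
  pairs-low (suc y) b (suc (suc n)) s q refl refl =
    pairs-low y (3 ℕ.+ b) n (+ 3 + (+ 3 + s)) (+ 3 + (+ 3 + q)) (eq-s (+ b) (+ y)) (eq-q (+ b) (+ c))
    where
    eq-s : ∀ b y → + 3 + (+ 3 + (b + + 2 - + 3 * (+ 1 + y))) ≡ + 3 + b + + 2 - + 3 * y
    eq-s = solve-∀
    eq-q : ∀ b c → + 3 + (+ 3 + (+ 2 * b + c)) ≡ + 2 * (+ 3 + b) + c
    eq-q = solve-∀

  level-low′ : ∀ x y n s q → s ≡ + 2 - + 3 * + y - + 3 * + x → q ≡ + c - + 3 * + x →
    Low (+ level x y n) (advance n s) (advance n q)
  level-low′ zero y n s q refl refl =
    pairs-low y 0 n s q (eq-s (+ y)) (eq-q (+ c))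
    where
    eq-s : ∀ y → + 2 - + 3 * y - + 3 * + 0 ≡ + 0 + + 2 - + 3 * y
    eq-s = solve-∀
    eq-q : ∀ c → c - + 3 * + 0 ≡ + 2 * + 0 + c
    eq-q = solve-∀
  level-low′ (suc x) y zero s q refl refl = record
    { ℓ≥0   = nat 0
    ; s≤ℓ   = via (nat 1 ⊹ nat 3 ⊠ nat x ⊹ nat 3 ⊠ nat y) (eq₁ (+ x) (+ y))
    ; q≤2ℓ  = via (c≤2 ⊹ nat 1 ⊹ nat 3 ⊠ nat x) (eq₂ (+ x) (+ c))
    ; tight = inj₁ (nat 0) }
    where
    eq₁ : ∀ x y → + 0 - (+ 2 - + 3 * y - + 3 * (+ 1 + x)) ≡ + 1 + + 3 * x + + 3 * y
    eq₁ = solve-∀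
    eq₂ : ∀ x c → + 2 * + 0 - (c - + 3 * (+ 1 + x)) ≡ + 2 - c + + 1 + + 3 * x
    eq₂ = solve-∀
  level-low′ (suc x) y (suc n) s q refl refl =
    level-low′ x y n (+ 3 + s) (+ 3 + q) (eq-s (+ x) (+ y)) (eq-q (+ x) (+ c))
    where
    eq-s : ∀ x y → + 3 + (+ 2 - + 3 * y - + 3 * (+ 1 + x)) ≡ + 2 - + 3 * y - + 3 * x
    eq-s = solve-∀
    eq-q : ∀ x c → + 3 + (c - + 3 * (+ 1 + x)) ≡ c - + 3 * x
    eq-q = solve-∀

  level-low : ∀ x y n →
    Low (+ level x y n) (+ 2 - + 3 * + y - + 3 * + x + + 3 * + n) (+ c - + 3 * + x + + 3 * + n)
  level-low x y n = subst₂ (Low (+ level x y n)) (advance≡ n _) (advance≡ n _)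
    (level-low′ x y n (+ 2 - + 3 * + y - + 3 * + x) (+ c - + 3 * + x) refl refl)

  Periodic : (ℕ → Heis) → Set
  Periodic f = ∀ r → f (3 ℕ.+ r) ≡ f r

  prod-rising : ∀ f → Periodic f → ∀ b n → prod n (λ i → f (rising b i)) ≡ f b ^ n
  prod-rising f per b zero    = refl
  prod-rising f per b (suc n) = cong (f b ∙_)
    (trans (prod-rising f per (3 ℕ.+ b) n) (cong (_^ n) (per b)))

  -- The last hypothesis expresses that `b` is a multiple of 3, as it grows by 3 with each pair:
  -- every pair then contributes the same two factors.
  prod-pairs : ∀ f → Periodic f → ∀ y b n → (∀ r → f (r ℕ.+ b) ≡ f r) →
    prod (y ℕ.* 2 ℕ.+ n) (λ i → f (pairs y b i)) ≡ (f α ∙ f β) ^ y ∙ f 2 ^ n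
  prod-pairs f per zero b n eq = trans (prod-rising f per (2 ℕ.+ b) n)
    (trans (cong (_^ n) (eq 2)) (sym (∙-identityˡ (f 2 ^ n))))
  prod-pairs f per (suc y) b n eq = trans
    (cong₂ _∙_ (eq α) (cong₂ _∙_ (eq β) (prod-pairs f per y (3 ℕ.+ b) n eq′)))
    (trans (sym (∙-assoc (f α) (f β) ((f α ∙ f β) ^ y ∙ f 2 ^ n)))
           (sym (∙-assoc (f α ∙ f β) ((f α ∙ f β) ^ y) (f 2 ^ n))))
    where
    eq′ : ∀ r → f (r ℕ.+ (3 ℕ.+ b)) ≡ f r
    eq′ r = trans (cong f (trans (sym (ℕₚ.+-assoc r 3 b)) (cong (ℕ._+ b) (ℕₚ.+-comm r 3))))
                  (trans (eq (3 ℕ.+ r)) (per r))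

  prod-level : ∀ f → Periodic f → ∀ x y n →
    prod (x ℕ.+ (y ℕ.* 2 ℕ.+ n)) (λ i → f (level x y i)) ≡ f 0 ^ x ∙ ((f α ∙ f β) ^ y ∙ f 2 ^ n)
  prod-level f per zero    y n = trans
    (prod-pairs f per y 0 n (λ r → cong f (ℕₚ.+-identityʳ r))) (sym (∙-identityˡ _))
  prod-level f per (suc x) y n = trans (cong (f 0 ∙_) (prod-level f per x y n))
    (sym (∙-assoc (f 0) (f 0 ^ x) _))

-- The extent of each column

0≤? : ∀ i → Dec (0≤ i)
0≤? i = decide (0≤-dec i)
  where
  contra : 0≤ - + 1 - i → 0≤ i → ⊥
  contra p q = absurd 0 (p ⊹ q) (solve (i ∷ []))
  decide : 0≤ i ⊎ 0≤ - + 1 - i → Dec (0≤ i)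
  decide (inj₁ p) = yes p
  decide (inj₂ p) = no (contra p)

within? : ∀ A B x y → Dec (Within A B x y)
within? A B x y = map′
  (λ (au , av , aw , bu , bv , bw) → within au av aw bu bv bw)
  (λ (within au av aw bu bv bw) → au , av , aw , bu , bv , bw)
  (0≤? _ ×-dec 0≤? _ ×-dec 0≤? _ ×-dec 0≤? _ ×-dec 0≤? _ ×-dec 0≤? _)

low-least : ∀ {ℓ s q} e → Low ℓ s q → 0≤ e → 0≤ e - s → 0≤ + 2 * e - q → 0≤ e - ℓ
low-least {ℓ} {s} {q} e low e≥0 s≤e q≤2e = [ e≥0 ⊹_ , [ by-s , by-q ]′ ]′ (Low.tight low)
  where
  by-s : 0≤ s - ℓ → 0≤ e - ℓ
  by-s t = via (s≤e ⊹ t) (solve (e ∷ s ∷ ℓ ∷ []))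
  by-q : 0≤ q + + 1 - + 2 * ℓ → 0≤ e - ℓ
  by-q t = 0≤-half (e - ℓ) (via (q≤2e ⊹ t) (solve (e ∷ q ∷ ℓ ∷ [])))

-- With e = u + A and s = u - v, the bounds u ≥ -A, v ≥ -A and w ≤ B read e ≥ 0, e ≥ s and 2 e ≥ s +
-- 2 A - B. The other three become the same bounds on s + A + B - e, with A and B exchanged.
module Bounds {ℓ ℓ′ s A B : ℤ} (low : Low ℓ s (s + + 2 * A - B)) (low′ : Low ℓ′ s (s + + 2 * B - A)) (e : ℤ) where

  private
    module L = Low low
    module L′ = Low low′

  within→ : Within A B (e - A) (s - (e - A)) → 0≤ e - ℓ × 0≤ s + A + B - e - ℓ′
  within→ (within au av aw bu bv bw) =
    low-least e low
      (via au (solve (A ∷ e ∷ [])))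
      (via av (solve (A ∷ e ∷ s ∷ [])))
      (via bw (solve (A ∷ B ∷ e ∷ s ∷ []))) ,
    low-least (s + A + B - e) low′
      (via bv (solve (A ∷ B ∷ e ∷ s ∷ [])))
      (via bu (solve (A ∷ B ∷ e ∷ s ∷ [])))
      (via aw (solve (A ∷ B ∷ e ∷ s ∷ [])))

  within← : 0≤ e - ℓ → 0≤ s + A + B - e - ℓ′ → Within A B (e - A) (s - (e - A))
  within← p q = within
    (via (p ⊹ L.ℓ≥0) (solve (A ∷ e ∷ ℓ ∷ [])))
    (via (p ⊹ L.s≤ℓ) (solve (A ∷ e ∷ s ∷ ℓ ∷ [])))
    (via (nat 2 ⊠ q ⊹ L′.q≤2ℓ) (solve (A ∷ B ∷ e ∷ s ∷ ℓ′ ∷ [])))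
    (via (q ⊹ L′.s≤ℓ) (solve (A ∷ B ∷ e ∷ s ∷ ℓ′ ∷ [])))
    (via (q ⊹ L′.ℓ≥0) (solve (A ∷ B ∷ e ∷ s ∷ ℓ′ ∷ [])))
    (via (nat 2 ⊠ p ⊹ L.q≤2ℓ) (solve (A ∷ B ∷ e ∷ s ∷ ℓ ∷ [])))

-- The two ends of a column do not cross; a column of length zero is allowed. The nine cases record
-- which constraint is tight at the lower and at the upper end, `m<2h` says that the column is not
-- beyond the last one, and `big` settles the case where both ends are given by w.
low-sum : ∀ {s s′ q q′} l l′ m h x y c θ → Low l s q → Low l′ s′ q′ →
  s ≡ + 3 * m + + 2 - + 3 * h → s′ ≡ + 3 * m + + 2 - + 3 * h →
  q ≡ c - + 3 * x + + 3 * m → q′ ≡ c - + 3 * y + + 3 * m →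
  0≤ m → 0≤ + 2 * h - + 1 - m → 0≤ h → 0≤ x → 0≤ y → 0≤ θ →
  0≤ + 2 * θ + + 1 - c → 0≤ + 2 * θ + + 1 + + 3 * (x + y) - + 2 * c →
  0≤ + 3 * m + θ + + 1 - (l + l′)
low-sum l l′ m h x y c θ low low′ refl refl refl refl 0≤m m<2h 0≤h 0≤x 0≤y 0≤θ c≤ big =
  [ (λ t → [ zero-zero t , [ zero-s t , zero-q t ]′ ]′ tight′)
  , [ (λ t → [ s-zero t , [ s-s t , s-q t ]′ ]′ tight′)
    , (λ t → [ q-zero t , [ q-s t , q-q t ]′ ]′ tight′) ]′
  ]′ (Low.tight low)
  where
  tight′ : 0≤ - l′ ⊎ 0≤ + 3 * m + + 2 - + 3 * h - l′ ⊎ 0≤ c - + 3 * y + + 3 * m + + 1 - + 2 * l′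
  tight′ = Low.tight low′
  zero-zero : 0≤ - l → 0≤ - l′ → 0≤ + 3 * m + θ + + 1 - (l + l′)
  zero-zero t t′ = via (t ⊹ t′ ⊹ nat 3 ⊠ 0≤m ⊹ 0≤θ ⊹ nat 1) (solve (l ∷ l′ ∷ m ∷ θ ∷ []))
  zero-s : 0≤ - l → 0≤ + 3 * m + + 2 - + 3 * h - l′ → 0≤ + 3 * m + θ + + 1 - (l + l′)
  zero-s t t′ = via (t ⊹ t′ ⊹ m<2h ⊹ 0≤m ⊹ 0≤h ⊹ 0≤θ) (solve (l ∷ l′ ∷ m ∷ h ∷ θ ∷ []))
  zero-q : 0≤ - l → 0≤ c - + 3 * y + + 3 * m + + 1 - + 2 * l′ → 0≤ + 3 * m + θ + + 1 - (l + l′)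
  zero-q t t′ = 0≤-half (+ 3 * m + θ + + 1 - (l + l′))
    (via (nat 2 ⊠ t ⊹ t′ ⊹ nat 3 ⊠ 0≤m ⊹ c≤ ⊹ nat 1 ⊹ nat 3 ⊠ 0≤y) (solve (m ∷ θ ∷ c ∷ y ∷ l ∷ l′ ∷ [])))
  s-zero : 0≤ + 3 * m + + 2 - + 3 * h - l → 0≤ - l′ → 0≤ + 3 * m + θ + + 1 - (l + l′)
  s-zero t t′ = via (t ⊹ t′ ⊹ m<2h ⊹ 0≤m ⊹ 0≤h ⊹ 0≤θ) (solve (l ∷ l′ ∷ m ∷ h ∷ θ ∷ []))
  s-s : 0≤ + 3 * m + + 2 - + 3 * h - l → 0≤ + 3 * m + + 2 - + 3 * h - l′ → 0≤ + 3 * m + θ + + 1 - (l + l′)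
  s-s t t′ = via (t ⊹ t′ ⊹ nat 3 ⊠ m<2h ⊹ 0≤θ) (solve (l ∷ l′ ∷ m ∷ h ∷ θ ∷ []))
  s-q : 0≤ + 3 * m + + 2 - + 3 * h - l → 0≤ c - + 3 * y + + 3 * m + + 1 - + 2 * l′ → 0≤ + 3 * m + θ + + 1 - (l + l′)
  s-q t t′ = 0≤-half (+ 3 * m + θ + + 1 - (l + l′))
    (via (nat 2 ⊠ t ⊹ t′ ⊹ nat 3 ⊠ m<2h ⊹ c≤ ⊹ nat 3 ⊠ 0≤y) (solve (m ∷ h ∷ θ ∷ c ∷ y ∷ l ∷ l′ ∷ [])))
  q-zero : 0≤ c - + 3 * x + + 3 * m + + 1 - + 2 * l → 0≤ - l′ → 0≤ + 3 * m + θ + + 1 - (l + l′)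
  q-zero t t′ = 0≤-half (+ 3 * m + θ + + 1 - (l + l′))
    (via (nat 2 ⊠ t′ ⊹ t ⊹ nat 3 ⊠ 0≤m ⊹ c≤ ⊹ nat 1 ⊹ nat 3 ⊠ 0≤x) (solve (m ∷ θ ∷ c ∷ x ∷ l ∷ l′ ∷ [])))
  q-s : 0≤ c - + 3 * x + + 3 * m + + 1 - + 2 * l → 0≤ + 3 * m + + 2 - + 3 * h - l′ → 0≤ + 3 * m + θ + + 1 - (l + l′)
  q-s t t′ = 0≤-half (+ 3 * m + θ + + 1 - (l + l′))
    (via (nat 2 ⊠ t′ ⊹ t ⊹ nat 3 ⊠ m<2h ⊹ c≤ ⊹ nat 3 ⊠ 0≤x) (solve (m ∷ h ∷ θ ∷ c ∷ x ∷ l ∷ l′ ∷ [])))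
  q-q : 0≤ c - + 3 * x + + 3 * m + + 1 - + 2 * l → 0≤ c - + 3 * y + + 3 * m + + 1 - + 2 * l′ → 0≤ + 3 * m + θ + + 1 - (l + l′)
  q-q t t′ = 0≤-half (+ 3 * m + θ + + 1 - (l + l′))
    (via (t ⊹ t′ ⊹ big) (solve (m ∷ θ ∷ c ∷ x ∷ y ∷ l ∷ l′ ∷ [])))

T-periods : ∀ z r → T (z ℕ.* 3 ℕ.+ r) ≡ T r
T-periods zero    r = refl
T-periods (suc z) r = T-periods z r

-- The lower boundary has 2 (x + ŷ) columns and the upper one 2 (y + x̂), which `h≡` makes equal.
-- The constants `c` and `θ` are the remainders in the three linear equations, shifted by 2 because
-- s is congruent to -1 modulo 3.
module Region (shape : Shape) (a b : ℤ) (x y x̂ ŷ : ℕ)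
  (0<a : 0≤ a - + 1) (0<b : 0≤ b - + 1) (f≥0 : 0≤ + 2 * b - a) (g≥0 : 0≤ + 2 * a - b)
  (h≡ : + x + + ŷ ≡ + y + + x̂)
  (2A-B : + 2 * (a - + 1) - (b - + 1) ≡ + 3 * + ŷ + + Shape.c shape - + 2)
  (2B-A : + 2 * (b - + 1) - (a - + 1) ≡ + 3 * + x̂ + + Shape.c shape - + 2)
  (A+B  : (a - + 1) + (b - + 1) ≡ + 3 * (+ x + + ŷ) + + Shape.θ shape - + 2)
  (big  : 0≤ + 2 * + Shape.θ shape + + 1 + + 3 * (+ x + + y) - + 2 * + Shape.c shape) where

  open Shape shape
  open Levels shape
  open Benzel a b 0<a 0<b f≥0 g≥0

  A B h : ℤ
  A = a - + 1
  B = b - + 1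
  h = + x + + ŷ

  abstract
    N C : ℕ
    N = x ℕ.+ (ŷ ℕ.* 2 ℕ.+ x)
    -- `C` is at least every m < N, so that `C ∸ m` is a true difference, and it is 1 modulo 3, so
    -- that the lowest cell of column m + 1 has colour `ℓ m`.
    C = suc (3 ℕ.* N)

    N-def : N ≡ x ℕ.+ (ŷ ℕ.* 2 ℕ.+ x)
    N-def = refl

    C-def : C ≡ suc (3 ℕ.* N)
    C-def = refl

  ℓ ℓ′ : ℕ → ℕ
  ℓ = level x ŷ
  ℓ′ = level y x̂

  s : ℕ → ℤ
  s m = + 3 * + m - + 1 - + 3 * h

  e : ℕ → ℕ → ℤ
  e m k = + k + + m - + 2 - + C

  cell : ℕ → ℕ → Pt
  cell m k = e m k - A , s m - (e m k - A)

  low : ∀ m → Low (+ ℓ m) (s (suc m)) (s (suc m) + + 2 * A - B)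
  low m = subst₂ (Low (+ ℓ m)) (eq-s (+ x) (+ ŷ) (+ m)) (eq-q (+ x) (+ ŷ) (+ m) (+ c) A B 2A-B) (level-low x ŷ m)
    where
    eq-s : ∀ x ŷ m → + 2 - + 3 * ŷ - + 3 * x + + 3 * m ≡ + 3 * (+ 1 + m) - + 1 - + 3 * (x + ŷ)
    eq-s = solve-∀
    eq-q : ∀ x ŷ m c A B → + 2 * A - B ≡ + 3 * ŷ + c - + 2 →
      c - + 3 * x + + 3 * m ≡ + 3 * (+ 1 + m) - + 1 - + 3 * (x + ŷ) + + 2 * A - B
    eq-q x ŷ m c A B eq = begin
      c - + 3 * x + + 3 * m
        ≡⟨ solve (x ∷ ŷ ∷ m ∷ c ∷ []) ⟩
      + 3 * (+ 1 + m) - + 1 - + 3 * (x + ŷ) + (+ 3 * ŷ + c - + 2)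
        ≡⟨ cong (λ i → + 3 * (+ 1 + m) - + 1 - + 3 * (x + ŷ) + i) eq ⟨
      + 3 * (+ 1 + m) - + 1 - + 3 * (x + ŷ) + (+ 2 * A - B)
        ≡⟨ solve (x ∷ ŷ ∷ m ∷ A ∷ B ∷ []) ⟩
      + 3 * (+ 1 + m) - + 1 - + 3 * (x + ŷ) + + 2 * A - B ∎
      where open ≡-Reasoning

  low′ : ∀ m → Low (+ ℓ′ m) (s (suc m)) (s (suc m) + + 2 * B - A)
  low′ m = subst₂ (Low (+ ℓ′ m)) (eq-s (+ y) (+ x̂) (+ m) h h≡) (eq-q (+ y) (+ x̂) (+ m) (+ c) h A B h≡ 2B-A) (level-low y x̂ m)
    where
    eq-s : ∀ y x̂ m h → h ≡ y + x̂ → + 2 - + 3 * x̂ - + 3 * y + + 3 * m ≡ + 3 * (+ 1 + m) - + 1 - + 3 * h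
    eq-s y x̂ m _ refl = solve (y ∷ x̂ ∷ m ∷ [])
    eq-q : ∀ y x̂ m c h A B → h ≡ y + x̂ → + 2 * B - A ≡ + 3 * x̂ + c - + 2 →
      c - + 3 * y + + 3 * m ≡ + 3 * (+ 1 + m) - + 1 - + 3 * h + + 2 * B - A
    eq-q y x̂ m c _ A B refl eq = begin
      c - + 3 * y + + 3 * m
        ≡⟨ solve (y ∷ x̂ ∷ m ∷ c ∷ []) ⟩
      + 3 * (+ 1 + m) - + 1 - + 3 * (y + x̂) + (+ 3 * x̂ + c - + 2)
        ≡⟨ cong (λ i → + 3 * (+ 1 + m) - + 1 - + 3 * (y + x̂) + i) eq ⟨
      + 3 * (+ 1 + m) - + 1 - + 3 * (y + x̂) + (+ 2 * B - A)
        ≡⟨ solve (y ∷ x̂ ∷ m ∷ A ∷ B ∷ []) ⟩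
      + 3 * (+ 1 + m) - + 1 - + 3 * (y + x̂) + + 2 * B - A ∎
      where open ≡-Reasoning

  t≡ : ∀ m → s (suc m) + A + B ≡ + 3 * + m + + θ
  t≡ m = eq (+ m) h (+ θ) A B A+B
    where
    eq : ∀ m h θ A B → A + B ≡ + 3 * h + θ - + 2 → + 3 * (+ 1 + m) - + 1 - + 3 * h + A + B ≡ + 3 * m + θ
    eq m h θ A B eq′ = begin
      + 3 * (+ 1 + m) - + 1 - + 3 * h + A + B        ≡⟨ solve (m ∷ h ∷ A ∷ B ∷ []) ⟩
      + 3 * (+ 1 + m) - + 1 - + 3 * h + (A + B)      ≡⟨ cong (λ i → + 3 * (+ 1 + m) - + 1 - + 3 * h + i) eq′ ⟩
      + 3 * (+ 1 + m) - + 1 - + 3 * h + (+ 3 * h + θ - + 2) ≡⟨ solve (m ∷ h ∷ θ ∷ []) ⟩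
      + 3 * m + θ ∎
      where open ≡-Reasoning

  ∈-lattice : ∀ m k → InL-1 (cell m k)
  ∈-lattice m k = ∣⇒∣ᵤ (divides (+ m - h) (eq (+ m) h (e m k - A)))
    where
    eq : ∀ m h u → u + (+ 3 * m - + 1 - + 3 * h - u) + + 1 ≡ (m - h) * + 3
    eq = solve-∀

  abstract
    benzel? : ∀ m k → Dec (BenzelCell a b (cell m k))
    benzel? m k = map′
      (λ w → ∈-lattice m k , cell← _ _ w)
      (λ benz → cell→ _ _ (proj₂ benz))
      (within? A B (e m k - A) (s m - (e m k - A)))

  benzel→within : ∀ m k → BenzelCell a b (cell m k) → Within A B (e m k - A) (s m - (e m k - A))
  benzel→within m k benz = cell→ _ _ (proj₂ benz)

  N≡2h : + N ≡ + 2 * h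
  N≡2h = trans (cong +_ N-def) (trans (cong (λ i → + x + (i + + x)) (ℤₚ.pos-* ŷ 2)) (eq (+ x) (+ ŷ)))
    where
    eq : ∀ x ŷ → x + (ŷ * + 2 + x) ≡ + 2 * (x + ŷ)
    eq = solve-∀

  column-bound : ∀ {m} → m ℕ.< N → 0≤ + 2 * h - + 1 - + m
  column-bound {m} m<N = via (gap (+≤+ m<N)) (trans (cong (λ i → i - + 1 - + m) (sym N≡2h)) (eq (+ N) (+ m)))
    where
    eq : ∀ N m → N - + 1 - m ≡ N - (+ 1 + m)
    eq = solve-∀

  nonempty : ∀ m → m ℕ.< N → ℓ m ℕ.+ ℓ′ m ℕ.≤ suc (3 ℕ.* m ℕ.+ θ)
  nonempty m m<N = ℤₚ.drop‿+≤+ (ungap (via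
    (low-sum (+ ℓ m) (+ ℓ′ m) (+ m) h (+ x) (+ y) (+ c) (+ θ) (level-low x ŷ m) (level-low y x̂ m)
      (eq-s (+ x) (+ ŷ) (+ m)) (eq-s′ (+ y) (+ x̂) (+ m) h h≡) refl refl
      (nat m) (column-bound m<N) (nat (x ℕ.+ ŷ)) (nat x) (nat y) (nat θ) c-θ big)
    (trans (cong (λ i → + 1 + (i + + θ) - (+ ℓ m + + ℓ′ m)) (ℤₚ.pos-* 3 m)) (eq (+ m) (+ θ) (+ ℓ m + + ℓ′ m)))))
    where
    eq-s : ∀ x ŷ m → + 2 - + 3 * ŷ - + 3 * x + + 3 * m ≡ + 3 * m + + 2 - + 3 * (x + ŷ)
    eq-s = solve-∀
    eq-s′ : ∀ y x̂ m h → h ≡ y + x̂ → + 2 - + 3 * x̂ - + 3 * y + + 3 * m ≡ + 3 * m + + 2 - + 3 * h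
    eq-s′ y x̂ m _ refl = solve (y ∷ x̂ ∷ m ∷ [])
    eq : ∀ m θ i → + 1 + (+ 3 * m + θ) - i ≡ + 3 * m + θ + + 1 - i
    eq = solve-∀

  m≤C : ∀ {m} → m ℕ.< N → m ℕ.≤ C
  m≤C {m} m<N = subst (m ℕ.≤_) (sym C-def)
    (ℕₚ.≤-trans (ℕₚ.<⇒≤ m<N) (ℕₚ.≤-trans (ℕₚ.m≤m+n N (N ℕ.+ (N ℕ.+ 0))) (ℕₚ.n≤1+n (3 ℕ.* N))))

  abstract
    lo n : ℕ → ℕ
    lo m = ℓ m ℕ.+ (C ℕ.∸ m)
    n m = suc (3 ℕ.* m ℕ.+ θ) ℕ.∸ (ℓ m ℕ.+ ℓ′ m)

    n≡ : ∀ m → m ℕ.< N → n m ℕ.+ (ℓ m ℕ.+ ℓ′ m) ≡ suc (3 ℕ.* m ℕ.+ θ)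
    n≡ m m<N = ℕₚ.m∸n+n≡m (nonempty m m<N)

    lo≡ : ∀ m → m ℕ.< N → lo m ℕ.+ m ≡ ℓ m ℕ.+ C
    lo≡ m m<N = trans (ℕₚ.+-assoc (ℓ m) (C ℕ.∸ m) m) (cong (ℓ m ℕ.+_) (ℕₚ.m∸n+n≡m (m≤C m<N)))

    lo≤ : ∀ m → lo m ℕ.≤ ℓ m ℕ.+ C
    lo≤ m = ℕₚ.+-monoʳ-≤ (ℓ m) (ℕₚ.m∸n≤m C m)

  e-lo : ∀ m k → m ℕ.< N → e (suc m) k - + ℓ m ≡ + k - + 1 - + lo m
  e-lo m k m<N = eq (+ k) (+ m) (+ C) (+ ℓ m) (+ lo m) (cong +_ (lo≡ m m<N))
    where
    eq : ∀ k m C ℓ lo → lo + m ≡ ℓ + C → k + (+ 1 + m) - + 2 - C - ℓ ≡ k - + 1 - lo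
    eq k m C ℓ lo eq′ = begin
      k + (+ 1 + m) - + 2 - C - ℓ  ≡⟨ solve (k ∷ m ∷ C ∷ ℓ ∷ []) ⟩
      k + m - + 1 - (ℓ + C)        ≡⟨ cong (λ i → k + m - + 1 - i) eq′ ⟨
      k + m - + 1 - (lo + m)       ≡⟨ solve (k ∷ m ∷ lo ∷ []) ⟩
      k - + 1 - lo ∎
      where open ≡-Reasoning

  e-hi : ∀ m k → m ℕ.< N → s (suc m) + A + B - e (suc m) k - + ℓ′ m ≡ + n m + + lo m - + k
  e-hi m k m<N = eq (+ k) (+ m) (+ θ) (+ C) (+ ℓ m) (+ ℓ′ m) (+ lo m) (+ n m) (s (suc m)) A B
    (t≡ m) (cong +_ (lo≡ m m<N)) (trans (cong +_ (n≡ m m<N)) (cong (λ i → + 1 + (i + + θ)) (ℤₚ.pos-* 3 m)))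
    where
    eq : ∀ k m θ C ℓ ℓ′ lo n s A B → s + A + B ≡ + 3 * m + θ → lo + m ≡ ℓ + C → n + (ℓ + ℓ′) ≡ + 1 + (+ 3 * m + θ) →
      s + A + B - (k + (+ 1 + m) - + 2 - C) - ℓ′ ≡ n + lo - k
    eq k m θ C ℓ ℓ′ lo n s A B t≡ lo≡ n≡ = begin
      s + A + B - (k + (+ 1 + m) - + 2 - C) - ℓ′
        ≡⟨ cong (λ i → i - (k + (+ 1 + m) - + 2 - C) - ℓ′) t≡ ⟩
      + 3 * m + θ - (k + (+ 1 + m) - + 2 - C) - ℓ′
        ≡⟨ solve (k ∷ m ∷ θ ∷ C ∷ ℓ ∷ ℓ′ ∷ []) ⟩
      + 1 + (+ 3 * m + θ) - (ℓ + ℓ′) + (ℓ + C) - m - k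
        ≡⟨ cong₂ (λ i j → i - (ℓ + ℓ′) + j - m - k) n≡ lo≡ ⟨
      n + (ℓ + ℓ′) - (ℓ + ℓ′) + (lo + m) - m - k
        ≡⟨ solve (k ∷ m ∷ ℓ ∷ ℓ′ ∷ lo ∷ n ∷ []) ⟩
      n + lo - k ∎
      where open ≡-Reasoning

  inside→ : ∀ m k → m ℕ.< N → BenzelCell a b (cell (suc m) k) → 0≤ + k - + 1 - + lo m × 0≤ + n m + + lo m - + k
  inside→ m k m<N benz =
    let p , q = Bounds.within→ (low m) (low′ m) (e (suc m) k) (benzel→within (suc m) k benz)
    in subst 0≤_ (e-lo m k m<N) p , subst 0≤_ (e-hi m k m<N) q

  inside← : ∀ m k → m ℕ.< N → 0≤ + k - + 1 - + lo m → 0≤ + n m + + lo m - + k → BenzelCell a b (cell (suc m) k)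
  inside← m k m<N p q = ∈-lattice (suc m) k , cell← _ _
    (Bounds.within← (low m) (low′ m) (e (suc m) k) (via p (e-lo m k m<N)) (via q (e-hi m k m<N)))

  -- In column 0, u ≥ -A and v ≤ B would force s + A + B ≥ 0, but this number is θ - 3. At the other
  -- end, v ≥ -A and u ≤ B contradict A + B - s = θ - 4.
  start : ∀ k → ¬ BenzelCell a b (cell 0 k)
  start k benz = absurd 0 (Within.au w ⊹ Within.bv w ⊹ θ≤2) (sym (eq (e 0 k) h A B (+ θ) A+B))
    where
    w = benzel→within 0 k benz
    eq : ∀ e h A B θ → A + B ≡ + 3 * h + θ - + 2 →
      A + (e - A) + (B - - (+ 3 * + 0 - + 1 - + 3 * h - (e - A))) + (+ 2 - θ) ≡ - + 1
    eq e h A B θ eq′ = begin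
      A + (e - A) + (B - - (+ 3 * + 0 - + 1 - + 3 * h - (e - A))) + (+ 2 - θ)
        ≡⟨ solve (e ∷ h ∷ A ∷ B ∷ θ ∷ []) ⟩
      A + B + + 1 - + 3 * h - θ          ≡⟨ cong (λ i → i + + 1 - + 3 * h - θ) eq′ ⟩
      + 3 * h + θ - + 2 + + 1 - + 3 * h - θ ≡⟨ solve (h ∷ θ ∷ []) ⟩
      - + 1 ∎
      where open ≡-Reasoning

  end : ∀ k → ¬ BenzelCell a b (cell (suc N) k)
  end k benz = absurd 1 (Within.av w ⊹ Within.bu w ⊹ θ≤2) (sym (eq (e (suc N) k) h A B (+ θ) (+ N) N≡2h A+B))
    where
    w = benzel→within (suc N) k benz
    eq : ∀ e h A B θ N → N ≡ + 2 * h → A + B ≡ + 3 * h + θ - + 2 →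
      A + - (+ 3 * (+ 1 + N) - + 1 - + 3 * h - (e - A)) + (B - (e - A)) + (+ 2 - θ) ≡ - + 2
    eq e h A B θ _ refl eq′ = begin
      A + - (+ 3 * (+ 1 + + 2 * h) - + 1 - + 3 * h - (e - A)) + (B - (e - A)) + (+ 2 - θ)
        ≡⟨ solve (e ∷ h ∷ A ∷ B ∷ θ ∷ []) ⟩
      A + B - + 3 * h - θ                ≡⟨ cong (λ i → i - + 3 * h - θ) eq′ ⟩
      + 3 * h + θ - + 2 - + 3 * h - θ    ≡⟨ solve (h ∷ θ ∷ []) ⟩
      - + 2 ∎
      where open ≡-Reasoning

  K : ℕ
  K = suc (suc (3 ℕ.* N ℕ.+ θ) ℕ.+ C)

  K-large : ∀ m → m ℕ.< N → n m ℕ.+ lo m ℕ.< K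
  K-large m m<N = s≤s (begin
    n m ℕ.+ lo m                  ≤⟨ ℕₚ.+-monoʳ-≤ (n m) (lo≤ m) ⟩
    n m ℕ.+ (ℓ m ℕ.+ C)           ≡⟨ ℕₚ.+-assoc (n m) (ℓ m) C ⟨
    n m ℕ.+ ℓ m ℕ.+ C             ≤⟨ ℕₚ.+-monoˡ-≤ C n+ℓ≤ ⟩
    suc (3 ℕ.* N ℕ.+ θ) ℕ.+ C     ∎)
    where
    open ℕₚ.≤-Reasoning
    n+ℓ≤ : n m ℕ.+ ℓ m ℕ.≤ suc (3 ℕ.* N ℕ.+ θ)
    n+ℓ≤ = begin
      n m ℕ.+ ℓ m                   ≤⟨ ℕₚ.m≤m+n _ (ℓ′ m) ⟩
      n m ℕ.+ ℓ m ℕ.+ ℓ′ m          ≡⟨ ℕₚ.+-assoc (n m) (ℓ m) (ℓ′ m) ⟩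
      n m ℕ.+ (ℓ m ℕ.+ ℓ′ m)        ≡⟨ n≡ m m<N ⟩
      suc (3 ℕ.* m ℕ.+ θ)           ≤⟨ s≤s (ℕₚ.+-monoˡ-≤ θ (ℕₚ.*-monoʳ-≤ 3 (ℕₚ.<⇒≤ m<N))) ⟩
      suc (3 ℕ.* N ℕ.+ θ)           ∎

below-lo : ∀ k lo → k ℕ.≤ lo → 0≤ + k - + 1 - + lo → ⊥
below-lo k lo k≤lo p = absurd 0 (p ⊹ gap (+≤+ k≤lo)) (sym (eq (+ k) (+ lo)))
  where
  eq : ∀ k lo → k - + 1 - lo + (lo - k) ≡ - + 1
  eq = solve-∀

above-lo : ∀ i lo → 0≤ + (suc i ℕ.+ lo) - + 1 - + lo
above-lo i lo = via (nat i) (eq (+ i) (+ lo))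
  where
  eq : ∀ i lo → + 1 + i + lo - + 1 - lo ≡ i
  eq = solve-∀

below-hi : ∀ i lo n → i ℕ.< n → 0≤ + n + + lo - + (suc i ℕ.+ lo)
below-hi i lo n i<n = via (gap (+≤+ i<n)) (eq (+ i) (+ lo) (+ n))
  where
  eq : ∀ i lo n → n + lo - (+ 1 + i + lo) ≡ n - (+ 1 + i)
  eq = solve-∀

above-hi : ∀ i lo n → 0≤ + n + + lo - + (suc i ℕ.+ (n ℕ.+ lo)) → ⊥
above-hi i lo n p = absurd 0 (p ⊹ nat i) (sym (eq (+ i) (+ lo) (+ n)))
  where
  eq : ∀ i lo n → n + lo - (+ 1 + i + (n + lo)) + i ≡ - + 1
  eq = solve-∀

-- Equality of the boundary products of a tiled benzel

module Holonomy (shape : Shape) (a b : ℤ) (x y x̂ ŷ : ℕ)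
  (0<a : 0≤ a - + 1) (0<b : 0≤ b - + 1) (f≥0 : 0≤ + 2 * b - a) (g≥0 : 0≤ + 2 * a - b)
  (h≡ : + x + + ŷ ≡ + y + + x̂)
  (2A-B : + 2 * (a - + 1) - (b - + 1) ≡ + 3 * + ŷ + + Shape.c shape - + 2)
  (2B-A : + 2 * (b - + 1) - (a - + 1) ≡ + 3 * + x̂ + + Shape.c shape - + 2)
  (A+B  : (a - + 1) + (b - + 1) ≡ + 3 * (+ x + + ŷ) + + Shape.θ shape - + 2)
  (big  : 0≤ + 2 * + Shape.θ shape + + 1 + + 3 * (+ x + + y) - + 2 * + Shape.c shape)
  {count} (tiling : TilingByBones a b count) where

  open Shape shape
  open Levels shape
  open Region shape a b x y x̂ ŷ 0<a 0<b f≥0 g≥0 h≡ 2A-B 2B-A A+B big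
  open Labelling {a} {b} tiling cell benzel?

  cell-V : ∀ m k → cell m (suc k) ≡ cell m k ⊕ stride north
  cell-V m k = cong₂ _,_ (eq₁ (+ k) (+ m) (+ C) A) (eq₂ (+ k) (+ m) (+ C) A (s m))
    where
    eq₁ : ∀ k m C A → + 1 + k + m - + 2 - C - A ≡ k + m - + 2 - C - A + + 1
    eq₁ = solve-∀
    eq₂ : ∀ k m C A s → s - (+ 1 + k + m - + 2 - C - A) ≡ s - (k + m - + 2 - C - A) + - + 1
    eq₂ = solve-∀

  cell-F : ∀ m k → cell (suc m) k ≡ cell m k ⊕ stride southeast
  cell-F m k = cong₂ _,_ (eq₁ (+ k) (+ m) (+ C) A) (eq₂ (+ k) (+ m) (+ C) A h)
    where
    eq₁ : ∀ k m C A → k + (+ 1 + m) - + 2 - C - A ≡ k + m - + 2 - C - A + + 1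
    eq₁ = solve-∀
    eq₂ : ∀ k m C A h → + 3 * (+ 1 + m) - + 1 - + 3 * h - (k + (+ 1 + m) - + 2 - C - A)
      ≡ + 3 * m - + 1 - + 3 * h - (k + m - + 2 - C - A) + + 2
    eq₂ = solve-∀

  cell-R : ∀ m k → cell (suc m) (suc k) ≡ cell m k ⊕ stride northeast
  cell-R m k = cong₂ _,_ (eq₁ (+ k) (+ m) (+ C) A) (eq₂ (+ k) (+ m) (+ C) A h)
    where
    eq₁ : ∀ k m C A → + 1 + k + (+ 1 + m) - + 2 - C - A ≡ k + m - + 2 - C - A + + 2
    eq₁ = solve-∀
    eq₂ : ∀ k m C A h → + 3 * (+ 1 + m) - + 1 - + 3 * h - (+ 1 + k + (+ 1 + m) - + 2 - C - A)
      ≡ + 3 * m - + 1 - + 3 * h - (k + m - + 2 - C - A) + + 1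
    eq₂ = solve-∀

  open Transport τ
    (λ m k → τ-consistent north {m} {k} {m} {suc k} (cell-V m k))
    (λ m k → τ-consistent southeast {m} {k} {suc m} {k} (cell-F m k))
    (λ m k → τ-consistent northeast {m} {k} {suc m} {suc k} (cell-R m k))

  below : ∀ m → m ℕ.< N → ∀ k → k ℕ.≤ lo m → τ (suc m) k ≡ none
  below m m<N k k≤lo = τ-outside (suc m) k λ benz → below-lo k (lo m) k≤lo (proj₁ (inside→ m k m<N benz))

  inside : ∀ m → m ℕ.< N → ∀ i → i ℕ.< n m → τ (suc m) (suc i ℕ.+ lo m) ≢ none
  inside m m<N i i<n = τ-inside (suc m) (suc i ℕ.+ lo m)
    (inside← m (suc i ℕ.+ lo m) m<N (above-lo i (lo m)) (below-hi i (lo m) (n m) i<n))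

  above : ∀ m → m ℕ.< N → ∀ i → τ (suc m) (suc i ℕ.+ (n m ℕ.+ lo m)) ≡ none
  above m m<N i = τ-outside (suc m) (suc i ℕ.+ (n m ℕ.+ lo m))
    λ benz → above-hi i (lo m) (n m) (proj₂ (inside→ m (suc i ℕ.+ (n m ℕ.+ lo m)) m<N benz))

  lo≡C : ∀ m → m ℕ.< N → lo m ℕ.+ m ≡ ℓ m ℕ.+ suc (3 ℕ.* N)
  lo≡C m m<N = trans (lo≡ m m<N) (cong (ℓ m ℕ.+_) C-def)

  bottom-colour : ∀ m → m ℕ.< N → suc (lo m) ℕ.+ suc m ≡ suc N ℕ.* 3 ℕ.+ ℓ m
  bottom-colour m m<N = trans (cong suc (ℕₚ.+-suc (lo m) m)) (trans (cong (λ i → suc (suc i)) (lo≡C m m<N)) (eq (ℓ m) N))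
    where
    eq : ∀ ℓ N → suc (suc (ℓ ℕ.+ suc (3 ℕ.* N))) ≡ suc N ℕ.* 3 ℕ.+ ℓ
    eq = ℕ-solve-∀

  -- The colour above the column is θ + 1 - ℓ′ modulo 3. Adding 3 ℓ′ avoids the subtraction and
  -- yields the argument of `T′`.
  top-colour : ∀ m → m ℕ.< N →
    ℓ′ m ℕ.* 3 ℕ.+ (suc (n m ℕ.+ lo m) ℕ.+ suc m) ≡ (suc N ℕ.+ m) ℕ.* 3 ℕ.+ (ℓ′ m ℕ.* 2 ℕ.+ suc θ)
  top-colour m m<N = eq (ℓ m) (ℓ′ m) (lo m) (n m) m N θ (lo≡C m m<N) (n≡ m m<N)
    where
    eq : ∀ ℓ ℓ′ lo n m N θ → lo ℕ.+ m ≡ ℓ ℕ.+ suc (3 ℕ.* N) → n ℕ.+ (ℓ ℕ.+ ℓ′) ≡ suc (3 ℕ.* m ℕ.+ θ) →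
      ℓ′ ℕ.* 3 ℕ.+ (suc (n ℕ.+ lo) ℕ.+ suc m) ≡ (suc N ℕ.+ m) ℕ.* 3 ℕ.+ (ℓ′ ℕ.* 2 ℕ.+ suc θ)
    eq ℓ ℓ′ lo n m N θ lo≡ n≡ = begin
      ℓ′ ℕ.* 3 ℕ.+ (suc (n ℕ.+ lo) ℕ.+ suc m)             ≡⟨ eq₁ ℓ′ n lo m ⟩
      ℓ′ ℕ.* 3 ℕ.+ (2 ℕ.+ (n ℕ.+ (lo ℕ.+ m)))             ≡⟨ cong (λ i → ℓ′ ℕ.* 3 ℕ.+ (2 ℕ.+ (n ℕ.+ i))) lo≡ ⟩
      ℓ′ ℕ.* 3 ℕ.+ (2 ℕ.+ (n ℕ.+ (ℓ ℕ.+ suc (3 ℕ.* N))))  ≡⟨ eq₂ ℓ ℓ′ n N ⟩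
      ℓ′ ℕ.* 2 ℕ.+ suc N ℕ.* 3 ℕ.+ (n ℕ.+ (ℓ ℕ.+ ℓ′))     ≡⟨ cong (ℓ′ ℕ.* 2 ℕ.+ suc N ℕ.* 3 ℕ.+_) n≡ ⟩
      ℓ′ ℕ.* 2 ℕ.+ suc N ℕ.* 3 ℕ.+ suc (3 ℕ.* m ℕ.+ θ)    ≡⟨ eq₃ ℓ′ m N θ ⟩
      (suc N ℕ.+ m) ℕ.* 3 ℕ.+ (ℓ′ ℕ.* 2 ℕ.+ suc θ)        ∎
      where
      open ≡-Reasoning
      eq₁ : ∀ ℓ′ n lo m → ℓ′ ℕ.* 3 ℕ.+ (suc (n ℕ.+ lo) ℕ.+ suc m) ≡ ℓ′ ℕ.* 3 ℕ.+ (2 ℕ.+ (n ℕ.+ (lo ℕ.+ m)))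
      eq₁ = ℕ-solve-∀
      eq₂ : ∀ ℓ ℓ′ n N → ℓ′ ℕ.* 3 ℕ.+ (2 ℕ.+ (n ℕ.+ (ℓ ℕ.+ suc (3 ℕ.* N)))) ≡ ℓ′ ℕ.* 2 ℕ.+ suc N ℕ.* 3 ℕ.+ (n ℕ.+ (ℓ ℕ.+ ℓ′))
      eq₂ = ℕ-solve-∀
      eq₃ : ∀ ℓ′ m N θ → ℓ′ ℕ.* 2 ℕ.+ suc N ℕ.* 3 ℕ.+ suc (3 ℕ.* m ℕ.+ θ) ≡ (suc N ℕ.+ m) ℕ.* 3 ℕ.+ (ℓ′ ℕ.* 2 ℕ.+ suc θ)
      eq₃ = ℕ-solve-∀

  T′ : ℕ → Heis
  T′ r = T (r ℕ.* 2 ℕ.+ suc θ)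

  N′ : N ≡ y ℕ.+ (x̂ ℕ.* 2 ℕ.+ y)
  N′ = trans N-def (trans (eq x ŷ) (trans (cong (ℕ._* 2) (ℤₚ.+-injective h≡)) (sym (eq y x̂))))
    where
    eq : ∀ x ŷ → x ℕ.+ (ŷ ℕ.* 2 ℕ.+ x) ≡ (x ℕ.+ ŷ) ℕ.* 2
    eq = ℕ-solve-∀

  holonomy : T′ 0 ^ y ∙ ((T′ α ∙ T′ β) ^ x̂ ∙ T′ 2 ^ y) ≡ T 0 ^ x ∙ ((T α ∙ T β) ^ ŷ ∙ T 2 ^ x)
  holonomy = begin
    T′ 0 ^ y ∙ ((T′ α ∙ T′ β) ^ x̂ ∙ T′ 2 ^ y)
      ≡⟨ prod-level T′ (λ r → refl) y x̂ y ⟨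
    prod (y ℕ.+ (x̂ ℕ.* 2 ℕ.+ y)) (λ m → T′ (ℓ′ m))
      ≡⟨ cong (λ i → prod i (λ m → T′ (ℓ′ m))) N′ ⟨
    prod N (λ m → T′ (ℓ′ m))
      ≡⟨ prod-cong N (λ m m<N → trans (sym (T-periods (ℓ′ m) (suc (n m ℕ.+ lo m) ℕ.+ suc m))) (trans (cong T (top-colour m m<N)) (T-periods (suc N ℕ.+ m) (ℓ′ m ℕ.* 2 ℕ.+ suc θ)))) ⟨
    prod N (λ m → T (suc (n m ℕ.+ lo m) ℕ.+ suc m))
      ≡⟨ boundary N K lo n (λ k → τ-outside 0 k (start k)) (λ k → τ-outside (suc N) k (end k)) K-large below inside above ⟩
    prod N (λ m → T (suc (lo m) ℕ.+ suc m))
      ≡⟨ prod-cong N (λ m m<N → trans (cong T (bottom-colour m m<N)) (T-periods (suc N) (ℓ m))) ⟩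
    prod N (λ m → T (ℓ m))
      ≡⟨ cong (λ i → prod i (λ m → T (ℓ m))) N-def ⟩
    prod (x ℕ.+ (ŷ ℕ.* 2 ℕ.+ x)) (λ m → T (ℓ m))
      ≡⟨ prod-level T (λ r → refl) x ŷ x ⟩
    T 0 ^ x ∙ ((T α ∙ T β) ^ ŷ ∙ T 2 ^ x) ∎
    where open ≡-Reasoning

-- Comparison of areas for the three values of δ

^-scale : ∀ p q n k → ⟨ p , q , n ⟩ ^ k ≡ ⟨ + k * p , + k * q , + k * n ⟩
^-scale p q n zero    = refl
^-scale p q n (suc k) = trans (cong (⟨ p , q , n ⟩ ∙_) (^-scale p q n k))
  (⟨⟩-cong (lin p (+ k)) (lin q (+ k)) (quad p q n (+ k)))
  where
  lin : ∀ p k → p + k * p ≡ (+ 1 + k) * p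
  lin = solve-∀
  quad : ∀ p q n k → n + k * n + (p * (k * q) - q * (k * p)) ≡ (+ 1 + k) * n
  quad = solve-∀

area-product : ∀ p q n p′ q′ n′ p″ q″ n″ i j k →
  Heis.area (⟨ p , q , n ⟩ ^ i ∙ (⟨ p′ , q′ , n′ ⟩ ^ j ∙ ⟨ p″ , q″ , n″ ⟩ ^ k))
    ≡ + i * n + + j * n′ + + k * n″
      + (+ i * + j * (p * q′ - q * p′) + + i * + k * (p * q″ - q * p″) + + j * + k * (p′ * q″ - q′ * p″))
area-product p q n p′ q′ n′ p″ q″ n″ i j k = trans
  (cong Heis.area (cong₂ _∙_ (^-scale p q n i) (cong₂ _∙_ (^-scale p′ q′ n′ j) (^-scale p″ q″ n″ k))))
  (expand p q n p′ q′ n′ p″ q″ n″ (+ i) (+ j) (+ k))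
  where
  expand : ∀ p q n p′ q′ n′ p″ q″ n″ i j k →
    i * n + (j * n′ + k * n″ + (j * p′ * (k * q″) - j * q′ * (k * p″)))
      + (i * p * (j * q′ + k * q″) - i * q * (j * p′ + k * p″))
    ≡ i * n + j * n′ + k * n″
      + (i * j * (p * q′ - q * p′) + i * k * (p * q″ - q * p″) + j * k * (p′ * q″ - q′ * p″))
  expand = solve-∀

PairedPentagonal : ℤ → ℤ → Set
PairedPentagonal a b = ∃ λ (k : ℤ) → + 2 ≤ k ×
  ((+ 2 * a ≡ k * (+ 3 * k - + 1) × + 2 * b ≡ k * (+ 3 * k + + 1)) ⊎
   (+ 2 * a ≡ k * (+ 3 * k + + 1) × + 2 * b ≡ k * (+ 3 * k - + 1)))

module Necessity (a b : ℤ) (2≤a : 0≤ a - + 2) (2≤b : 0≤ b - + 2) (f≥0 : 0≤ + 2 * b - a) (g≥0 : 0≤ + 2 * a - b)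
  {count} (tiling : TilingByBones a b count) where

  0<a : 0≤ a - + 1
  0<a = via (2≤a ⊹ nat 1) (solve (a ∷ []))
  0<b : 0≤ b - + 1
  0<b = via (2≤b ⊹ nat 1) (solve (b ∷ []))

  module Residue0 (x y : ℕ) (a≡ : a ≡ + x + + 2 * + y + + 0) (b≡ : b ≡ + 2 * + x + + y + + 0) where

    shape : Shape
    shape = record
      -- `c` is δ + 1 and `θ` is 2 δ modulo 3; `α` and `β` are c / 2 and (c + 3) / 2 rounded up. The
      -- same rule gives the constants for δ = 1 and δ = 2.
      { α = 1 ; β = 2 ; c = 1 ; θ = 0
      ; α-lower = nat 1 ; α-upper = nat 0 ; β-lower = nat 0 ; β-upper = nat 1
      ; β≥2 = nat 0 ; c≤2 = nat 1 ; θ≤2 = nat 2 ; c-θ = nat 0 }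

    h≡ : + x + + y ≡ + y + + x
    h≡ = eq (+ x) (+ y)
      where
      eq : ∀ x y → x + y ≡ y + x
      eq = solve-∀

    2A-B : + 2 * (a - + 1) - (b - + 1) ≡ + 3 * + y + + 1 - + 2
    2A-B = eq (+ x) (+ y) a b a≡ b≡
      where
      eq : ∀ x y a b → a ≡ x + + 2 * y + + 0 → b ≡ + 2 * x + y + + 0 →
        + 2 * (a - + 1) - (b - + 1) ≡ + 3 * y + + 1 - + 2
      eq x y _ _ refl refl = solve (x ∷ y ∷ [])

    2B-A : + 2 * (b - + 1) - (a - + 1) ≡ + 3 * + x + + 1 - + 2
    2B-A = eq (+ x) (+ y) a b a≡ b≡
      where
      eq : ∀ x y a b → a ≡ x + + 2 * y + + 0 → b ≡ + 2 * x + y + + 0 →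
        + 2 * (b - + 1) - (a - + 1) ≡ + 3 * x + + 1 - + 2
      eq x y _ _ refl refl = solve (x ∷ y ∷ [])

    A+B : (a - + 1) + (b - + 1) ≡ + 3 * (+ x + + y) + + 0 - + 2
    A+B = eq (+ x) (+ y) a b a≡ b≡
      where
      eq : ∀ x y a b → a ≡ x + + 2 * y + + 0 → b ≡ + 2 * x + y + + 0 →
        (a - + 1) + (b - + 1) ≡ + 3 * (x + y) + + 0 - + 2
      eq x y _ _ refl refl = solve (x ∷ y ∷ [])

    big : 0≤ + 2 * + 0 + + 1 + + 3 * (+ x + + y) - + 2 * + 1
    -- Since a + b = 3 (x + y), the lower bounds on a and b exclude x + y = 0.
    big = 0≤-third (+ 1 + + 3 * (+ x + + y) - + 2) (via (nat 3 ⊠ (2≤a ⊹ 2≤b) ⊹ nat 11) (eq (+ x) (+ y) a b a≡ b≡))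
      where
      eq : ∀ x y a b → a ≡ x + + 2 * y + + 0 → b ≡ + 2 * x + y + + 0 →
        + 3 * (+ 1 + + 3 * (x + y) - + 2) + + 2 ≡ + 3 * (a - + 2 + (b - + 2)) + + 11
      eq x y _ _ refl refl = solve (x ∷ y ∷ [])

    -- The literals outside the brackets are the areas of `T′ 0`, `T′ α ∙ T′ β`, `T′ 2` on the left
    -- and of `T 0`, `T α ∙ T β`, `T 2` on the right; those inside are the pairwise cross products
    -- of their planar parts.
    areas : ∀ X Y → X ≡ + x → Y ≡ + y →
      Y * (+ 0) + X * (- + 1) + Y * (+ 0) + (Y * X * (+ 0) + Y * Y * (+ 1) + X * Y * (- + 1))
      ≡ X * (+ 0) + Y * (+ 1) + X * (+ 0) + (X * Y * (+ 0) + X * X * (- + 1) + Y * X * (+ 1))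
    areas _ _ refl refl = trans (sym (area-product (+ 0) (+ 1) (+ 0) (+ 0) (- + 1) (- + 1) (- + 1) (- + 1) (+ 0) y x y))
      (trans (cong Heis.area (Holonomy.holonomy shape a b x y x y 0<a 0<b f≥0 g≥0 h≡ 2A-B 2B-A A+B big tiling))
        (area-product (+ 1) (+ 0) (+ 0) (- + 1) (+ 0) (+ 1) (- + 1) (- + 1) (+ 0) x y x))

    square : (+ x - + y) * (+ x - + y) ≡ + x + + y
    square = eq (+ x) (+ y) (areas (+ x) (+ y) refl refl)
      where
      eq : ∀ X Y →
        Y * (+ 0) + X * (- + 1) + Y * (+ 0) + (Y * X * (+ 0) + Y * Y * (+ 1) + X * Y * (- + 1))
        ≡ X * (+ 0) + Y * (+ 1) + X * (+ 0) + (X * Y * (+ 0) + X * X * (- + 1) + Y * X * (+ 1)) →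
        (X - Y) * (X - Y) ≡ X + Y
      eq X Y areas = begin
        (X - Y) * (X - Y)        ≡⟨ solve (X ∷ Y ∷ []) ⟩
        X + Y + ((Y * (+ 0) + X * (- + 1) + Y * (+ 0) + (Y * X * (+ 0) + Y * Y * (+ 1) + X * Y * (- + 1)))
          - (X * (+ 0) + Y * (+ 1) + X * (+ 0) + (X * Y * (+ 0) + X * X * (- + 1) + Y * X * (+ 1))))          ≡⟨ cong (λ i → X + Y + (i - (X * (+ 0) + Y * (+ 1) + X * (+ 0) + (X * Y * (+ 0) + X * X * (- + 1) + Y * X * (+ 1))))) areas ⟩
        X + Y + ((X * (+ 0) + Y * (+ 1) + X * (+ 0) + (X * Y * (+ 0) + X * X * (- + 1) + Y * X * (+ 1)))
          - (X * (+ 0) + Y * (+ 1) + X * (+ 0) + (X * Y * (+ 0) + X * X * (- + 1) + Y * X * (+ 1))))          ≡⟨ cong (λ i → X + Y + i) (ℤₚ.+-inverseʳ (X * (+ 0) + Y * (+ 1) + X * (+ 0) + (X * Y * (+ 0) + X * X * (- + 1) + Y * X * (+ 1)))) ⟩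
        X + Y + + 0              ≡⟨ ℤₚ.+-identityʳ (X + Y) ⟩
        X + Y                    ∎
        where
        open ≡-Reasoning

    conclude : ∀ X Y a b → a ≡ X + + 2 * Y + + 0 → b ≡ + 2 * X + Y + + 0 → (X - Y) * (X - Y) ≡ X + Y →
      0≤ a - + 2 → 0≤ b - + 2 → PairedPentagonal a b
    conclude X Y _ _ refl refl sq 2≤a 2≤b = cases (0≤-dec (X - Y))
      where
      open ≡-Reasoning
      minus : ∀ X Y → (X - Y) * (X - Y) ≡ X + Y → + 2 * (X + + 2 * Y + + 0) ≡ (X - Y) * (+ 3 * (X - Y) - + 1)
      minus X Y sq = begin
        + 2 * (X + + 2 * Y + + 0)               ≡⟨ solve (X ∷ Y ∷ []) ⟩
        + 3 * (X + Y) - (X - Y)                 ≡⟨ cong (λ i → + 3 * i - (X - Y)) sq ⟨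
        + 3 * ((X - Y) * (X - Y)) - (X - Y)     ≡⟨ solve (X ∷ Y ∷ []) ⟩
        (X - Y) * (+ 3 * (X - Y) - + 1)         ∎
      plus : ∀ X Y → (X - Y) * (X - Y) ≡ X + Y → + 2 * (+ 2 * X + Y + + 0) ≡ (X - Y) * (+ 3 * (X - Y) + + 1)
      plus X Y sq = begin
        + 2 * (+ 2 * X + Y + + 0)               ≡⟨ solve (X ∷ Y ∷ []) ⟩
        + 3 * (X + Y) + (X - Y)                 ≡⟨ cong (λ i → + 3 * i + (X - Y)) sq ⟨
        + 3 * ((X - Y) * (X - Y)) + (X - Y)     ≡⟨ solve (X ∷ Y ∷ []) ⟩
        (X - Y) * (+ 3 * (X - Y) + + 1)         ∎
      2≤k : ∀ a k → + 2 * a ≡ k * (+ 3 * k - + 1) → 0≤ a - + 2 → 0≤ k → + 2 ≤ k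
      2≤k a k eq 2≤a 0≤k = ungap (large (0≤-dec (k - + 2)))
        where
        large : 0≤ k - + 2 ⊎ 0≤ - + 1 - (k - + 2) → 0≤ k - + 2
        large (inj₁ p) = p
        -- If k ≤ 1 then k (3 k - 1) ≤ 2, whereas 2 a ≥ 4.
        large (inj₂ p) = ⊥-elim (absurd 0 (nat 2 ⊠ 2≤a ⊹ nat 3 ⊠ p ⊠ (nat 1 ⊹ 0≤k) ⊹ 0≤k) (sym (begin
          + 2 * (a - + 2) + + 3 * (- + 1 - (k - + 2)) * (+ 1 + k) + k             ≡⟨ solve (a ∷ k ∷ []) ⟩
          + 2 * a - + 4 + + 3 * (+ 1 - k) * (+ 1 + k) + k                         ≡⟨ cong (λ i → i - + 4 + + 3 * (+ 1 - k) * (+ 1 + k) + k) eq ⟩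
          k * (+ 3 * k - + 1) - + 4 + + 3 * (+ 1 - k) * (+ 1 + k) + k             ≡⟨ solve (k ∷ []) ⟩
          - + 1 ∎)))
      swapped : ∀ X Y → (X - Y) * (X - Y) ≡ X + Y → (Y - X) * (Y - X) ≡ Y + X
      swapped X Y sq = begin
        (Y - X) * (Y - X)   ≡⟨ solve (X ∷ Y ∷ []) ⟩
        (X - Y) * (X - Y)   ≡⟨ sq ⟩
        X + Y               ≡⟨ ℤₚ.+-comm X Y ⟩
        Y + X               ∎
      flip₁ : ∀ X Y → + 2 * X + Y + + 0 ≡ Y + + 2 * X + + 0
      flip₁ = solve-∀
      flip₂ : ∀ X Y → X + + 2 * Y + + 0 ≡ + 2 * Y + X + + 0
      flip₂ = solve-∀
      minus′ : + 2 * (+ 2 * X + Y + + 0) ≡ (Y - X) * (+ 3 * (Y - X) - + 1)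
      minus′ = trans (cong (+ 2 *_) (flip₁ X Y)) (minus Y X (swapped X Y sq))
      plus′ : + 2 * (X + + 2 * Y + + 0) ≡ (Y - X) * (+ 3 * (Y - X) + + 1)
      plus′ = trans (cong (+ 2 *_) (flip₂ X Y)) (plus Y X (swapped X Y sq))
      0≤Y-X : 0≤ - + 1 - (X - Y) → 0≤ Y - X
      0≤Y-X p = via (p ⊹ nat 1) (solve (X ∷ Y ∷ []))
      cases : 0≤ X - Y ⊎ 0≤ - + 1 - (X - Y) → PairedPentagonal (X + + 2 * Y + + 0) (+ 2 * X + Y + + 0)
      cases (inj₁ p) = X - Y , 2≤k _ (X - Y) (minus X Y sq) 2≤a p , inj₁ (minus X Y sq , plus X Y sq)
      cases (inj₂ p) = Y - X , 2≤k _ (Y - X) minus′ 2≤b (0≤Y-X p) , inj₂ (plus′ , minus′)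

    conclusion : PairedPentagonal a b
    conclusion = conclude (+ x) (+ y) a b a≡ b≡ square 2≤a 2≤b

  module Residue1 (x y : ℕ) (a≡ : a ≡ + x + + 2 * + y + + 1) (b≡ : b ≡ + 2 * + x + + y + + 1) where

    shape : Shape
    shape = record
      { α = 1 ; β = 3 ; c = 2 ; θ = 2
      ; α-lower = nat 0 ; α-upper = nat 1 ; β-lower = nat 1 ; β-upper = nat 0
      ; β≥2 = nat 1 ; c≤2 = nat 0 ; θ≤2 = nat 0 ; c-θ = nat 3 }

    h≡ : + x + + y ≡ + y + + x
    h≡ = eq (+ x) (+ y)
      where
      eq : ∀ x y → x + y ≡ y + x
      eq = solve-∀

    2A-B : + 2 * (a - + 1) - (b - + 1) ≡ + 3 * + y + + 2 - + 2
    2A-B = eq (+ x) (+ y) a b a≡ b≡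
      where
      eq : ∀ x y a b → a ≡ x + + 2 * y + + 1 → b ≡ + 2 * x + y + + 1 →
        + 2 * (a - + 1) - (b - + 1) ≡ + 3 * y + + 2 - + 2
      eq x y _ _ refl refl = solve (x ∷ y ∷ [])

    2B-A : + 2 * (b - + 1) - (a - + 1) ≡ + 3 * + x + + 2 - + 2
    2B-A = eq (+ x) (+ y) a b a≡ b≡
      where
      eq : ∀ x y a b → a ≡ x + + 2 * y + + 1 → b ≡ + 2 * x + y + + 1 →
        + 2 * (b - + 1) - (a - + 1) ≡ + 3 * x + + 2 - + 2
      eq x y _ _ refl refl = solve (x ∷ y ∷ [])

    A+B : (a - + 1) + (b - + 1) ≡ + 3 * (+ x + + y) + + 2 - + 2
    A+B = eq (+ x) (+ y) a b a≡ b≡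
      where
      eq : ∀ x y a b → a ≡ x + + 2 * y + + 1 → b ≡ + 2 * x + y + + 1 →
        (a - + 1) + (b - + 1) ≡ + 3 * (x + y) + + 2 - + 2
      eq x y _ _ refl refl = solve (x ∷ y ∷ [])

    big : 0≤ + 2 * + 2 + + 1 + + 3 * (+ x + + y) - + 2 * + 2
    big = via (nat 1 ⊹ nat 3 ⊠ nat (x ℕ.+ y)) (eq (+ x) (+ y))
      where
      eq : ∀ x y → + 2 * + 2 + + 1 + + 3 * (x + y) - + 2 * + 2 ≡ + 1 + + 3 * (x + y)
      eq = solve-∀

    areas : ∀ X Y → X ≡ + x → Y ≡ + y →
      Y * (+ 0) + X * (+ 1) + Y * (+ 0) + (Y * X * (- + 1) + Y * Y * (+ 1) + X * Y * (+ 0))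
      ≡ X * (+ 0) + Y * (- + 1) + X * (+ 0) + (X * Y * (+ 1) + X * X * (- + 1) + Y * X * (+ 0))
    areas _ _ refl refl = trans (sym (area-product (+ 1) (+ 0) (+ 0) (+ 0) (- + 1) (+ 1) (+ 0) (+ 1) (+ 0) y x y))
      (trans (cong Heis.area (Holonomy.holonomy shape a b x y x y 0<a 0<b f≥0 g≥0 h≡ 2A-B 2B-A A+B big tiling))
        (area-product (+ 1) (+ 0) (+ 0) (+ 1) (+ 1) (- + 1) (- + 1) (- + 1) (+ 0) x y x))

    -- The two areas differ by (x - y)² + x + y, which vanishes only for x = y = 0, that is for a =
    -- b = 1.
    impossible : ⊥
    impossible = eq (+ x) (+ y) (areas (+ x) (+ y) refl refl) (square≥0 (+ x - + y))
      (subst (λ i → 0≤ i - + 2) a≡ 2≤a) (subst (λ i → 0≤ i - + 2) b≡ 2≤b)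
      where
      square≥0 : ∀ i → 0≤ i * i
      square≥0 i = cases (0≤-dec i)
        where
        cases : 0≤ i ⊎ 0≤ - + 1 - i → 0≤ i * i
        cases (inj₁ p) = p ⊠ p
        cases (inj₂ p) = via ((p ⊹ nat 1) ⊠ (p ⊹ nat 1)) (solve (i ∷ []))
      eq : ∀ X Y →
        Y * (+ 0) + X * (+ 1) + Y * (+ 0) + (Y * X * (- + 1) + Y * Y * (+ 1) + X * Y * (+ 0))
        ≡ X * (+ 0) + Y * (- + 1) + X * (+ 0) + (X * Y * (+ 1) + X * X * (- + 1) + Y * X * (+ 0)) →
        0≤ (X - Y) * (X - Y) → 0≤ X + + 2 * Y + + 1 - + 2 → 0≤ + 2 * X + Y + + 1 - + 2 → ⊥
      eq X Y areas sq 2≤a 2≤b = absurd 1 (nat 3 ⊠ sq ⊹ 2≤a ⊹ 2≤b) (sym (begin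
        + 3 * ((X - Y) * (X - Y)) + (X + + 2 * Y + + 1 - + 2) + (+ 2 * X + Y + + 1 - + 2)
          ≡⟨ solve (X ∷ Y ∷ []) ⟩
        + 3 * ((Y * (+ 0) + X * (+ 1) + Y * (+ 0) + (Y * X * (- + 1) + Y * Y * (+ 1) + X * Y * (+ 0)))
          - (X * (+ 0) + Y * (- + 1) + X * (+ 0) + (X * Y * (+ 1) + X * X * (- + 1) + Y * X * (+ 0)))) - + 2
          ≡⟨ cong (λ i → + 3 * (i - (X * (+ 0) + Y * (- + 1) + X * (+ 0) + (X * Y * (+ 1) + X * X * (- + 1) + Y * X * (+ 0)))) - + 2) areas ⟩
        + 3 * ((X * (+ 0) + Y * (- + 1) + X * (+ 0) + (X * Y * (+ 1) + X * X * (- + 1) + Y * X * (+ 0)))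
          - (X * (+ 0) + Y * (- + 1) + X * (+ 0) + (X * Y * (+ 1) + X * X * (- + 1) + Y * X * (+ 0)))) - + 2
          ≡⟨ cong (λ i → + 3 * i - + 2) (ℤₚ.+-inverseʳ (X * (+ 0) + Y * (- + 1) + X * (+ 0) + (X * Y * (+ 1) + X * X * (- + 1) + Y * X * (+ 0)))) ⟩
        - + 2 ∎))
        where open ≡-Reasoning

  module Residue2 (x y : ℕ) (a≡ : a ≡ + x + + 2 * + y + + 2) (b≡ : b ≡ + 2 * + x + + y + + 2) where

    shape : Shape
    shape = record
      { α = 0 ; β = 2 ; c = 0 ; θ = 1
      ; α-lower = nat 0 ; α-upper = nat 1 ; β-lower = nat 1 ; β-upper = nat 0
      ; β≥2 = nat 0 ; c≤2 = nat 2 ; θ≤2 = nat 1 ; c-θ = nat 3 }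

    h≡ : + x + + (suc y) ≡ + y + + (suc x)
    h≡ = eq (+ x) (+ y)
      where
      eq : ∀ x y → x + (+ 1 + y) ≡ y + (+ 1 + x)
      eq = solve-∀

    2A-B : + 2 * (a - + 1) - (b - + 1) ≡ + 3 * + (suc y) + + 0 - + 2
    2A-B = eq (+ x) (+ y) a b a≡ b≡
      where
      eq : ∀ x y a b → a ≡ x + + 2 * y + + 2 → b ≡ + 2 * x + y + + 2 →
        + 2 * (a - + 1) - (b - + 1) ≡ + 3 * (+ 1 + y) + + 0 - + 2
      eq x y _ _ refl refl = solve (x ∷ y ∷ [])

    2B-A : + 2 * (b - + 1) - (a - + 1) ≡ + 3 * + (suc x) + + 0 - + 2
    2B-A = eq (+ x) (+ y) a b a≡ b≡
      where
      eq : ∀ x y a b → a ≡ x + + 2 * y + + 2 → b ≡ + 2 * x + y + + 2 →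
        + 2 * (b - + 1) - (a - + 1) ≡ + 3 * (+ 1 + x) + + 0 - + 2
      eq x y _ _ refl refl = solve (x ∷ y ∷ [])

    A+B : (a - + 1) + (b - + 1) ≡ + 3 * (+ x + + (suc y)) + + 1 - + 2
    A+B = eq (+ x) (+ y) a b a≡ b≡
      where
      eq : ∀ x y a b → a ≡ x + + 2 * y + + 2 → b ≡ + 2 * x + y + + 2 →
        (a - + 1) + (b - + 1) ≡ + 3 * (x + (+ 1 + y)) + + 1 - + 2
      eq x y _ _ refl refl = solve (x ∷ y ∷ [])

    big : 0≤ + 2 * + 1 + + 1 + + 3 * (+ x + + y) - + 2 * + 0
    big = via (nat 3 ⊹ nat 3 ⊠ nat (x ℕ.+ y)) (eq (+ x) (+ y))
      where
      eq : ∀ x y → + 2 * + 1 + + 1 + + 3 * (x + y) - + 2 * + 0 ≡ + 3 + + 3 * (x + y)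
      eq = solve-∀

    areas : ∀ X Y → X ≡ + x → Y ≡ + y →
      Y * (+ 0) + (+ 1 + X) * (+ 1) + Y * (+ 0) + (Y * (+ 1 + X) * (+ 1) + Y * Y * (+ 1) + (+ 1 + X) * Y * (+ 1))
      ≡ X * (+ 0) + (+ 1 + Y) * (- + 1) + X * (+ 0) + (X * (+ 1 + Y) * (- + 1) + X * X * (- + 1) + (+ 1 + Y) * X * (- + 1))
    areas _ _ refl refl = trans (sym (area-product (- + 1) (- + 1) (+ 0) (+ 0) (- + 1) (+ 1) (+ 1) (+ 0) (+ 0) y (suc x) y))
      (trans (cong Heis.area (Holonomy.holonomy shape a b x y (suc x) (suc y) 0<a 0<b f≥0 g≥0 h≡ 2A-B 2B-A A+B big tiling))
        (area-product (+ 1) (+ 0) (+ 0) (+ 0) (- + 1) (- + 1) (- + 1) (- + 1) (+ 0) x (suc y) x))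

    -- The two areas differ by (x + y)² + 2 x y + 3 x + 3 y + 2, which is positive.
    impossible : ⊥
    impossible = eq (+ x) (+ y) (areas (+ x) (+ y) refl refl) (nat x) (nat y)
      where
      eq : ∀ X Y →
        Y * (+ 0) + (+ 1 + X) * (+ 1) + Y * (+ 0) + (Y * (+ 1 + X) * (+ 1) + Y * Y * (+ 1) + (+ 1 + X) * Y * (+ 1))
        ≡ X * (+ 0) + (+ 1 + Y) * (- + 1) + X * (+ 0) + (X * (+ 1 + Y) * (- + 1) + X * X * (- + 1) + (+ 1 + Y) * X * (- + 1)) →
        0≤ X → 0≤ Y → ⊥
      eq X Y areas 0≤X 0≤Y = absurd 0 ((0≤X ⊹ 0≤Y) ⊠ (0≤X ⊹ 0≤Y) ⊹ nat 3 ⊠ 0≤X ⊹ nat 3 ⊠ 0≤Y ⊹ nat 2 ⊠ 0≤X ⊠ 0≤Y ⊹ nat 1) (sym (begin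
        (X + Y) * (X + Y) + + 3 * X + + 3 * Y + + 2 * X * Y + + 1
          ≡⟨ solve (X ∷ Y ∷ []) ⟩
        ((Y * (+ 0) + (+ 1 + X) * (+ 1) + Y * (+ 0) + (Y * (+ 1 + X) * (+ 1) + Y * Y * (+ 1) + (+ 1 + X) * Y * (+ 1)))
          - (X * (+ 0) + (+ 1 + Y) * (- + 1) + X * (+ 0) + (X * (+ 1 + Y) * (- + 1) + X * X * (- + 1) + (+ 1 + Y) * X * (- + 1)))) - + 1
          ≡⟨ cong (λ i → (i - (X * (+ 0) + (+ 1 + Y) * (- + 1) + X * (+ 0) + (X * (+ 1 + Y) * (- + 1) + X * X * (- + 1) + (+ 1 + Y) * X * (- + 1)))) - + 1) areas ⟩
        ((X * (+ 0) + (+ 1 + Y) * (- + 1) + X * (+ 0) + (X * (+ 1 + Y) * (- + 1) + X * X * (- + 1) + (+ 1 + Y) * X * (- + 1)))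
          - (X * (+ 0) + (+ 1 + Y) * (- + 1) + X * (+ 0) + (X * (+ 1 + Y) * (- + 1) + X * X * (- + 1) + (+ 1 + Y) * X * (- + 1)))) - + 1
          ≡⟨ cong (λ i → i - + 1) (ℤₚ.+-inverseʳ (X * (+ 0) + (+ 1 + Y) * (- + 1) + X * (+ 0) + (X * (+ 1 + Y) * (- + 1) + X * X * (- + 1) + (+ 1 + Y) * X * (- + 1)))) ⟩
        - + 1 ∎))
        where open ≡-Reasoning

  necessity : PairedPentagonal a b
  necessity = by-residue (+ 2 * b - a) refl f≥0
    where
    -- The side lengths determine the parameters: 2 b - a = 3 x + δ and 2 a - b = 3 y + δ. Naming
    -- the integer `f` lets its sign be matched on.
    by-residue : ∀ f → f ≡ + 2 * b - a → 0≤ f → PairedPentagonal a b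
    by-residue (+ f) f≡ _ = split (f ℕ.% 3) (f ℕ./ 3) (ℕₚ.≤-pred (m%n<n f 3)) (trans (sym f≡) (cong +_ (m≡m%n+[m/n]*n f 3)))
      where
      split : ∀ d x → d ℕ.≤ 2 → + 2 * b - a ≡ + (d ℕ.+ x ℕ.* 3) → PairedPentagonal a b
      split d x d≤2 eq = found (b - + 2 * + x - + d) refl (0≤-third (b - + 2 * + x - + d)
          (via (g≥0 ⊹ gap (+≤+ d≤2)) (eq₁ (+ x) (+ d) a b eq′)))
        where
        eq′ : + 2 * b - a ≡ + d + + x * + 3
        eq′ = trans eq (cong (λ i → + d + i) (ℤₚ.pos-* x 3))
        eq₁ : ∀ x d a b → + 2 * b - a ≡ d + x * + 3 → + 3 * (b - + 2 * x - d) + + 2 ≡ + 2 * a - b + (+ 2 - d)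
        eq₁ x d a b eq = begin
          + 3 * (b - + 2 * x - d) + + 2                           ≡⟨ solve (x ∷ d ∷ b ∷ []) ⟩
          + 3 * b - + 2 * (d + x * + 3) + (+ 2 - d)               ≡⟨ cong (λ i → + 3 * b - + 2 * i + (+ 2 - d)) eq ⟨
          + 3 * b - + 2 * (+ 2 * b - a) + (+ 2 - d)               ≡⟨ solve (a ∷ b ∷ d ∷ []) ⟩
          + 2 * a - b + (+ 2 - d)                                 ∎
          where open ≡-Reasoning
        found : ∀ y → y ≡ b - + 2 * + x - + d → 0≤ y → PairedPentagonal a b
        found (+ y) y≡ _ = residue d d≤2 (a≡ (+ x) (+ y) (+ d) a b eq′ y≡) (b≡ (+ x) (+ y) (+ d) b y≡)
          where
          b≡ : ∀ x y d b → y ≡ b - + 2 * x - d → b ≡ + 2 * x + y + d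
          b≡ x _ d b refl = solve (x ∷ d ∷ b ∷ [])
          a≡ : ∀ x y d a b → + 2 * b - a ≡ d + x * + 3 → y ≡ b - + 2 * x - d → a ≡ x + + 2 * y + d
          a≡ x _ d a b eq refl = begin
            a                                   ≡⟨ solve (a ∷ b ∷ []) ⟩
            + 2 * b - (+ 2 * b - a)             ≡⟨ cong (λ i → + 2 * b - i) eq ⟩
            + 2 * b - (d + x * + 3)             ≡⟨ solve (x ∷ d ∷ b ∷ []) ⟩
            x + + 2 * (b - + 2 * x - d) + d     ∎
            where open ≡-Reasoning
          residue : ∀ d → d ℕ.≤ 2 → a ≡ + x + + 2 * + y + + d → b ≡ + 2 * + x + + y + + d → PairedPentagonal a b
          residue 0 _ a≡ b≡ = Residue0.conclusion x y a≡ b≡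
          residue 1 _ a≡ b≡ = ⊥-elim (Residue1.impossible x y a≡ b≡)
          residue 2 _ a≡ b≡ = ⊥-elim (Residue2.impossible x y a≡ b≡)
          residue (suc (suc (suc _))) (s≤s (s≤s ())) _ _

-- The tiling of the pentagonal benzels

tri : ℕ → ℕ
tri zero    = 0
tri (suc n) = suc n ℕ.+ tri n

tri-mono : ∀ {m n} → m ℕ.≤ n → tri m ℕ.≤ tri n
tri-mono z≤n       = z≤n
tri-mono (s≤s m≤n) = ℕₚ.+-mono-≤ (s≤s m≤n) (tri-mono m≤n)

2*tri : ∀ n → + 2 * + tri n ≡ + n * (+ n + + 1)
2*tri zero    = refl
2*tri (suc n) = step (+ n) (+ tri n) (2*tri n)
  where
  step : ∀ n t → + 2 * t ≡ n * (n + + 1) → + 2 * (+ 1 + n + t) ≡ (+ 1 + n) * (+ 1 + n + + 1)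
  step n t eq = begin
    + 2 * (+ 1 + n + t)           ≡⟨ solve (n ∷ t ∷ []) ⟩
    + 2 * (+ 1 + n) + + 2 * t     ≡⟨ cong (λ i → + 2 * (+ 1 + n) + i) eq ⟩
    + 2 * (+ 1 + n) + n * (n + + 1) ≡⟨ solve (n ∷ []) ⟩
    (+ 1 + n) * (+ 1 + n + + 1)   ∎
    where open ≡-Reasoning

-- The largest τ ≤ p with tri τ < μ.
root : ℕ → ℕ → ℕ
root zero    μ = 0
root (suc p) μ with tri (suc p) ℕ.<? μ
... | yes _ = suc p
... | no  _ = root p μ

root≤ : ∀ p μ → root p μ ℕ.≤ p
root≤ zero    μ = z≤n
root≤ (suc p) μ with tri (suc p) ℕ.<? μ
... | yes _ = ℕₚ.≤-refl
... | no  _ = ℕₚ.m≤n⇒m≤1+n (root≤ p μ)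

tri-root< : ∀ p μ → 0 ℕ.< μ → tri (root p μ) ℕ.< μ
tri-root< zero    μ 0<μ = 0<μ
tri-root< (suc p) μ 0<μ with tri (suc p) ℕ.<? μ
... | yes lt = lt
... | no  _  = tri-root< p μ 0<μ

root-maximal : ∀ p μ → root p μ ≡ p ⊎ (root p μ ℕ.< p × μ ℕ.≤ tri (suc (root p μ)))
root-maximal zero    μ = inj₁ refl
root-maximal (suc p) μ with tri (suc p) ℕ.<? μ
... | yes _ = inj₁ refl
... | no ≮  with root-maximal p μ
... | inj₁ eq         = inj₂ (s≤s (root≤ p μ) , subst (λ r → μ ℕ.≤ tri (suc r)) (sym eq) (ℕₚ.≮⇒≥ ≮))
... | inj₂ (lt , le)  = inj₂ (ℕₚ.m<n⇒m<1+n lt , le)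

-- What is used of τ = root p μ, with T = tri p and R = tri τ.
record Root (p T μ τ R : ℤ) : Set where
  field
    τ≥0   : 0≤ τ
    τ≤p   : 0≤ p - τ
    R<μ   : 0≤ μ - + 1 - R
    2R    : + 2 * R ≡ τ * (τ + + 1)
    R≤T   : 0≤ T - R
    max   : 0≤ τ - p ⊎ (0≤ R + τ + + 1 - μ × 0≤ T - μ)

root-Root : ∀ p μ → 0 ℕ.< μ → Root (+ p) (+ tri p) (+ μ) (+ root p μ) (+ tri (root p μ))
root-Root p μ 0<μ = record
  { τ≥0 = nat (root p μ)
  ; τ≤p = gap (+≤+ (root≤ p μ))
  ; R<μ = via (gap (+≤+ (tri-root< p μ 0<μ))) (eq (+ μ) (+ tri (root p μ)))
  ; 2R  = 2*tri (root p μ)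
  ; R≤T = gap (+≤+ (tri-mono (root≤ p μ)))
  ; max = cases (root-maximal p μ) }
  where
  eq : ∀ μ R → μ - + 1 - R ≡ μ - (+ 1 + R)
  eq = solve-∀
  eq₂ : ∀ τ R μ → R + τ + + 1 - μ ≡ + 1 + τ + R - μ
  eq₂ = solve-∀
  cases : root p μ ≡ p ⊎ (root p μ ℕ.< p × μ ℕ.≤ tri (suc (root p μ))) → _
  cases (inj₁ eq) = inj₁ (gap (+≤+ (ℕₚ.≤-reflexive (sym eq))))
  cases (inj₂ (lt , le)) = inj₂
    ( via (gap (+≤+ le)) (eq₂ (+ root p μ) (+ tri (root p μ)) (+ μ))
    , gap (+≤+ (ℕₚ.≤-trans le (tri-mono lt))) )

-- The parabola and the three sectors

record Box (A B w v u : ℤ) : Set where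
  field
    aw : 0≤ A + w
    av : 0≤ A + v
    au : 0≤ A + u
    bw : 0≤ B - w
    bv : 0≤ B - v
    bu : 0≤ B - u

-- The parabola 2 v = w (3 w - 1) passes through the generalised pentagonal numbers; a point is inner
-- if it lies strictly below the arm w < 0.
record Inner (w v : ℤ) : Set where
  constructor inner
  field
    w<0   : 0≤ - + 1 - w
    under : 0≤ w * (+ 3 * w - + 1) - + 1 - + 2 * v

record Outer (w v : ℤ) : Set where
  constructor outer
  field
    either : 0≤ w ⊎ 0≤ + 2 * v - w * (+ 3 * w - + 1)

inner-or-outer : ∀ w v → Inner w v ⊎ Outer w v
inner-or-outer w v =
  [ (λ p → inj₂ (outer (inj₁ p)))
  , (λ p → [ (λ q → inj₂ (outer (inj₂ q))) , (λ q → inj₁ (inner p (below q))) ]′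
             (0≤-dec (+ 2 * v - w * (+ 3 * w - + 1))))
  ]′ (0≤-dec w)
  where
  below : 0≤ - + 1 - (+ 2 * v - w * (+ 3 * w - + 1)) → 0≤ w * (+ 3 * w - + 1) - + 1 - + 2 * v
  below q = via q (solve (w ∷ v ∷ []))

inner-not-outer : ∀ w v → Inner w v → Outer w v → ⊥
inner-not-outer w v i o = [ left (Inner.w<0 i) , under (Inner.under i) ]′ (Outer.either o)
  where
  left : 0≤ - + 1 - w → 0≤ w → ⊥
  left p r = absurd 0 (p ⊹ r) (solve (w ∷ []))
  under : 0≤ w * (+ 3 * w - + 1) - + 1 - + 2 * v → 0≤ + 2 * v - w * (+ 3 * w - + 1) → ⊥
  under q r = absurd 0 (q ⊹ r) (solve (w ∷ v ∷ []))

not-all-inner : ∀ w v u → w + v + u ≡ + 0 → Inner w v → Inner v u → Inner u w → ⊥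
not-all-inner w v u eq (inner p _) (inner q _) (inner r _) = absurd 2 (p ⊹ q ⊹ r) (sym (begin
  - + 1 - w + (- + 1 - v) + (- + 1 - u)             ≡⟨ solve (w ∷ v ∷ u ∷ []) ⟩
  - + 3 - (w + v + u)                               ≡⟨ cong (λ i → - + 3 - i) eq ⟩
  - + 3 ∎))
  where open ≡-Reasoning

two-negatives : ∀ w u → 0≤ - + 1 - w → 0≤ - + 1 - u → Outer u w → ⊥
two-negatives w u p q o = [ left , over ]′ (Outer.either o)
  where
  left : 0≤ u → ⊥
  left r = absurd 0 (q ⊹ r) (solve (u ∷ []))
  over : 0≤ + 2 * w - u * (+ 3 * u - + 1) → ⊥
  over r = absurd 5 (r ⊹ nat 2 ⊠ p ⊹ nat 3 ⊠ q ⊠ q ⊹ nat 7 ⊠ q) (solve (w ∷ u ∷ []))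

-- On the outer side, w < 0 forces v ≥ 2|w|, hence u < 0, hence w > 0.
negative-not-outer : ∀ w v u → w + v + u ≡ + 0 → 0≤ - + 1 - w → Outer w v → Outer u w → ⊥
negative-not-outer w v u eq p ow ou = [ right , over ]′ (Outer.either ow)
  where
  open ≡-Reasoning
  right : 0≤ w → ⊥
  right q = absurd 0 (p ⊹ q) (solve (w ∷ []))
  over : 0≤ + 2 * v - w * (+ 3 * w - + 1) → ⊥
  over q = two-negatives w u p (0≤-half (- + 1 - u) (via (q ⊹ nat 3 ⊠ p ⊠ p ⊹ nat 5 ⊠ p ⊹ nat 1) (begin
    + 2 * (- + 1 - u) + + 1                 ≡⟨ solve (w ∷ v ∷ u ∷ []) ⟩
    + 2 * (w + v - + 1) + + 1 - + 2 * (w + v + u)  ≡⟨ cong (λ i → + 2 * (w + v - + 1) + + 1 - + 2 * i) eq ⟩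
    + 2 * (w + v - + 1) + + 1 - + 2 * + 0   ≡⟨ solve (w ∷ v ∷ []) ⟩
    + 2 * v - w * (+ 3 * w - + 1) + + 3 * (- + 1 - w) * (- + 1 - w) + + 5 * (- + 1 - w) + + 1 ∎))) ou

-- Three outer conditions leave only the origin, where w = v = u = 0. The origin is no cell centre,
-- as v - w is -1 modulo 3.
not-all-outer : ∀ w v u μ → w + v + u ≡ + 0 → v ≡ w + + 3 * μ - + 1 →
  Outer w v → Outer v u → Outer u w → ⊥
not-all-outer w v u μ sum step ow ov ou = cases (0≤-dec w) (0≤-dec v) (0≤-dec u)
  where
  open ≡-Reasoning
  cases : 0≤ w ⊎ 0≤ - + 1 - w → 0≤ v ⊎ 0≤ - + 1 - v → 0≤ u ⊎ 0≤ - + 1 - u → ⊥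
  cases (inj₂ p) _ _ = negative-not-outer w v u sum p ow ou
  cases _ (inj₂ p) _ = negative-not-outer v u w (trans (rotate w v u) sum) p ov ow
    where
    rotate : ∀ w v u → v + u + w ≡ w + v + u
    rotate = solve-∀
  cases _ _ (inj₂ p) = negative-not-outer u w v (trans (rotate w v u) sum) p ou ov
    where
    rotate : ∀ w v u → u + w + v ≡ w + v + u
    rotate = solve-∀
  cases (inj₁ p) (inj₁ q) (inj₁ r) = zero-absurd (0≤-dec (μ - + 1))
    where
    zero-absurd : 0≤ μ - + 1 ⊎ 0≤ - + 1 - (μ - + 1) → ⊥
    zero-absurd (inj₁ s) = absurd 1 (p ⊹ p ⊹ r ⊹ nat 3 ⊠ s) (sym (begin
      w + w + u + + 3 * (μ - + 1)                      ≡⟨ solve (w ∷ u ∷ μ ∷ []) ⟩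
      w + (w + + 3 * μ - + 1) + u - + 2                ≡⟨ cong (λ i → w + i + u - + 2) step ⟨
      w + v + u - + 2                                  ≡⟨ cong (λ i → i - + 2) sum ⟩
      - + 2 ∎))
    zero-absurd (inj₂ s) = absurd 0 (q ⊹ q ⊹ r ⊹ nat 3 ⊠ s) (sym (begin
      v + v + u + + 3 * (- + 1 - (μ - + 1))            ≡⟨ solve (w ∷ v ∷ u ∷ μ ∷ []) ⟩
      w + v + u + v - (w + + 3 * μ - + 1) - + 1        ≡⟨ cong₂ (λ i j → i + v - j - + 1) sum (sym step) ⟩
      + 0 + v - v - + 1                                ≡⟨ solve (v ∷ []) ⟩
      - + 1 ∎))

-- The lines of a sector

slack : ∀ {i j} → i ≡ j → 0≤ i - j
slack {i} refl = via (nat 0) (ℤₚ.+-inverseʳ i)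

slack′ : ∀ {i j} → i ≡ j → 0≤ j - i
slack′ eq = slack (sym eq)

-- Line μ of a sector, v - w = 3 μ - 1, runs from v = -(τ + 1) to w = -(τ + 1) and has 3 μ cells, hence is a
-- row of μ bones; the benzel cuts it only between bones.  Here k = p + 1 and T = tri p, so that a = 3 T + p + 1
-- and b = 3 T + 2 p + 2.
module Strip (p T μ τ R : ℤ) (2T : + 2 * T ≡ p * (p + + 1)) (T≥1 : 0≤ T - + 1) (root : Root p T μ τ R) where
  open Root root

  p≥0 : 0≤ p
  p≥0 = via (τ≤p ⊹ τ≥0) (solve (p ∷ τ ∷ []))

  A B : ℤ
  A = + 3 * T + p
  B = + 3 * T + + 2 * p + + 1

  2B : p * (+ 3 * p + + 7) + + 2 ≡ + 2 * B
  2B = begin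
    p * (+ 3 * p + + 7) + + 2                    ≡⟨ solve (p ∷ []) ⟩
    + 3 * (p * (p + + 1)) + + 4 * p + + 2        ≡⟨ cong (λ i → + 3 * i + + 4 * p + + 2) 2T ⟨
    + 3 * (+ 2 * T) + + 4 * p + + 2              ≡⟨ solve (p ∷ T ∷ []) ⟩
    + 2 * (+ 3 * T + + 2 * p + + 1)              ∎
    where open ≡-Reasoning

  -- Put v = w + 3 μ - 1 and w = -t: then 2 v < w (3 w - 1) becomes 6 μ - 2 < 3 t (t + 1), that is μ
  -- ≤ tri t. Hence the arm is crossed just before t = τ + 1.
  under-by-root : ∀ w v → v ≡ w + + 3 * μ - + 1 → 0≤ - + 1 - w - τ → 0≤ R + τ + + 1 - μ →
    0≤ w * (+ 3 * w - + 1) - + 1 - + 2 * v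
  under-by-root w v v≡ d q = via
    (nat 6 ⊠ q ⊹ nat 3 ⊠ d ⊠ (d ⊹ nat 2 ⊠ τ≥0 ⊹ nat 3) ⊹ nat 1 ⊹ nat 3 ⊠ slack′ 2R ⊹ nat 2 ⊠ slack′ v≡)
    (solve (w ∷ v ∷ μ ∷ τ ∷ R ∷ []))

  -- At w = -(p + 1) the parabola has v = B + 1, the pentagonal number b. Once τ has reached its cap
  -- p, the side v ≤ B of the benzel therefore does the work of the parabola.
  under-by-bound : ∀ w v b → p * (+ 3 * p + + 7) + + 2 ≡ + 2 * b → 0≤ - + 1 - w - τ → 0≤ τ - p → 0≤ b - v →
    0≤ w * (+ 3 * w - + 1) - + 1 - + 2 * v
  under-by-bound w v b 2b d q bv = via
    (nat 2 ⊠ bv ⊹ (d ⊹ q) ⊠ (nat 3 ⊠ (d ⊹ q) ⊹ nat 6 ⊠ p≥0 ⊹ nat 7) ⊹ nat 1 ⊹ slack 2b)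
    (solve (w ∷ v ∷ b ∷ τ ∷ p ∷ []))

  -- With v = -(t + 1), the condition 2 u ≥ v (3 v - 1) on line μ becomes tri t < μ. This is the
  -- same threshold as at the other end of the line.
  over-by-root : ∀ v u → u ≡ + 3 * μ - + 1 - + 2 * v → 0≤ - + 1 - v → 0≤ v + τ + + 1 → 0≤ + 2 * u - v * (+ 3 * v - + 1)
  over-by-root v u u≡ n e = via
    (nat 6 ⊠ R<μ ⊹ nat 3 ⊠ slack 2R ⊹ nat 3 ⊠ e ⊠ (τ≥0 ⊹ n ⊹ nat 1) ⊹ nat 4 ⊹ nat 2 ⊠ slack u≡)
    (solve (v ∷ u ∷ μ ∷ τ ∷ R ∷ []))

  not-past-root : ∀ w v → v ≡ w + + 3 * μ - + 1 → 0≤ - + 1 - w → 0≤ w * (+ 3 * w - + 1) - + 1 - + 2 * v →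
    0≤ - + 1 - (- + 1 - w - τ) → ⊥
  not-past-root w v v≡ n under x = absurd 4
    (under ⊹ nat 6 ⊠ R<μ ⊹ nat 3 ⊠ slack 2R ⊹ nat 3 ⊠ x ⊠ (τ≥0 ⊹ n ⊹ nat 2) ⊹ nat 2 ⊠ slack v≡)
    (solve (w ∷ v ∷ μ ∷ τ ∷ R ∷ []))

  not-beyond-root : ∀ v u → u ≡ + 3 * μ - + 1 - + 2 * v → 0≤ + 2 * u - v * (+ 3 * v - + 1) → 0≤ R + τ + + 1 - μ →
    0≤ - + 1 - (v + τ + + 1) → ⊥
  not-beyond-root v u u≡ over q x = absurd 1
    (over ⊹ nat 2 ⊠ slack′ u≡ ⊹ nat 6 ⊠ q ⊹ nat 3 ⊠ slack′ 2R ⊹ nat 3 ⊠ x ⊠ (x ⊹ nat 2 ⊠ τ≥0 ⊹ nat 3))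
    (solve (v ∷ u ∷ μ ∷ τ ∷ R ∷ []))

  not-beyond-bound : ∀ v u b → p * (+ 3 * p + + 7) + + 2 ≡ + 2 * b → 0≤ + 2 * u - v * (+ 3 * v - + 1) → 0≤ b - u →
    0≤ τ - p → 0≤ - + 1 - (v + τ + + 1) → ⊥
  not-beyond-bound v u b 2b over bu q x = absurd 11
    (over ⊹ nat 2 ⊠ bu ⊹ slack 2b ⊹ (x ⊹ q) ⊠ (nat 3 ⊠ (x ⊹ q) ⊹ nat 6 ⊠ p≥0 ⊹ nat 13) ⊹ nat 6 ⊠ p≥0)
    (solve (v ∷ u ∷ b ∷ τ ∷ p ∷ []))

  -- `J` bones of the line precede this one, on the side of small v, and `I` follow it. If τ = p,
  -- the sides w = -A and v = B cut the line exactly at I = T and J = T + p + 1; if τ < p, then μ ≤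
  -- T and no bone of the line is lost.
  module Sound (I J r : ℤ) (I≥0 : 0≤ I) (I<T : 0≤ T - + 1 - I) (J≥0 : 0≤ J) (J<T′ : 0≤ T + p - J)
    (r≥0 : 0≤ r) (r≤2 : 0≤ + 2 - r) (μ≡ : μ ≡ + 1 + I + J) where

    w v u : ℤ
    w = r - τ - + 3 - + 3 * I
    v = r - τ - + 1 + + 3 * J
    u = - w - v

    J≤T+τ : 0≤ T + τ - J
    J≤T+τ = [ saturated , strict ]′ max
      where
      saturated : 0≤ τ - p → 0≤ T + τ - J
      saturated q = via (J<T′ ⊹ q) (solve (T ∷ τ ∷ p ∷ J ∷ []))
      strict : 0≤ R + τ + + 1 - μ × 0≤ T - μ → 0≤ T + τ - J
      strict (q , _) = via (q ⊹ R≤T ⊹ I≥0 ⊹ slack μ≡) (solve (T ∷ τ ∷ R ∷ μ ∷ I ∷ J ∷ []))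

    box : Box A B w v u
    box = record { aw = aw ; av = av ; au = au ; bw = bw ; bv = bv ; bu = bu }
      where
      aw : 0≤ + 3 * T + p + (r - τ - + 3 - + 3 * I)
      aw = via (nat 3 ⊠ I<T ⊹ r≥0 ⊹ τ≤p) (solve (T ∷ p ∷ τ ∷ r ∷ I ∷ []))
      av : 0≤ + 3 * T + p + (r - τ - + 1 + + 3 * J)
      av = via (nat 3 ⊠ T≥1 ⊹ τ≤p ⊹ r≥0 ⊹ nat 2 ⊹ nat 3 ⊠ J≥0) (solve (T ∷ p ∷ τ ∷ r ∷ J ∷ []))
      au : 0≤ + 3 * T + p + (- (r - τ - + 3 - + 3 * I) - (r - τ - + 1 + + 3 * J))
      au = via (nat 2 ⊠ r≤2 ⊹ nat 3 ⊠ I≥0 ⊹ τ≤p ⊹ nat 3 ⊠ J≤T+τ) (solve (T ∷ p ∷ τ ∷ r ∷ I ∷ J ∷ []))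
      bw : 0≤ + 3 * T + + 2 * p + + 1 - (r - τ - + 3 - + 3 * I)
      bw = via (nat 3 ⊠ (T≥1 ⊹ nat 1) ⊹ nat 2 ⊠ p≥0 ⊹ τ≥0 ⊹ nat 3 ⊠ I≥0 ⊹ nat 2 ⊹ r≤2) (solve (T ∷ p ∷ τ ∷ r ∷ I ∷ []))
      bv : 0≤ + 3 * T + + 2 * p + + 1 - (r - τ - + 1 + + 3 * J)
      bv = via (r≤2 ⊹ nat 3 ⊠ J≤T+τ ⊹ nat 2 ⊠ τ≤p) (solve (T ∷ p ∷ τ ∷ r ∷ J ∷ []))
      bu : 0≤ + 3 * T + + 2 * p + + 1 - (- (r - τ - + 3 - + 3 * I) - (r - τ - + 1 + + 3 * J))
      bu = via (nat 3 ⊠ I<T ⊹ nat 2 ⊠ τ≤p ⊹ nat 2 ⊠ r≥0 ⊹ nat 3 ⊠ J≥0) (solve (T ∷ p ∷ τ ∷ r ∷ I ∷ J ∷ []))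

    v≡ : v ≡ w + + 3 * μ - + 1
    v≡ = trans (eq r τ I J) (cong (λ i → w + + 3 * i - + 1) (sym μ≡))
      where
      eq : ∀ r τ I J → r - τ - + 1 + + 3 * J ≡ r - τ - + 3 - + 3 * I + + 3 * (+ 1 + I + J) - + 1
      eq = solve-∀

    u≡ : u ≡ + 3 * μ - + 1 - + 2 * v
    u≡ = eq w v μ v≡
      where
      eq : ∀ w v μ → v ≡ w + + 3 * μ - + 1 → - w - v ≡ + 3 * μ - + 1 - + 2 * v
      eq w v μ v≡ = begin
        - w - v                                ≡⟨ solve (w ∷ v ∷ []) ⟩
        - w + v - + 2 * v                      ≡⟨ cong (λ i → - w + i - + 2 * v) v≡ ⟩
        - w + (w + + 3 * μ - + 1) - + 2 * v    ≡⟨ solve (w ∷ v ∷ μ ∷ []) ⟩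
        + 3 * μ - + 1 - + 2 * v                ∎
        where open ≡-Reasoning

    is-inner : Inner w v
    is-inner = record
      { w<0   = n
      ; under = [ (λ q → under-by-bound w v B 2B d q (Box.bv box)) , (λ q → under-by-root w v v≡ d (proj₁ q)) ]′ max }
      where
      n : 0≤ - + 1 - (r - τ - + 3 - + 3 * I)
      n = via (r≤2 ⊹ τ≥0 ⊹ nat 3 ⊠ I≥0) (solve (r ∷ τ ∷ I ∷ []))
      d : 0≤ - + 1 - (r - τ - + 3 - + 3 * I) - τ
      d = via (r≤2 ⊹ nat 3 ⊠ I≥0) (solve (r ∷ τ ∷ I ∷ []))

    is-outer : Outer v u
    is-outer = outer ([ inj₁ , (λ n → inj₂ (over-by-root v u u≡ n e)) ]′ (0≤-dec v))
      where
      e : 0≤ (r - τ - + 1 + + 3 * J) + τ + + 1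
      e = via (r≥0 ⊹ nat 3 ⊠ J≥0) (solve (r ∷ τ ∷ J ∷ []))

  module Cover (w v u : ℤ) (v≡ : v ≡ w + + 3 * μ - + 1) (sum : w + v + u ≡ + 0)
    (box : Box A B w v u) (inn : Inner w v) (out : Outer v u) where

    u≡ : u ≡ + 3 * μ - + 1 - + 2 * v
    u≡ = eq w v u μ sum v≡
      where
      eq : ∀ w v u μ → w + v + u ≡ + 0 → v ≡ w + + 3 * μ - + 1 → u ≡ + 3 * μ - + 1 - + 2 * v
      eq w v u μ sum v≡ = begin
        u                                          ≡⟨ solve (w ∷ v ∷ u ∷ []) ⟩
        w + v + u + (v - w) - + 2 * v              ≡⟨ cong₂ (λ i j → i + (j - w) - + 2 * v) sum v≡ ⟩
        + 0 + (w + + 3 * μ - + 1 - w) - + 2 * v    ≡⟨ solve (w ∷ v ∷ μ ∷ []) ⟩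
        + 3 * μ - + 1 - + 2 * v                    ∎
        where open ≡-Reasoning

    d : 0≤ - + 1 - w - τ
    d = [ id , (λ x → ⊥-elim (not-past-root w v v≡ (Inner.w<0 inn) (Inner.under inn) x)) ]′ (0≤-dec (- + 1 - w - τ))

    e : 0≤ v + τ + + 1
    e = [ id , (λ x → ⊥-elim ([ right x , over x ]′ (Outer.either out))) ]′ (0≤-dec (v + τ + + 1))
      where
      right : 0≤ - + 1 - (v + τ + + 1) → 0≤ v → ⊥
      right x q = absurd 1 (x ⊹ q ⊹ τ≥0) (solve (v ∷ τ ∷ []))
      over : 0≤ - + 1 - (v + τ + + 1) → 0≤ + 2 * u - v * (+ 3 * v - + 1) → ⊥
      over x o = [ (λ q → not-beyond-bound v u B 2B o (Box.bu box) q x) , (λ q → not-beyond-root v u u≡ o (proj₁ q) x) ]′ max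

    t : 0≤ w + τ + + 3 * T
    t = [ saturated , (λ q → strict (proj₂ q)) ]′ max
      where
      saturated : 0≤ τ - p → 0≤ w + τ + + 3 * T
      saturated q = via (Box.aw box ⊹ q) (eq w τ T p)
        where
        eq : ∀ w τ T p → w + τ + + 3 * T ≡ + 3 * T + p + w + (τ - p)
        eq = solve-∀
      strict : 0≤ T - μ → 0≤ w + τ + + 3 * T
      strict q = via (e ⊹ nat 3 ⊠ q ⊹ slack′ v≡) (solve (w ∷ v ∷ τ ∷ T ∷ μ ∷ []))

    module _ (J r : ℤ) (vτ : v + τ + + 1 ≡ r + + 3 * J) (r≥0 : 0≤ r) (r≤2 : 0≤ + 2 - r) where

      I : ℤ
      I = μ - + 1 - J

      I≥0 : 0≤ I
      I≥0 = 0≤-third (μ - + 1 - J) (via (d ⊹ r≥0 ⊹ slack vτ ⊹ slack′ v≡) (solve (w ∷ v ∷ τ ∷ μ ∷ J ∷ r ∷ [])))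

      I<T : 0≤ T - + 1 - I
      I<T = 0≤-third (T - + 1 - (μ - + 1 - J)) (via (t ⊹ r≤2 ⊹ slack′ vτ ⊹ slack v≡) (solve (w ∷ v ∷ τ ∷ T ∷ μ ∷ J ∷ r ∷ [])))

      J<T′ : 0≤ T + p - J
      J<T′ = [ saturated , (λ q → strict (proj₂ q)) ]′ max
        where
        saturated : 0≤ τ - p → 0≤ T + p - J
        saturated q = 0≤-third (T + p - J) (via (Box.bv box ⊹ τ≤p ⊹ r≥0 ⊹ slack vτ) (eq v τ T p J r))
          where
          eq : ∀ v τ T p J r → + 3 * (T + p - J) + + 2 ≡ + 3 * T + + 2 * p + + 1 - v + (p - τ) + r + (v + τ + + 1 - (r + + 3 * J))
          eq = solve-∀
        strict : 0≤ T - μ → 0≤ T + p - J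
        strict q = via (q ⊹ p≥0 ⊹ nat 1 ⊹ I≥0) (eq T p μ J)
          where
          eq : ∀ T p μ J → T + p - J ≡ T - μ + p + + 1 + (μ - + 1 - J)
          eq = solve-∀

      v-form : v ≡ r - τ - + 1 + + 3 * J
      v-form = eq v τ r J vτ
        where
        eq : ∀ v τ r J → v + τ + + 1 ≡ r + + 3 * J → v ≡ r - τ - + 1 + + 3 * J
        eq v τ r J vτ = begin
          v                        ≡⟨ solve (v ∷ τ ∷ []) ⟩
          v + τ + + 1 - τ - + 1    ≡⟨ cong (λ i → i - τ - + 1) vτ ⟩
          r + + 3 * J - τ - + 1    ≡⟨ solve (τ ∷ r ∷ J ∷ []) ⟩
          r - τ - + 1 + + 3 * J    ∎
          where open ≡-Reasoning

      w-form : w ≡ r - τ - + 3 - + 3 * I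
      w-form = eq w v μ τ r J v≡ v-form
        where
        eq : ∀ w v μ τ r J → v ≡ w + + 3 * μ - + 1 → v ≡ r - τ - + 1 + + 3 * J → w ≡ r - τ - + 3 - + 3 * (μ - + 1 - J)
        eq w v μ τ r J v≡ v-form = begin
          w                                              ≡⟨ solve (w ∷ μ ∷ []) ⟩
          w + + 3 * μ - + 1 - + 3 * μ + + 1              ≡⟨ cong (λ i → i - + 3 * μ + + 1) (trans (sym v≡) v-form) ⟩
          r - τ - + 1 + + 3 * J - + 3 * μ + + 1          ≡⟨ solve (μ ∷ τ ∷ r ∷ J ∷ []) ⟩
          r - τ - + 3 - + 3 * (μ - + 1 - J)              ∎
          where open ≡-Reasoning

-- For v ≥ 0 this is clear from w < 0. For v < 0, the outer condition gives 2 (v - w) ≥ 3 v (v + 1)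
-- ≥ 0, and rounding does the rest.
line-positive : ∀ w v u μ → v ≡ w + + 3 * μ - + 1 → w + v + u ≡ + 0 → Inner w v → Outer v u → 0≤ μ - + 1
line-positive w v u μ v≡ sum inn out = [ nonnegative , (λ x → [ nonnegative , negative x ]′ (Outer.either out)) ]′ (0≤-dec v)
  where
  n : 0≤ - + 1 - w
  n = Inner.w<0 inn
  nonnegative : 0≤ v → 0≤ μ - + 1
  nonnegative q = 0≤-third (μ - + 1) (via (q ⊹ n ⊹ nat 1 ⊹ slack′ v≡) (solve (w ∷ v ∷ μ ∷ [])))
  negative : 0≤ - + 1 - v → 0≤ + 2 * u - v * (+ 3 * v - + 1) → 0≤ μ - + 1
  negative x o = 0≤-third (μ - + 1) (via (0≤-half (v - w) (via (o ⊹ nat 3 ⊠ x ⊠ (x ⊹ nat 1) ⊹ nat 1 ⊹ nat 2 ⊠ slack′ sum) (solve (w ∷ v ∷ u ∷ []))) ⊹ slack′ v≡)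
    (solve (w ∷ v ∷ μ ∷ [])))

-- Coordinates adapted to the three sectors

-- The cell of sector d with sector coordinates w, v.
pt : Fin 3 → ℤ → ℤ → Pt
pt zero             w v = (- w - v , - v)
pt (suc zero)       w v = (v , - w)
pt (suc (suc zero)) w v = (w , w + v)

co₁ co₂ co₃ : Fin 3 → Pt → ℤ
co₁ zero             (x , y) = y - x
co₁ (suc zero)       (x , y) = - y
co₁ (suc (suc zero)) (x , y) = x
co₂ zero             (x , y) = - y
co₂ (suc zero)       (x , y) = x
co₂ (suc (suc zero)) (x , y) = y - x
co₃ zero             (x , y) = x
co₃ (suc zero)       (x , y) = y - x
co₃ (suc (suc zero)) (x , y) = - y

dir : Fin 3 → Dir
dir zero             = d₅
dir (suc zero)       = d₁
dir (suc (suc zero)) = d₃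

co₁-pt : ∀ d w v → co₁ d (pt d w v) ≡ w
co₁-pt zero             = eq
  where
  eq : ∀ w v → - v - (- w - v) ≡ w
  eq = solve-∀
co₁-pt (suc zero)       = λ w v → ℤₚ.neg-involutive w
co₁-pt (suc (suc zero)) = λ w v → refl

co₂-pt : ∀ d w v → co₂ d (pt d w v) ≡ v
co₂-pt zero             = λ w v → ℤₚ.neg-involutive v
co₂-pt (suc zero)       = λ w v → refl
co₂-pt (suc (suc zero)) = eq
  where
  eq : ∀ w v → w + v - w ≡ v
  eq = solve-∀

co₃-pt : ∀ d w v → co₃ d (pt d w v) ≡ - w - v
co₃-pt zero             = λ w v → refl
co₃-pt (suc zero)       = λ w v → refl
co₃-pt (suc (suc zero)) = eq
  where
  eq : ∀ w v → - (w + v) ≡ - w - v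
  eq = solve-∀

co-sum : ∀ d c → co₁ d c + co₂ d c + co₃ d c ≡ + 0
co-sum zero             (x , y) = eq x y
  where
  eq : ∀ x y → y - x + - y + x ≡ + 0
  eq = solve-∀
co-sum (suc zero)       (x , y) = eq x y
  where
  eq : ∀ x y → - y + x + (y - x) ≡ + 0
  eq = solve-∀
co-sum (suc (suc zero)) (x , y) = eq x y
  where
  eq : ∀ x y → x + (y - x) + - y ≡ + 0
  eq = solve-∀

pt-co : ∀ d c → c ≡ pt d (co₁ d c) (co₂ d c)
pt-co zero             (x , y) = cong₂ _,_ (eq x y) (sym (ℤₚ.neg-involutive y))
  where
  eq : ∀ x y → x ≡ - (y - x) - (- y)
  eq = solve-∀
pt-co (suc zero)       (x , y) = cong₂ _,_ refl (sym (ℤₚ.neg-involutive y))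
pt-co (suc (suc zero)) (x , y) = cong₂ _,_ refl (eq x y)
  where
  eq : ∀ x y → y ≡ x + (y - x)
  eq = solve-∀

co-line : ∀ d c q → proj₁ c + proj₂ c + + 1 ≡ q * + 3 → ∃[ μ ] co₂ d c ≡ co₁ d c + + 3 * μ - + 1
co-line zero (x , y) q eq = q - y , (begin
  - y                                   ≡⟨ solve (x ∷ y ∷ []) ⟩
  x + y + + 1 + - x - + 2 * y - + 1     ≡⟨ cong (λ i → i + - x - + 2 * y - + 1) eq ⟩
  q * + 3 + - x - + 2 * y - + 1         ≡⟨ solve (x ∷ y ∷ q ∷ []) ⟩
  y - x + + 3 * (q - y) - + 1           ∎)
  where open ≡-Reasoning
co-line (suc zero) (x , y) q eq = q , (begin
  x                                     ≡⟨ solve (x ∷ y ∷ []) ⟩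
  x + y + + 1 - y - + 1                 ≡⟨ cong (λ i → i - y - + 1) eq ⟩
  q * + 3 - y - + 1                     ≡⟨ solve (y ∷ q ∷ []) ⟩
  - y + + 3 * q - + 1                   ∎)
  where open ≡-Reasoning
co-line (suc (suc zero)) (x , y) q eq = q - x , (begin
  y - x                                 ≡⟨ solve (x ∷ y ∷ []) ⟩
  x + y + + 1 - + 2 * x - + 1           ≡⟨ cong (λ i → i - + 2 * x - + 1) eq ⟩
  q * + 3 - + 2 * x - + 1               ≡⟨ solve (x ∷ q ∷ []) ⟩
  x + + 3 * (q - x) - + 1               ∎)
  where open ≡-Reasoning

pt-lattice : ∀ d w v μ → v ≡ w + + 3 * μ - + 1 → InL-1 (pt d w v)
pt-lattice zero w v μ eq = ∣⇒∣ᵤ (divides (- w - + 2 * μ + + 1) (begin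
  - w - v + - v + + 1                                              ≡⟨ cong (λ i → - w - i + - i + + 1) eq ⟩
  - w - (w + + 3 * μ - + 1) + - (w + + 3 * μ - + 1) + + 1          ≡⟨ solve (w ∷ μ ∷ []) ⟩
  (- w - + 2 * μ + + 1) * + 3                                      ∎))
  where open ≡-Reasoning
pt-lattice (suc zero) w v μ eq = ∣⇒∣ᵤ (divides μ (begin
  v + - w + + 1                          ≡⟨ cong (λ i → i + - w + + 1) eq ⟩
  w + + 3 * μ - + 1 + - w + + 1          ≡⟨ solve (w ∷ μ ∷ []) ⟩
  μ * + 3                                ∎))
  where open ≡-Reasoning
pt-lattice (suc (suc zero)) w v μ eq = ∣⇒∣ᵤ (divides (w + μ) (begin
  w + (w + v) + + 1                        ≡⟨ cong (λ i → w + (w + i) + + 1) eq ⟩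
  w + (w + (w + + 3 * μ - + 1)) + + 1      ≡⟨ solve (w ∷ μ ∷ []) ⟩
  (w + μ) * + 3                            ∎))
  where open ≡-Reasoning

box→within : ∀ {A B} d w v → Box A B w v (- w - v) → Within A B (proj₁ (pt d w v)) (proj₂ (pt d w v))
box→within {A} {B} zero w v box = within {A} {B} { - w - v} { - v}
  au (via av (solve (A ∷ v ∷ []))) (via aw (solve (A ∷ w ∷ v ∷ [])))
  bu (via bv (solve (B ∷ v ∷ []))) (via bw (solve (B ∷ w ∷ v ∷ [])))
  where open Box box
box→within {A} {B} (suc zero) w v box = within {A} {B} {v} { - w}
  av (via aw (solve (A ∷ w ∷ []))) (via au (solve (A ∷ w ∷ v ∷ [])))
  bv (via bw (solve (B ∷ w ∷ []))) (via bu (solve (B ∷ w ∷ v ∷ [])))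
  where open Box box
box→within {A} {B} (suc (suc zero)) w v box = within {A} {B} {w} {w + v}
  aw (via au (solve (A ∷ w ∷ v ∷ []))) (via av (solve (A ∷ w ∷ v ∷ [])))
  bw (via bu (solve (B ∷ w ∷ v ∷ []))) (via bv (solve (B ∷ w ∷ v ∷ [])))
  where open Box box

within→box : ∀ {A B} d c → Within A B (proj₁ c) (proj₂ c) → Box A B (co₁ d c) (co₂ d c) (co₃ d c)
within→box zero (x , y) w = record { aw = aw ; av = av ; au = au ; bw = bw ; bv = bv ; bu = bu }
  where open Within w
within→box (suc zero) (x , y) w = record { aw = av ; av = au ; au = aw ; bw = bv ; bv = bu ; bu = bw }
  where open Within w
within→box (suc (suc zero)) (x , y) w = record { aw = au ; av = aw ; au = av ; bw = bu ; bv = bw ; bu = bv }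
  where open Within w

InSector : Fin 3 → Pt → Set
InSector d c = Inner (co₁ d c) (co₂ d c) × Outer (co₂ d c) (co₃ d c)

pt-sector : ∀ d w v → Inner w v → Outer v (- w - v) → InSector d (pt d w v)
pt-sector d w v i o =
  subst₂ Inner (sym (co₁-pt d w v)) (sym (co₂-pt d w v)) i ,
  subst₂ Outer (sym (co₂-pt d w v)) (sym (co₃-pt d w v)) o

-- Cyclically, the outer condition of a sector concerns the same pair of coordinates as the inner
-- condition of the next sector, and the two exclude each other.
sector-unique : ∀ c d d′ → InSector d c → InSector d′ c → d ≡ d′
sector-unique c zero             zero             _       _       = refl
sector-unique c (suc zero)       (suc zero)       _       _       = refl
sector-unique c (suc (suc zero)) (suc (suc zero)) _       _       = refl
sector-unique (x , y) zero             (suc zero)       (_ , o) (i , _) = ⊥-elim (inner-not-outer (- y) x i o)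
sector-unique (x , y) (suc zero)       zero             (i , _) (_ , o) = ⊥-elim (inner-not-outer (- y) x i o)
sector-unique (x , y) (suc zero)       (suc (suc zero)) (_ , o) (i , _) = ⊥-elim (inner-not-outer x (y - x) i o)
sector-unique (x , y) (suc (suc zero)) (suc zero)       (i , _) (_ , o) = ⊥-elim (inner-not-outer x (y - x) i o)
sector-unique (x , y) (suc (suc zero)) zero             (_ , o) (i , _) = ⊥-elim (inner-not-outer (y - x) (- y) i o)
sector-unique (x , y) zero             (suc (suc zero)) (i , _) (_ , o) = ⊥-elim (inner-not-outer (y - x) (- y) i o)

-- Going once around, the three predicates Inner cannot agree, so somewhere Inner is followed by Outer.
sector-exists : ∀ c q → proj₁ c + proj₂ c + + 1 ≡ q * + 3 → ∃[ d ] InSector d c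
sector-exists c@(x , y) q eq with inner-or-outer (y - x) (- y) | inner-or-outer (- y) x | inner-or-outer x (y - x)
... | inj₁ i | inj₂ o | _      = zero , i , o
... | _      | inj₁ i | inj₂ o = suc zero , i , o
... | inj₂ o | _      | inj₁ i = suc (suc zero) , i , o
... | inj₁ i | inj₁ j | inj₁ k = ⊥-elim (not-all-inner (y - x) (- y) x (co-sum zero c) i j k)
... | inj₂ i | inj₂ j | inj₂ k =
  let μ , line = co-line zero c q eq in ⊥-elim (not-all-outer (y - x) (- y) x μ (co-sum zero c) line i j k)

pt-second : ∀ d w v → pt d (w + + 1) (v + + 1) ≡ pt d w v ⊕ dirVec (dir d)
pt-second zero w v = cong₂ _,_ (eq w v) (eq′ v)
  where
  eq : ∀ w v → - (w + + 1) - (v + + 1) ≡ - w - v + - + 2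
  eq = solve-∀
  eq′ : ∀ v → - (v + + 1) ≡ - v + - + 1
  eq′ = solve-∀
pt-second (suc zero) w v = cong₂ _,_ refl (eq w)
  where
  eq : ∀ w → - (w + + 1) ≡ - w + - + 1
  eq = solve-∀
pt-second (suc (suc zero)) w v = cong₂ _,_ refl (eq w v)
  where
  eq : ∀ w v → w + + 1 + (v + + 1) ≡ w + v + + 2
  eq = solve-∀

pt-third : ∀ d w v → pt d (w + + 2) (v + + 2) ≡ pt d w v ⊕ scale (+ 2) (dirVec (dir d))
pt-third zero w v = cong₂ _,_ (eq w v) (eq′ v)
  where
  eq : ∀ w v → - (w + + 2) - (v + + 2) ≡ - w - v + - + 4
  eq = solve-∀
  eq′ : ∀ v → - (v + + 2) ≡ - v + - + 2
  eq′ = solve-∀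
pt-third (suc zero) w v = cong₂ _,_ refl (eq w)
  where
  eq : ∀ w → - (w + + 2) ≡ - w + - + 2
  eq = solve-∀
pt-third (suc (suc zero)) w v = cong₂ _,_ refl (eq w v)
  where
  eq : ∀ w v → w + + 2 + (v + + 2) ≡ w + v + + 4
  eq = solve-∀

-- Assembling the bones of the three sectors

module Tiling (p : ℕ) (a b : ℤ) (a≡ : a ≡ + 3 * + tri p + + p + + 1) (b≡ : b ≡ + 3 * + tri p + + 2 * + p + + 2)
  (T≥1 : 0≤ + tri p - + 1) where

  A≡ : a - + 1 ≡ + 3 * + tri p + + p
  A≡ = trans (cong (_- + 1) a≡) (eq (+ 3 * + tri p + + p))
    where
    eq : ∀ i → i + + 1 - + 1 ≡ i
    eq = solve-∀

  B≡ : b - + 1 ≡ + 3 * + tri p + + 2 * + p + + 1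
  B≡ = trans (cong (_- + 1) b≡) (eq (+ 3 * + tri p + + 2 * + p))
    where
    eq : ∀ i → i + + 2 - + 1 ≡ i + + 1
    eq = solve-∀

  0<a : 0≤ a - + 1
  0<a = subst 0≤_ (sym A≡) (nat 3 ⊠ nat (tri p) ⊹ nat p)

  0<b : 0≤ b - + 1
  0<b = subst 0≤_ (sym B≡) (nat 3 ⊠ nat (tri p) ⊹ nat 2 ⊠ nat p ⊹ nat 1)

  f≥0 : 0≤ + 2 * b - a
  f≥0 = via (nat 3 ⊠ nat (tri p) ⊹ nat 3 ⊠ nat p ⊹ nat 3) (eq (+ tri p) (+ p) a b a≡ b≡)
    where
    eq : ∀ T p a b → a ≡ + 3 * T + p + + 1 → b ≡ + 3 * T + + 2 * p + + 2 → + 2 * b - a ≡ + 3 * T + + 3 * p + + 3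
    eq T p _ _ refl refl = solve (T ∷ p ∷ [])

  g≥0 : 0≤ + 2 * a - b
  g≥0 = via (nat 3 ⊠ nat (tri p)) (eq (+ tri p) (+ p) a b a≡ b≡)
    where
    eq : ∀ T p a b → a ≡ + 3 * T + p + + 1 → b ≡ + 3 * T + + 2 * p + + 2 → + 2 * a - b ≡ + 3 * T
    eq T p _ _ refl refl = solve (T ∷ p ∷ [])

  open Benzel a b 0<a 0<b f≥0 g≥0

  τ : ℕ → ℕ → ℕ
  τ I J = root p (suc (I ℕ.+ J))

  strip-root : ∀ I J → Root (+ p) (+ tri p) (+ suc (I ℕ.+ J)) (+ τ I J) (+ tri (τ I J))
  strip-root I J = root-Root p (suc (I ℕ.+ J)) (s≤s z≤n)

  private
    eq₁ : ∀ T I → T - + 1 - I ≡ T - (+ 1 + I)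
    eq₁ = solve-∀
    eq₂ : ∀ p T J → T + p - J ≡ + 1 + p + T - (+ 1 + J)
    eq₂ = solve-∀
    index≤2 : ∀ ro → 0≤ + 2 - + index ro
    index≤2 first  = nat 2
    index≤2 second = nat 1
    index≤2 third  = nat 0

  module Slot (I J : ℕ) (I<T : I ℕ.< tri p) (J<T′ : J ℕ.< tri (suc p)) (ro : Role) where
    open Strip (+ p) (+ tri p) (+ suc (I ℕ.+ J)) (+ τ I J) (+ tri (τ I J)) (2*tri p) T≥1 (strip-root I J) using (module Sound)
    open Sound (+ I) (+ J) (+ index ro) (nat I)
      (via (gap (+≤+ I<T)) (eq₁ (+ tri p) (+ I))) (nat J)
      (via (gap (+≤+ J<T′)) (eq₂ (+ p) (+ tri p) (+ J)))
      (nat (index ro)) (index≤2 ro) refl public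

  wAt vAt : ℕ → ℕ → ℤ → ℤ
  wAt I J r = r - + τ I J - + 3 - + 3 * + I
  vAt I J r = r - + τ I J - + 1 + + 3 * + J

  cellAt : Fin 3 → ℕ → ℕ → Role → Pt
  cellAt d I J ro = pt d (wAt I J (+ index ro)) (vAt I J (+ index ro))

  cellAt-benzel : ∀ d I J → I ℕ.< tri p → J ℕ.< tri (suc p) → ∀ ro → BenzelCell a b (cellAt d I J ro)
  cellAt-benzel d I J I<T J<T′ ro =
    pt-lattice d w v (+ suc (I ℕ.+ J)) v≡ ,
    cell← x y (subst₂ (λ A B → Within A B x y) (sym A≡) (sym B≡) (box→within d w v box))
    where
    open Slot I J I<T J<T′ ro
    x y : ℤ
    x = proj₁ (pt d w v)
    y = proj₂ (pt d w v)

  cellAt-sector : ∀ d I J → I ℕ.< tri p → J ℕ.< tri (suc p) → ∀ ro → InSector d (cellAt d I J ro)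
  cellAt-sector d I J I<T J<T′ ro = pt-sector d w v is-inner is-outer
    where open Slot I J I<T J<T′ ro

  boneAt : (d : Fin 3) (I J : ℕ) → I ℕ.< tri p → J ℕ.< tri (suc p) → Bone
  boneAt d I J I<T J<T′ = bone (cellAt d I J first) (proj₁ (cellAt-benzel d I J I<T J<T′ first)) (dir d)

  wAt-shift : ∀ I J r → wAt I J r ≡ wAt I J (+ 0) + r
  wAt-shift I J r = eq r (+ τ I J) (+ I)
    where
    eq : ∀ r τ I → r - τ - + 3 - + 3 * I ≡ + 0 - τ - + 3 - + 3 * I + r
    eq = solve-∀

  vAt-shift : ∀ I J r → vAt I J r ≡ vAt I J (+ 0) + r
  vAt-shift I J r = eq r (+ τ I J) (+ J)
    where
    eq : ∀ r τ J → r - τ - + 1 + + 3 * J ≡ + 0 - τ - + 1 + + 3 * J + r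
    eq = solve-∀

  second≡ : ∀ d I J → cellAt d I J second ≡ cellAt d I J first ⊕ dirVec (dir d)
  second≡ d I J = trans (cong₂ (pt d) (wAt-shift I J (+ 1)) (vAt-shift I J (+ 1))) (pt-second d (wAt I J (+ 0)) (vAt I J (+ 0)))

  third≡ : ∀ d I J → cellAt d I J third ≡ cellAt d I J first ⊕ scale (+ 2) (dirVec (dir d))
  third≡ d I J = trans (cong₂ (pt d) (wAt-shift I J (+ 2)) (vAt-shift I J (+ 2))) (pt-third d (wAt I J (+ 0)) (vAt I J (+ 0)))

  CellOf→ : ∀ {c} d I J I<T J<T′ → CellOf c (boneAt d I J I<T J<T′) → ∃[ ro ] c ≡ cellAt d I J ro
  CellOf→ d I J _ _ (inj₁ eq)        = first , eq
  CellOf→ d I J _ _ (inj₂ (inj₁ eq)) = second , trans eq (sym (second≡ d I J))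
  CellOf→ d I J _ _ (inj₂ (inj₂ eq)) = third , trans eq (sym (third≡ d I J))

  CellOf← : ∀ {c} d I J I<T J<T′ ro → c ≡ cellAt d I J ro → CellOf c (boneAt d I J I<T J<T′)
  CellOf← d I J _ _ first  eq = inj₁ eq
  CellOf← d I J _ _ second eq = inj₂ (inj₁ (trans eq (second≡ d I J)))
  CellOf← d I J _ _ third  eq = inj₂ (inj₂ (trans eq (third≡ d I J)))

  module _ (w v u μ : ℤ) (v≡ : v ≡ w + + 3 * μ - + 1) (sum : w + v + u ≡ + 0)
    (box : Box (+ 3 * + tri p + + p) (+ 3 * + tri p + + 2 * + p + + 1) w v u) (inn : Inner w v) (out : Outer v u) where

    locate : ∃[ I ] ∃[ J ] ∃[ ro ] I ℕ.< tri p × J ℕ.< tri (suc p) × w ≡ wAt I J (+ index ro) × v ≡ vAt I J (+ index ro)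
    locate = on-line (μ - + 1) refl (line-positive w v u μ v≡ sum inn out)
      where
      Located : Set
      Located = ∃[ I ] ∃[ J ] ∃[ ro ] I ℕ.< tri p × J ℕ.< tri (suc p) × w ≡ wAt I J (+ index ro) × v ≡ vAt I J (+ index ro)
      on-line : ∀ i → i ≡ μ - + 1 → 0≤ i → Located
      -- The position of the cell on its line is v + τ + 1; its quotient by 3 is `J` and its
      -- remainder is the role in the bone. Matching on nonnegative integers produces the natural
      -- numbers.
      on-line (+ m) m≡ _ = divide (v + + ρ + + 1) refl e
        where
        ρ : ℕ
        ρ = root p (suc m)
        μ≡ : μ ≡ + suc m
        μ≡ = trans (eq μ) (cong (λ i → + 1 + i) (sym m≡))
          where
          eq : ∀ μ → μ ≡ + 1 + (μ - + 1)
          eq = solve-∀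
        open Strip (+ p) (+ tri p) (+ suc m) (+ ρ) (+ tri ρ) (2*tri p) T≥1 (root-Root p (suc m) (s≤s z≤n)) using (module Cover)
        open Cover w v u (trans v≡ (cong (λ i → w + + 3 * i - + 1) μ≡)) sum box inn out
        role : ∀ r → r ℕ.< 3 → ∃[ ro ] r ≡ index ro
        role 0 _ = first , refl
        role 1 _ = second , refl
        role 2 _ = third , refl
        role (suc (suc (suc _))) (s≤s (s≤s (s≤s ())))
        divide : ∀ i → i ≡ v + + ρ + + 1 → 0≤ i → Located
        divide (+ n) n≡ _ with role (n ℕ.% 3) (m%n<n n 3)
        ... | ro , ro≡ = fill (+ suc m - + 1 - + J) refl (I≥0 (+ J) (+ index ro) vτ (nat (index ro)) r≤2)
          where
          J : ℕ
          J = n ℕ./ 3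
          vτ : v + + ρ + + 1 ≡ + index ro + + 3 * + J
          vτ = trans (sym n≡) (trans (cong +_ (trans (m≡m%n+[m/n]*n n 3) (cong₂ ℕ._+_ ro≡ (ℕₚ.*-comm J 3))))
                                     (cong (λ i → + index ro + i) (ℤₚ.pos-* 3 J)))
          r≤2 : 0≤ + 2 - + index ro
          r≤2 = gap (+≤+ (ℕₚ.≤-pred (subst (ℕ._< 3) ro≡ (m%n<n n 3))))
          fill : ∀ i → i ≡ + suc m - + 1 - + J → 0≤ i → Located
          fill (+ I) i≡ _ = I , J , ro , I<tri , J<tri , w-form′ , v-form′
            where
            r≥0 : 0≤ + index ro
            r≥0 = nat (index ro)
            I<tri : I ℕ.< tri p
            I<tri = ℤₚ.drop‿+≤+ (ungap (via (I<T (+ J) (+ index ro) vτ r≥0 r≤2)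
              (trans (eq (+ tri p) (+ I)) (cong (λ i → + tri p - + 1 - i) i≡))))
              where
              eq : ∀ T I → T - (+ 1 + I) ≡ T - + 1 - I
              eq = solve-∀
            J<tri : J ℕ.< tri (suc p)
            J<tri = ℤₚ.drop‿+≤+ (ungap (via (J<T′ (+ J) (+ index ro) vτ r≥0 r≤2) (eq (+ p) (+ tri p) (+ J))))
              where
              eq : ∀ p T J → + 1 + p + T - (+ 1 + J) ≡ T + p - J
              eq = solve-∀
            m≡I+J : m ≡ I ℕ.+ J
            m≡I+J = ℤₚ.+-injective (trans (eq (+ m) (+ J)) (cong (λ i → i + + J) (sym i≡)))
              where
              eq : ∀ m J → m ≡ + 1 + m - + 1 - J + J
              eq = solve-∀
            ρ≡ : + ρ ≡ + τ I J
            ρ≡ = cong (λ i → + root p (suc i)) m≡I+J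
            v-form′ : v ≡ vAt I J (+ index ro)
            v-form′ = trans (v-form (+ J) (+ index ro) vτ r≥0 r≤2) (cong (λ i → + index ro - i - + 1 + + 3 * + J) ρ≡)
            w-form′ : w ≡ wAt I J (+ index ro)
            w-form′ = trans (w-form (+ J) (+ index ro) vτ r≥0 r≤2)
              (cong₂ (λ i j → + index ro - i - + 3 - + 3 * j) ρ≡ (sym i≡))

  -- The difference v - w determines I + J, hence the line and its τ; then v determines `J` by
  -- division by 3.
  slot-unique : ∀ I J I′ J′ ro ro′ →
    wAt I J (+ index ro) ≡ wAt I′ J′ (+ index ro′) → vAt I J (+ index ro) ≡ vAt I′ J′ (+ index ro′) → I ≡ I′ × J ≡ J′
  slot-unique I J I′ J′ ro ro′ w≡ v≡ = I≡ , J≡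
    where
    line : I ℕ.+ J ≡ I′ ℕ.+ J′
    line = ℤₚ.+-injective (ℤₚ.*-cancelˡ-≡ (+ 3) (+ (I ℕ.+ J)) (+ (I′ ℕ.+ J′)) (begin
      + 3 * (+ I + + J)                                            ≡⟨ eq (+ index ro) (+ τ I J) (+ I) (+ J) ⟩
      vAt I J (+ index ro) - wAt I J (+ index ro) - + 2            ≡⟨ cong₂ (λ i j → i - j - + 2) v≡ w≡ ⟩
      vAt I′ J′ (+ index ro′) - wAt I′ J′ (+ index ro′) - + 2      ≡⟨ eq (+ index ro′) (+ τ I′ J′) (+ I′) (+ J′) ⟨
      + 3 * (+ I′ + + J′)                                          ∎))
      where
      open ≡-Reasoning
      eq : ∀ r τ I J → + 3 * (I + J) ≡ r - τ - + 1 + + 3 * J - (r - τ - + 3 - + 3 * I) - + 2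
      eq = solve-∀
    τ≡ : + τ I J ≡ + τ I′ J′
    τ≡ = cong (λ i → + root p (suc i)) line
    r+3J : index ro ℕ.+ J ℕ.* 3 ≡ index ro′ ℕ.+ J′ ℕ.* 3
    r+3J = ℤₚ.+-injective (begin
      + index ro + + (J ℕ.* 3)                        ≡⟨ cong (λ i → + index ro + i) (ℤₚ.pos-* J 3) ⟩
      + index ro + + J * + 3                          ≡⟨ eq (+ index ro) (+ τ I J) (+ J) ⟩
      vAt I J (+ index ro) + + τ I J + + 1            ≡⟨ cong₂ (λ i j → i + j + + 1) v≡ τ≡ ⟩
      vAt I′ J′ (+ index ro′) + + τ I′ J′ + + 1       ≡⟨ eq (+ index ro′) (+ τ I′ J′) (+ J′) ⟨
      + index ro′ + + J′ * + 3                        ≡⟨ cong (λ i → + index ro′ + i) (ℤₚ.pos-* J′ 3) ⟨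
      + index ro′ + + (J′ ℕ.* 3)                      ∎)
      where
      open ≡-Reasoning
      eq : ∀ r τ J → r + J * + 3 ≡ r - τ - + 1 + + 3 * J + τ + + 1
      eq = solve-∀
    quotient : ∀ r J → (r ≡ 0 ⊎ r ≡ 1 ⊎ r ≡ 2) → (r ℕ.+ J ℕ.* 3) ℕ./ 3 ≡ J
    quotient r J r<3 = trans (+-distrib-/-∣ʳ r (n∣m*n J)) (cong₂ ℕ._+_ (small r<3) (m*n/n≡m J 3))
      where
      small : ∀ {r} → (r ≡ 0 ⊎ r ≡ 1 ⊎ r ≡ 2) → r ℕ./ 3 ≡ 0
      small (inj₁ refl)        = refl
      small (inj₂ (inj₁ refl)) = refl
      small (inj₂ (inj₂ refl)) = refl
    index<3 : ∀ ro → index ro ≡ 0 ⊎ index ro ≡ 1 ⊎ index ro ≡ 2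
    index<3 first  = inj₁ refl
    index<3 second = inj₂ (inj₁ refl)
    index<3 third  = inj₂ (inj₂ refl)
    J≡ : J ≡ J′
    J≡ = trans (sym (quotient (index ro) J (index<3 ro))) (trans (cong (ℕ._/ 3) r+3J) (quotient (index ro′) J′ (index<3 ro′)))
    I≡ : I ≡ I′
    I≡ = ℕₚ.+-cancelʳ-≡ J I I′ (trans line (cong (I′ ℕ.+_) (sym J≡)))

  -- Counting bones from the two ends of their line makes each sector a full rectangle of index
  -- pairs, although its lines have different lengths and offsets.
  count : ℕ
  count = 3 ℕ.* (tri p ℕ.* tri (suc p))

  sector : Fin count → Fin 3
  sector i = proj₁ (remQuot {3} (tri p ℕ.* tri (suc p)) i)

  row : Fin count → Fin (tri p)
  row i = proj₁ (remQuot (tri (suc p)) (proj₂ (remQuot {3} (tri p ℕ.* tri (suc p)) i)))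

  column : Fin count → Fin (tri (suc p))
  column i = proj₂ (remQuot {tri p} (tri (suc p)) (proj₂ (remQuot {3} (tri p ℕ.* tri (suc p)) i)))

  encode : Fin 3 → Fin (tri p) → Fin (tri (suc p)) → Fin count
  encode d I J = combine d (combine I J)

  encode-decode : ∀ i → encode (sector i) (row i) (column i) ≡ i
  encode-decode i = trans
    (cong (combine (sector i)) (combine-remQuot {tri p} (tri (suc p)) (proj₂ (remQuot {3} (tri p ℕ.* tri (suc p)) i))))
    (combine-remQuot {3} (tri p ℕ.* tri (suc p)) i)

  sector-encode : ∀ d I J → sector (encode d I J) ≡ d
  sector-encode d I J = cong proj₁ (remQuot-combine d (combine I J))

  row-encode : ∀ d I J → row (encode d I J) ≡ I
  row-encode d I J = trans (cong (λ s → proj₁ (remQuot {tri p} (tri (suc p)) (proj₂ s))) (remQuot-combine d (combine I J)))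
    (cong proj₁ (remQuot-combine I J))

  column-encode : ∀ d I J → column (encode d I J) ≡ J
  column-encode d I J = trans (cong (λ s → proj₂ (remQuot {tri p} (tri (suc p)) (proj₂ s))) (remQuot-combine d (combine I J)))
    (cong proj₂ (remQuot-combine I J))

  bones : Fin count → Bone
  bones i = boneAt (sector i) (toℕ (row i)) (toℕ (column i)) (toℕ<n (row i)) (toℕ<n (column i))

  bones-cell : ∀ i {c} → CellOf c (bones i) → ∃[ ro ] c ≡ cellAt (sector i) (toℕ (row i)) (toℕ (column i)) ro
  bones-cell i = CellOf→ (sector i) (toℕ (row i)) (toℕ (column i)) (toℕ<n (row i)) (toℕ<n (column i))

  contained : ∀ i c → CellOf c (bones i) → BenzelCell a b c
  contained i c c∈ = let ro , eq = bones-cell i c∈ in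
    subst (BenzelCell a b) (sym eq)
      (cellAt-benzel (sector i) (toℕ (row i)) (toℕ (column i)) (toℕ<n (row i)) (toℕ<n (column i)) ro)

  bones-sector : ∀ i {c} → CellOf c (bones i) → InSector (sector i) c
  bones-sector i c∈ = let ro , eq = bones-cell i c∈ in
    subst (InSector (sector i)) (sym eq)
      (cellAt-sector (sector i) (toℕ (row i)) (toℕ (column i)) (toℕ<n (row i)) (toℕ<n (column i)) ro)

  same-sector : ∀ d I J I′ J′ ro ro′ → cellAt d I J ro ≡ cellAt d I′ J′ ro′ → I ≡ I′ × J ≡ J′
  same-sector d I J I′ J′ ro ro′ eq = slot-unique I J I′ J′ ro ro′
    (trans (sym (co₁-pt d w v)) (trans (cong (co₁ d) eq) (co₁-pt d w′ v′)))
    (trans (sym (co₂-pt d w v)) (trans (cong (co₂ d) eq) (co₂-pt d w′ v′)))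
    where
    w v w′ v′ : ℤ
    w = wAt I J (+ index ro)
    v = vAt I J (+ index ro)
    w′ = wAt I′ J′ (+ index ro′)
    v′ = vAt I′ J′ (+ index ro′)

  bones-disjoint : ∀ i j c → CellOf c (bones i) → CellOf c (bones j) → j ≡ i
  bones-disjoint i j c i∋c j∋c = begin
    j                                          ≡⟨ encode-decode j ⟨
    encode (sector j) (row j) (column j)       ≡⟨ cong₂ (λ d I → encode d I (column j)) d≡ (toℕ-injective (proj₁ slots)) ⟩
    encode (sector i) (row i) (column j)       ≡⟨ cong (encode (sector i) (row i)) (toℕ-injective (proj₂ slots)) ⟩
    encode (sector i) (row i) (column i)       ≡⟨ encode-decode i ⟩
    i                                          ∎
    where
    open ≡-Reasoning
    d≡ : sector j ≡ sector i
    d≡ = sector-unique c (sector j) (sector i) (bones-sector j j∋c) (bones-sector i i∋c)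
    cell-i = bones-cell i i∋c
    cell-j = bones-cell j j∋c
    slots : toℕ (row j) ≡ toℕ (row i) × toℕ (column j) ≡ toℕ (column i)
    slots = same-sector (sector i) (toℕ (row j)) (toℕ (column j)) (toℕ (row i)) (toℕ (column i)) (proj₁ cell-j) (proj₁ cell-i)
      (trans (cong (λ d → cellAt d (toℕ (row j)) (toℕ (column j)) (proj₁ cell-j)) (sym d≡))
             (trans (sym (proj₂ cell-j)) (proj₂ cell-i)))

  covered : ∀ c → BenzelCell a b c → ∃[ i ] CellOf c (bones i)
  covered c@(x , y) benz = in-sector (sector-exists c q q≡)
    where
    3∣ = ∣ᵤ⇒∣ {+ 3} {x + y + + 1} (proj₁ benz)
    q : ℤ
    q = _∣_.quotient 3∣
    q≡ : x + y + + 1 ≡ q * + 3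
    q≡ = _∣_.equality 3∣
    in-sector : ∃[ d ] InSector d c → ∃[ i ] CellOf c (bones i)
    in-sector (d , inn , out) = encode d I J , CellOf← (sector e) (toℕ (row e)) (toℕ (column e)) (toℕ<n (row e)) (toℕ<n (column e)) ro c≡
      where
      line = co-line d c q q≡
      box : Box (+ 3 * + tri p + + p) (+ 3 * + tri p + + 2 * + p + + 1) (co₁ d c) (co₂ d c) (co₃ d c)
      box = within→box d c (subst₂ (λ A B → Within A B x y) A≡ B≡ (cell→ x y (proj₂ benz)))
      located = locate (co₁ d c) (co₂ d c) (co₃ d c) (proj₁ line) (proj₂ line) (co-sum d c) box inn out
      I₀ J₀ : ℕ
      I₀ = proj₁ located
      J₀ = proj₁ (proj₂ located)
      ro : Role
      ro = proj₁ (proj₂ (proj₂ located))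
      I<T = proj₁ (proj₂ (proj₂ (proj₂ located)))
      J<T′ = proj₁ (proj₂ (proj₂ (proj₂ (proj₂ located))))
      w≡ = proj₁ (proj₂ (proj₂ (proj₂ (proj₂ (proj₂ located)))))
      v≡ = proj₂ (proj₂ (proj₂ (proj₂ (proj₂ (proj₂ located)))))
      I : Fin (tri p)
      I = fromℕ< I<T
      J : Fin (tri (suc p))
      J = fromℕ< J<T′
      e : Fin count
      e = encode d I J
      c≡ : c ≡ cellAt (sector e) (toℕ (row e)) (toℕ (column e)) ro
      c≡ = begin
        c                                        ≡⟨ pt-co d c ⟩
        pt d (co₁ d c) (co₂ d c)                 ≡⟨ cong₂ (pt d) w≡ v≡ ⟩
        cellAt d I₀ J₀ ro                        ≡⟨ cong₂ (λ i j → cellAt d i j ro) (toℕ-fromℕ< I<T) (toℕ-fromℕ< J<T′) ⟨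
        cellAt d (toℕ I) (toℕ J) ro              ≡⟨ cong₂ (λ i j → cellAt d (toℕ i) (toℕ j) ro) (row-encode d I J) (column-encode d I J) ⟨
        cellAt d (toℕ (row e)) (toℕ (column e)) ro   ≡⟨ cong (λ d → cellAt d (toℕ (row e)) (toℕ (column e)) ro) (sector-encode d I J) ⟨
        cellAt (sector e) (toℕ (row e)) (toℕ (column e)) ro ∎
        where open ≡-Reasoning

  tiling : BenzelTileable a b
  tiling = count , bones , contained , λ c benz →
    let i , i∋c = covered c benz in i , i∋c , λ j j∋c → bones-disjoint i j c i∋c j∋c

-- The reflection exchanging a and b

transpose : Pt → Pt
transpose (x , y) = y , x

mirror : Dir → Dir
mirror d₁ = d₂
mirror d₂ = d₁
mirror d₃ = d₆
mirror d₄ = d₅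
mirror d₅ = d₄
mirror d₆ = d₃

transpose-dirVec : ∀ d → transpose (dirVec d) ≡ dirVec (mirror d)
transpose-dirVec d₁ = refl
transpose-dirVec d₂ = refl
transpose-dirVec d₃ = refl
transpose-dirVec d₄ = refl
transpose-dirVec d₅ = refl
transpose-dirVec d₆ = refl

transpose-InL-1 : ∀ c → InL-1 c → InL-1 (transpose c)
transpose-InL-1 (x , y) = subst (λ i → + 3 ∣ i + + 1) (ℤₚ.+-comm x y)

mirrorBone : Bone → Bone
mirrorBone (bone α α∈ d) = bone (transpose α) (transpose-InL-1 α α∈) (mirror d)

CellOf-mirror : ∀ {c} β → CellOf c β → CellOf (transpose c) (mirrorBone β)
CellOf-mirror (bone α _ d) = ⊎-map (cong transpose) (⊎-map
  (λ eq → trans (cong transpose eq) (cong (transpose α ⊕_) (transpose-dirVec d)))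
  (λ eq → trans (cong transpose eq) (cong (λ v → transpose α ⊕ scale (+ 2) v) (transpose-dirVec d))))

CellOf-unmirror : ∀ {c} β → CellOf c (mirrorBone β) → CellOf (transpose c) β
CellOf-unmirror (bone α _ d) = ⊎-map (cong transpose) (⊎-map
  (λ eq → trans (cong transpose eq) (cong (λ v → α ⊕ transpose v) (sym (transpose-dirVec d))))
  (λ eq → trans (cong transpose eq) (cong (λ v → α ⊕ scale (+ 2) (transpose v)) (sym (transpose-dirVec d)))))

-- Transposition takes (u, v, w) to (-v, -u, -w), so lower and upper bounds change places.
Within-transpose : ∀ {A B} x y → Within A B x y → Within B A y x
Within-transpose {A} {B} x y (within au av aw bu bv bw) = within
  (via bv (solve (B ∷ y ∷ []))) bu (via bw (solve (B ∷ x ∷ y ∷ [])))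
  av (via au (solve (A ∷ x ∷ []))) (via aw (solve (A ∷ x ∷ y ∷ [])))

module Mirror (a b : ℤ) (0<a : 0≤ a - + 1) (0<b : 0≤ b - + 1) (f≥0 : 0≤ + 2 * b - a) (g≥0 : 0≤ + 2 * a - b) where

  private
    module AB = Benzel a b 0<a 0<b f≥0 g≥0
    module BA = Benzel b a 0<b 0<a g≥0 f≥0

  BenzelCell-transpose : ∀ c → BenzelCell a b c → BenzelCell b a (transpose c)
  BenzelCell-transpose c@(x , y) (c∈ , cell) =
    transpose-InL-1 c c∈ , BA.cell← y x (Within-transpose x y (AB.cell→ x y cell))

  BenzelCell-untranspose : ∀ c → BenzelCell b a c → BenzelCell a b (transpose c)
  BenzelCell-untranspose c@(x , y) (c∈ , cell) =
    transpose-InL-1 c c∈ , AB.cell← y x (Within-transpose x y (BA.cell→ x y cell))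

  mirrored : BenzelTileable a b → BenzelTileable b a
  mirrored (n , bones , contained , covered) = n , (λ i → mirrorBone (bones i)) ,
    (λ i c c∈ → BenzelCell-transpose (transpose c) (contained i (transpose c) (CellOf-unmirror (bones i) c∈))) ,
    λ c benz → let i , c∈ , unique = covered (transpose c) (BenzelCell-untranspose c benz) in
      i , CellOf-mirror (bones i) c∈ , λ j c∈ⱼ → unique j (CellOf-unmirror (bones j) c∈ⱼ)

module Pentagonal (p : ℕ) (1≤p : 1 ℕ.≤ p) (a b : ℤ)
  (2a : + 2 * a ≡ + suc p * (+ 3 * + suc p - + 1)) (2b : + 2 * b ≡ + suc p * (+ 3 * + suc p + + 1)) where

  a≡ : a ≡ + 3 * + tri p + + p + + 1
  a≡ = ℤₚ.*-cancelˡ-≡ (+ 2) a (+ 3 * + tri p + + p + + 1) (trans 2a (eq (+ p) (+ tri p) (2*tri p)))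
    where
    eq : ∀ p T → + 2 * T ≡ p * (p + + 1) → (+ 1 + p) * (+ 3 * (+ 1 + p) - + 1) ≡ + 2 * (+ 3 * T + p + + 1)
    eq p T 2T = begin
      (+ 1 + p) * (+ 3 * (+ 1 + p) - + 1)      ≡⟨ solve (p ∷ []) ⟩
      + 3 * (p * (p + + 1)) + + 2 * p + + 2    ≡⟨ cong (λ i → + 3 * i + + 2 * p + + 2) 2T ⟨
      + 3 * (+ 2 * T) + + 2 * p + + 2          ≡⟨ solve (p ∷ T ∷ []) ⟩
      + 2 * (+ 3 * T + p + + 1)                ∎
      where open ≡-Reasoning

  b≡ : b ≡ + 3 * + tri p + + 2 * + p + + 2
  b≡ = ℤₚ.*-cancelˡ-≡ (+ 2) b (+ 3 * + tri p + + 2 * + p + + 2) (trans 2b (eq (+ p) (+ tri p) (2*tri p)))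
    where
    eq : ∀ p T → + 2 * T ≡ p * (p + + 1) → (+ 1 + p) * (+ 3 * (+ 1 + p) + + 1) ≡ + 2 * (+ 3 * T + + 2 * p + + 2)
    eq p T 2T = begin
      (+ 1 + p) * (+ 3 * (+ 1 + p) + + 1)      ≡⟨ solve (p ∷ []) ⟩
      + 3 * (p * (p + + 1)) + + 4 * p + + 4    ≡⟨ cong (λ i → + 3 * i + + 4 * p + + 4) 2T ⟨
      + 3 * (+ 2 * T) + + 4 * p + + 4          ≡⟨ solve (p ∷ T ∷ []) ⟩
      + 2 * (+ 3 * T + + 2 * p + + 2)          ∎
      where open ≡-Reasoning

  open Tiling p a b a≡ b≡ (gap (+≤+ (tri-mono 1≤p))) public

theorem3 : (a b : ℤ) → + 2 ≤ a → a ≤ + 2 * b → + 2 ≤ b → b ≤ + 2 * a →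
    BenzelTileable a b ⇔
    (∃ λ (k : ℤ) → + 2 ≤ k ×
    ((+ 2 * a ≡ k * (+ 3 * k - + 1) × + 2 * b ≡ k * (+ 3 * k + + 1)) ⊎
    (+ 2 * a ≡ k * (+ 3 * k + + 1) × + 2 * b ≡ k * (+ 3 * k - + 1))))
theorem3 a b 2≤a a≤2b 2≤b b≤2a = mk⇔
  (λ (_ , tiling) → Necessity.necessity a b (gap 2≤a) (gap 2≤b) (gap a≤2b) (gap b≤2a) tiling)
  sufficiency
  where
  sufficiency : PairedPentagonal a b → BenzelTileable a b
  sufficiency (+ suc p , +≤+ (s≤s 1≤p) , equations) =
    [ (λ (2a , 2b) → Pentagonal.tiling p 1≤p a b 2a 2b)
    -- The sectors are tiled for a < b; in this case a and b are exchanged and the tiling is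
    -- reflected.
    , (λ (2a , 2b) → let open Pentagonal p 1≤p b a 2b 2a in Mirror.mirrored b a 0<a 0<b f≥0 g≥0 tiling)
    ]′ equations
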